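{- For positive integers $n$ and $m$ with $m\le n$, let $r(n,m)$ denote the number of forest chord diagrams with $n$ chords whose intersection graph has exactly $m$ connected components (trees), each tree being rooted (i.e., counted together with a choice of one distinguished chord in each connected component of the intersection graph). Then \[ r(n,m)=\frac{1}{m}\binom{2n}{m-1}\big(\Sigma_1+\Sigma_2\big), \] where \[ \Sigma_1=\sum_{k=0}^{m}\sum_{j=0}^{n-m-1}(-1)^k\binom{m}{k}\binom{m+j-1}{j}2^{m-k}3^j\,\frac{2j+k}{n-m-j}\binom{3n-3m+k-j-1}{n-m-j-1} \] and \[ \Sigma_2=\sum_{k=0}^{m}(-1)^k\binom{m}{k}\binom{n-1}{n-m}2^{m-k}3^{n-m}. \]
   Context: A chord diagram of size $n$ is a perfect matching (pairing) of the $2n$ points labeled $1,\dots,2n$, placed in clockwise order on a circle; each pair is drawn as a chord. Two chord diagrams are the same exactly when they are the same pairing of $\{1,\dots,2n\}$. Two chords $\{a,c\}$ and $\{b,d\}$ with $a<c$, $b<d$ cross if $a<b<c<d$ or $b<a<d<c$. The intersection graph $G_{\mathcal C}$ of a chord diagram $\mathcal C$ has the chords of $\mathcal C$ as vertices, two vertices being adjacent iff the corresponding chords cross. $\mathcal C$ is a forest chord diagram if $G_{\mathcal C}$ is a forest (acyclic graph). Empty sums (e.g. when $n=m$) are $0$. -}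

module Defs where

open import Data.Bool using (Bool; true; false; _∧_; _∨_; not; if_then_else_; T)
open import Data.Nat as ℕ using (ℕ; zero; suc; _∸_; NonZero)
open import Data.Nat.Combinatorics using (_C_)
open import Data.Fin as Fin using (Fin; toℕ)
open import Data.Fin.Subset using (Subset; _∈_)
open import Data.List as List using (List; []; _∷_; allFin; upTo; concatMap; map; filter; length; foldr)
open import Data.Bool.ListAction using (any; all)
open import Data.Vec as Vec using (Vec; []; _∷_; lookup; toList)
open import Data.Product using (_×_; _,_; proj₁; proj₂)
open import Relation.Nullary.Decidable using (⌊_⌋)
open import Data.Integer as ℤ using (ℤ; +_)
open import Data.Rational as ℚ using (ℚ; 0ℚ)

allVecs : ∀ {N} k → List (Vec (Fin N) k)
allVecs zero    = [] ∷ []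
allVecs {N} (suc k) = concatMap (λ x → map (x ∷_) (allVecs k)) (allFin N)

allSubsets : ∀ k → List (Vec Bool k)
allSubsets zero    = [] ∷ []
allSubsets (suc k) = concatMap (λ b → map (b ∷_) (allSubsets k)) (true ∷ false ∷ [])

countB : ∀ {A : Set} → (A → Bool) → List A → ℕ
countB p xs = length (filter (λ x → Relation.Nullary.Decidable.Core.T? (p x)) xs)
  where import Relation.Nullary.Decidable.Core

_==_ : ∀ {N} → Fin N → Fin N → Bool
i == j = ⌊ i Fin.≟ j ⌋

_<ᵇ_ : ∀ {N} → Fin N → Fin N → Bool
i <ᵇ j = ⌊ i Fin.<? j ⌋

-- Chord diagrams with n chords on the points 0,…,2n-1 (the paper's
-- points 1,…,2n, shifted by one; clockwise order = numeric order).
-- A pairing is represented by its fixed-point-free involution p,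
-- stored as a vector (so two diagrams are equal iff same pairing).

Pts : ℕ → ℕ
Pts n = 2 ℕ.* n

Inv : ℕ → Set
Inv n = Vec (Fin (Pts n)) (Pts n)

module _ {n : ℕ} (p : Inv n) where
  private
    N = Pts n
    pt : Fin N → Fin N
    pt i = lookup p i

  isMatching : Bool
  isMatching = all (λ i → (pt (pt i) == i) ∧ not (pt i == i)) (allFin N)

  -- the chord {i , p i} is represented by its smaller endpoint i;
  -- these representatives are the vertices of the intersection graph
  isChord : Fin N → Bool
  isChord i = i <ᵇ pt i

  crosses : Fin N → Fin N → Bool
  crosses a b = ((a <ᵇ b) ∧ (b <ᵇ pt a) ∧ (pt a <ᵇ pt b))
              ∨ ((b <ᵇ a) ∧ (a <ᵇ pt b) ∧ (pt b <ᵇ pt a))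

  adj : Fin N → Fin N → Bool
  adj a b = isChord a ∧ isChord b ∧ crosses a b

  private
    distinct : List (Fin N) → Bool
    distinct []       = true
    distinct (x ∷ xs) = not (any (x ==_) xs) ∧ distinct xs

    path : Fin N → List (Fin N) → Bool
    path x []       = true
    path x (y ∷ ys) = adj x y ∧ path y ys

    lastOf : Fin N → List (Fin N) → Fin N
    lastOf x []       = x
    lastOf x (y ∷ ys) = lastOf y ys

  isCycle : List (Fin N) → Bool
  isCycle []       = false
  isCycle (x ∷ xs) = ⌊ 3 ℕ.≤? suc (length xs) ⌋ ∧ distinct (x ∷ xs)
                     ∧ path x xs ∧ adj (lastOf x xs) x

  -- G_C contains a cycle (cycles have length ≤ number of vertices ≤ N)
  hasCycle : Bool
  hasCycle = any (λ k → any (λ v → isCycle (toList v)) (allVecs {N} k)) (upTo (suc N))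

  isForest : Bool
  isForest = not hasCycle

  reachIn : ℕ → Fin N → Fin N → Bool
  reachIn zero    i j = i == j
  reachIn (suc k) i j = reachIn k i j ∨ any (λ l → adj i l ∧ reachIn k l j) (allFin N)

  connected : Fin N → Fin N → Bool
  connected i j = isChord i ∧ isChord j ∧ reachIn N i j

  components : ℕ
  components = countB (λ v → isChord v ∧ not (any (λ u → (u <ᵇ v) ∧ connected u v) (allFin N)))
                      (allFin N)

  isRooting : Subset N → Bool
  isRooting R = all (λ r → not (lookup R r) ∨ isChord r) (allFin N)
              ∧ all (λ v → not (isChord v)
                           ∨ ⌊ countB (λ r → lookup R r ∧ connected v r) (allFin N) ℕ.≟ 1 ⌋)
                    (allFin N)

r : ℕ → ℕ → ℕ
r n m = countB (λ pR → rootedOK (proj₁ pR) (proj₂ pR))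
               (concatMap (λ p → map (p ,_) (allSubsets (Pts n))) (allVecs {Pts n} (Pts n)))
  where
  rootedOK : Inv n → Subset (Pts n) → Bool
  rootedOK p R = isMatching {n} p ∧ isForest {n} p ∧ ⌊ components {n} p ℕ.≟ m ⌋ ∧ isRooting {n} p R

sumL : List ℚ → ℚ
sumL = foldr ℚ._+_ 0ℚ

sgn : ℕ → ℤ
sgn k = (ℤ.- (+ 1)) ℤ.^ k

-- Σ₁ ; j ranges over 0,…,n-m-1 = upTo (n ∸ m), and the denominator
-- n-m-j is written suc (n ∸ m ∸ suc j), which equals n-m-j there.
Σ₁ : ℕ → ℕ → ℚ
Σ₁ n m = sumL (map (λ k → sumL (map (λ j →
    (sgn k ℤ.* + ((m C k) ℕ.* ((m ℕ.+ j ∸ 1) C j) ℕ.* (2 ℕ.^ (m ∸ k)) ℕ.* (3 ℕ.^ j)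
                  ℕ.* (2 ℕ.* j ℕ.+ k)
                  ℕ.* ((3 ℕ.* n ∸ 3 ℕ.* m ℕ.+ k ∸ j ∸ 1) C (n ∸ m ∸ j ∸ 1))))
    ℚ./ suc (n ∸ m ∸ suc j))
  (upTo (n ∸ m)))) (upTo (suc m)))

Σ₂ : ℕ → ℕ → ℚ
Σ₂ n m = sumL (map (λ k →
    (sgn k ℤ.* + ((m C k) ℕ.* ((n ∸ 1) C (n ∸ m)) ℕ.* (2 ℕ.^ (m ∸ k)) ℕ.* (3 ℕ.^ (n ∸ m)))) ℚ./ 1)
  (upTo (suc m)))

{-# OPTIONS --safe #-}
module Submission where

-- Read the 2n points in order.  For the chords seen so far, the components containing an open chord
-- occupy intervals of the stack of open chords, and closing a chord crossed by j open chords creates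
-- no cycle exactly when these j chords are alone in their intervals and it is the top of the next one.
-- Rooted forest diagrams are thus the accepting runs (histories) of a stack automaton whose states
-- are the lists of interval sizes, each with the number of marked chords of its component.
-- The generating function of the runs ending in a given state is a product over its intervals.
-- With B = 1 + x B³ and H(X) = Σ (k + 1) [x^k]B · X^{2k+2}, the series of trees with a
-- marked chord, Lagrange inversion gives m r(n,m) = C(2n, m-1) [X^{2n}] H^m, and the coefficients of
-- H^m follow from H = X² (2 - B) / (1 - 3 X² B²), where B is evaluated at X².

-- Whether two open chords cross is unknown until one of them closes, so edges enter the graph at
-- closing times: the closing chord is joined to exactly the open chords that were opened after it.
-- A cycle arises if two of these already lie in one component, or if one of them lies in the
-- component of the closing chord; hence each must be alone in its interval. Of an unfinished
-- component only the numbers of open chords and of marks then matter. As long as no component is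
-- finished, the runs of length ℓ ending in a state are counted by the coefficient of `X^ℓ` in the
-- product over intervals. A finished component leaves the state, which breaks the product formula:
-- the components form a noncrossing partition of the points, and `C(2n, m-1) / m` is Kreweras's
-- number of noncrossing partitions for each ordered list of block sizes. A linear functional on
-- series, scaled by ℓ + 1 to avoid division, carries both effects through one induction. `Σ₂` is
-- the term `j = n - m` missing from `Σ₁`: there the quotient in Raney's formula has denominator 0,
-- although the coefficient it computes is 1.

open import Defs
open import Level using (0ℓ)
open import Algebra.Bundles using (CommutativeRing)
open import Data.Integer using (+_)
open import Data.Nat as ℕ using (ℕ; zero; suc; _≤_; _∸_; NonZero)
import Data.Nat.Properties as ℕ
open import Data.Nat.Combinatorics using (_C_; nCk+nC[k+1]≡[n+1]C[k+1]; k>n⇒nCk≡0)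
open import Data.Product using (Σ; ∃; _×_; _,_; proj₁; proj₂)
open import Function using (_∘_; id; _↔_; mk↔ₛ′; _⇔_; mk⇔; Equivalence; Inverse)
open import Relation.Binary.PropositionalEquality as ≡ using (_≡_)
import Relation.Binary.Reasoning.Setoid as SetoidReasoning

-- Formal power series

module PowerSeries (A : CommutativeRing 0ℓ 0ℓ) where
  open CommutativeRing A
  open SetoidReasoning setoid

  private
    open import Algebra.Solver.Ring.NaturalCoefficients.Default commutativeSemiring
      using (solve; _:=_; _:+_; _:*_)

    interchange : ∀ a b c d → (a + b) + (c + d) ≈ (a + c) + (b + d)
    interchange = solve 4 (λ a b c d → ((a :+ b) :+ (c :+ d)) := ((a :+ c) :+ (b :+ d))) refl

    shuffle : ∀ a b c → a + (b + c) ≈ b + (a + c)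
    shuffle = solve 3 (λ a b c → (a :+ (b :+ c)) := (b :+ (a :+ c))) refl

  Series : Set
  Series = ℕ → Carrier

  -- A record instead of a bare pointwise function type, so that unification can recover `f` and `g`
  -- from the type of a proof.
  record _≋_ (f g : Series) : Set where
    constructor pw
    field at : ∀ n → f n ≈ g n
  open _≋_ public

  infix 4 _≋_
  infixl 6 _⊕_
  infixl 7 _⊛_

  _⊕_ : Series → Series → Series
  (f ⊕ g) n = f n + g n

  ⊖_ : Series → Series
  (⊖ f) n = - f n

  𝟘 : Series
  𝟘 _ = 0#

  const : Carrier → Series
  const a zero    = a
  const a (suc _) = 0#

  𝟙 : Series
  𝟙 = const 1#

  _⊛_ : Series → Series → Series
  (f ⊛ g) zero    = f 0 * g 0
  (f ⊛ g) (suc n) = f 0 * g (suc n) + ((f ∘ suc) ⊛ g) n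

  ⊛-cong′ : ∀ {f f′ g g′} → f ≋ f′ → g ≋ g′ → ∀ n → (f ⊛ g) n ≈ (f′ ⊛ g′) n
  ⊛-cong′ p q zero    = *-cong (at p 0) (at q 0)
  ⊛-cong′ p q (suc n) =
    +-cong (*-cong (at p 0) (at q (suc n))) (⊛-cong′ (pw (λ i → at p (suc i))) q n)

  -- The definition of the product peels its first factor. Exchanging the factors exchanges that
  -- recursion with this one, which makes commutativity a plain induction.
  ⊛-suc : ∀ f g n → (f ⊛ g) (suc n) ≈ f (suc n) * g 0 + (f ⊛ (g ∘ suc)) n
  ⊛-suc f g zero    = +-comm _ _
  ⊛-suc f g (suc n) = begin
    f 0 * g (suc (suc n)) + ((f ∘ suc) ⊛ g) (suc n)
      ≈⟨ +-congˡ (⊛-suc (f ∘ suc) g n) ⟩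
    f 0 * g (suc (suc n)) + (f (suc (suc n)) * g 0 + ((f ∘ suc) ⊛ (g ∘ suc)) n)
      ≈⟨ shuffle _ _ _ ⟩
    f (suc (suc n)) * g 0 + (f ⊛ (g ∘ suc)) (suc n) ∎

  ⊛-comm : ∀ f g n → (f ⊛ g) n ≈ (g ⊛ f) n
  ⊛-comm f g zero    = *-comm _ _
  ⊛-comm f g (suc n) = begin
    f 0 * g (suc n) + ((f ∘ suc) ⊛ g) n ≈⟨ +-cong (*-comm _ _) (⊛-comm (f ∘ suc) g n) ⟩
    g (suc n) * f 0 + (g ⊛ (f ∘ suc)) n ≈⟨ ⊛-suc g f n ⟨
    (g ⊛ f) (suc n) ∎

  ⊛-zeroˡ : ∀ f n → (𝟘 ⊛ f) n ≈ 0#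
  ⊛-zeroˡ f zero    = zeroˡ _
  ⊛-zeroˡ f (suc n) = trans (+-cong (zeroˡ _) (⊛-zeroˡ f n)) (+-identityˡ 0#)

  const-⊛ : ∀ a f n → (const a ⊛ f) n ≈ a * f n
  const-⊛ a f zero    = refl
  const-⊛ a f (suc n) = trans (+-congˡ (⊛-zeroˡ f n)) (+-identityʳ _)

  ⊛-distribʳ : ∀ h f g n → ((f ⊕ g) ⊛ h) n ≈ (f ⊛ h) n + (g ⊛ h) n
  ⊛-distribʳ h f g zero    = distribʳ _ _ _
  ⊛-distribʳ h f g (suc n) =
    trans (+-cong (distribʳ _ _ _) (⊛-distribʳ h (f ∘ suc) (g ∘ suc) n)) (interchange _ _ _ _)

  scale-⊛ : ∀ a f g n → ((λ i → a * f i) ⊛ g) n ≈ a * (f ⊛ g) n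
  scale-⊛ a f g zero    = *-assoc _ _ _
  scale-⊛ a f g (suc n) =
    trans (+-cong (*-assoc _ _ _) (scale-⊛ a (f ∘ suc) g n)) (sym (distribˡ _ _ _))

  ⊛-assoc : ∀ f g h n → ((f ⊛ g) ⊛ h) n ≈ (f ⊛ (g ⊛ h)) n
  ⊛-assoc f g h zero    = *-assoc _ _ _
  ⊛-assoc f g h (suc n) = begin
    f 0 * g 0 * h (suc n) + (((λ i → f 0 * g (suc i)) ⊕ ((f ∘ suc) ⊛ g)) ⊛ h) n
      ≈⟨ +-cong (*-assoc _ _ _) (⊛-distribʳ h (λ i → f 0 * g (suc i)) ((f ∘ suc) ⊛ g) n) ⟩
    f 0 * (g 0 * h (suc n)) + (((λ i → f 0 * g (suc i)) ⊛ h) n + (((f ∘ suc) ⊛ g) ⊛ h) n)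
      ≈⟨ +-congˡ (+-cong (scale-⊛ (f 0) (g ∘ suc) h n) (⊛-assoc (f ∘ suc) g h n)) ⟩
    f 0 * (g 0 * h (suc n)) + (f 0 * ((g ∘ suc) ⊛ h) n + ((f ∘ suc) ⊛ (g ⊛ h)) n)
      ≈⟨ +-assoc _ _ _ ⟨
    f 0 * (g 0 * h (suc n)) + f 0 * ((g ∘ suc) ⊛ h) n + ((f ∘ suc) ⊛ (g ⊛ h)) n
      ≈⟨ +-congʳ (sym (distribˡ _ _ _)) ⟩
    f 0 * (g ⊛ h) (suc n) + ((f ∘ suc) ⊛ (g ⊛ h)) n ∎

  seriesRing : CommutativeRing 0ℓ 0ℓ
  seriesRing = record
    { Carrier = Series ; _≈_ = _≋_ ; _+_ = _⊕_ ; _*_ = _⊛_ ; -_ = ⊖_ ; 0# = 𝟘 ; 1# = 𝟙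
    ; isCommutativeRing = record
      { isRing = record
        { +-isAbelianGroup = record
          { isGroup = record
            { isMonoid = record
              { isSemigroup = record
                { isMagma = record
                  { isEquivalence = record
                    { refl = pw (λ _ → refl)
                    ; sym = λ p → pw (λ n → sym (at p n))
                    ; trans = λ p q → pw (λ n → trans (at p n) (at q n)) }
                  ; ∙-cong = λ p q → pw (λ n → +-cong (at p n) (at q n)) }
                ; assoc = λ f g h → pw (λ n → +-assoc _ _ _) }
              ; identity = (λ f → pw (λ n → +-identityˡ _)) , (λ f → pw (λ n → +-identityʳ _)) }
            ; inverse = (λ f → pw (λ n → -‿inverseˡ _)) , (λ f → pw (λ n → -‿inverseʳ _))
            ; ⁻¹-cong = λ p → pw (λ n → -‿cong (at p n)) }
          ; comm = λ f g → pw (λ n → +-comm _ _) }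
        ; *-cong = λ p q → pw (⊛-cong′ p q)
        ; *-assoc = λ f g h → pw (⊛-assoc f g h)
        ; *-identity = (λ f → pw (one f))
                     , (λ f → pw (λ n → trans (⊛-comm f 𝟙 n) (one f n)))
        ; distrib = (λ f g h → pw (λ n → trans (⊛-comm f (g ⊕ h) n)
                       (trans (⊛-distribʳ f g h n) (+-cong (⊛-comm g f n) (⊛-comm h f n)))))
                  , (λ f g h → pw (⊛-distribʳ f g h)) }
      ; *-comm = λ f g → pw (⊛-comm f g) } }
    where
    one : ∀ f n → (𝟙 ⊛ f) n ≈ f n
    one f n = trans (const-⊛ 1# f n) (*-identityˡ _)

  X : Series
  X 1 = 1#
  X _ = 0#

  X-⊛-zero : ∀ f → (X ⊛ f) 0 ≈ 0#
  X-⊛-zero f = zeroˡ _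

  X-⊛-suc : ∀ f n → (X ⊛ f) (suc n) ≈ f n
  X-⊛-suc f n = begin
    0# * f (suc n) + ((X ∘ suc) ⊛ f) n ≈⟨ +-cong (zeroˡ _) (⊛-cong′ {g = f} (pw tail) (pw (λ _ → refl)) n) ⟩
    0# + (𝟙 ⊛ f) n ≈⟨ +-identityˡ _ ⟩
    (𝟙 ⊛ f) n ≈⟨ const-⊛ 1# f n ⟩
    1# * f n ≈⟨ *-identityˡ _ ⟩
    f n ∎
    where
    tail : ∀ n → X (suc n) ≈ 𝟙 n
    tail zero    = refl
    tail (suc _) = refl

module Powers (R : CommutativeRing 0ℓ 0ℓ) where
  open CommutativeRing R
  open SetoidReasoning setoid
  open import Algebra.Solver.Ring.NaturalCoefficients.Default commutativeSemiring
      using (solve; con; _:=_; _:+_; _:*_)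

  pow : Carrier → ℕ → Carrier
  pow x zero    = 1#
  pow x (suc n) = x * pow x n

  pow-* : ∀ x y n → pow (x * y) n ≈ pow x n * pow y n
  pow-* x y zero    = sym (*-identityˡ _)
  pow-* x y (suc n) = trans (*-congˡ (pow-* x y n))
    (solve 4 (λ x y a b → ((x :* y) :* (a :* b)) := ((x :* a) :* (y :* b))) refl _ _ _ _)

  pow-cong : ∀ {x y} n → x ≈ y → pow x n ≈ pow y n
  pow-cong zero    p = refl
  pow-cong (suc n) p = *-cong p (pow-cong n p)

  *-swap : ∀ a b c → a * (b * c) ≈ b * (a * c)
  *-swap = solve 3 (λ a b c → (a :* (b :* c)) := (b :* (a :* c))) refl

  *-interchange : ∀ a b c d → (a * b) * (c * d) ≈ (a * c) * (b * d)
  *-interchange = solve 4 (λ a b c d → ((a :* b) :* (c :* d)) := ((a :* c) :* (b :* d))) refl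

  derivation-power : ∀ h d k p → d * (h * p) + h * (k * (d * p)) ≈ (1# + k) * (d * (h * p))
  derivation-power = solve 4 (λ h d k p →
    (d :* (h :* p) :+ h :* (k :* (d :* p))) := ((con 1 :+ k) :* (d :* (h :* p)))) refl

  collect-derivative : ∀ h d m e p → (d * m + h * e) * p ≈ e * (h * p) + m * (d * p)
  collect-derivative = solve 5 (λ h d m e p →
    ((d :* m :+ h :* e) :* p) := (e :* (h :* p) :+ m :* (d :* p))) refl

  factor-sum : ∀ x m e p → (x * m + x * e) * p ≈ x * (m * p + e * p)
  factor-sum = solve 4 (λ x m e p → ((x :* m :+ x :* e) :* p) := (x :* (m :* p :+ e :* p))) refl

  *-reassoc : ∀ a b c d → a * (b * (c * d)) ≈ b * ((a * c) * d)
  *-reassoc = solve 4 (λ a b c d → (a :* (b :* (c :* d))) := (b :* ((a :* c) :* d))) refl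

  -- The derivative `3 a² b` of a cube as it comes out of two product rules, with `c` for `a²`.
  triple : ∀ y a b c → c ≈ a * a →
    y * (a * (a * b + b * a) + b * c) ≈ (y * ((1# + (1# + 1#)) * c)) * b
  triple y a b c p = trans (*-congˡ (+-congˡ (*-congˡ p))) (trans
    (solve 3 (λ y a b → (y :* (a :* (a :* b :+ b :* a) :+ b :* (a :* a)))
      := ((y :* ((con 1 :+ (con 1 :+ con 1)) :* (a :* a))) :* b)) refl y a b)
    (*-congʳ (*-congˡ (*-congˡ (sym p)))))

  *-tuck : ∀ a b c d → a * (b * (c * d)) ≈ (b * (a * c)) * d
  *-tuck = solve 4 (λ a b c d → (a :* (b :* (c :* d))) := ((b :* (a :* c)) :* d)) refl

  unfold-power : ∀ h e u p f → h ≈ e + u * h → (h * p) * f ≈ p * (e * f) + u * ((h * p) * f)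
  unfold-power h e u p f q = trans (*-congʳ (*-congʳ q))
    (solve 5 (λ h e u p f → (((e :+ u :* h) :* p) :* f) := (p :* (e :* f) :+ u :* ((h :* p) :* f))) refl h e u p f)

  *-pull : ∀ u e f v → u * (e * (v * f)) ≈ v * (u * (e * f))
  *-pull = solve 4 (λ u e f v → (u :* (e :* (v :* f))) := (v :* (u :* (e :* f)))) refl

  *-rotate : ∀ a b c → (a * b) * c ≈ b * (a * c)
  *-rotate = solve 3 (λ a b c → ((a :* b) :* c) := (b :* (a :* c))) refl

  absorb-power : ∀ q x z b → z * ((q * (x * x)) * b) ≈ x * (((q * x) * z) * b)
  absorb-power = solve 4 (λ q x z b →
    (z :* ((q :* (x :* x)) :* b)) := (x :* (((q :* x) :* z) :* b))) refl

-- β s is the s-th power of the series B determined by B = 1 + q X² B³.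
module TernarySeries (A : CommutativeRing 0ℓ 0ℓ) (q : CommutativeRing.Carrier A) where
  open CommutativeRing A
  open PowerSeries A
  private module S = CommutativeRing seriesRing
  open Powers seriesRing

  β : ℕ → Series
  β s       0             = 1#
  β s       1             = 0#
  β zero    (suc (suc n)) = 0#
  -- The equation of `B` times `B^s`, that is `B^(s+1) = B^s + q X² B^(s+3)`. Treating all powers at
  -- once keeps the recursion linear and terminating: either the degree drops, or it stays and `s`
  -- drops.
  β (suc s) (suc (suc n)) = β s (suc (suc n)) + q * β (suc (suc (suc s))) n

  Y : Series
  Y = const q ⊛ (X ⊛ X)

  Y-⊛-0 : ∀ f → (Y ⊛ f) 0 ≈ 0#
  Y-⊛-0 f = trans (*-congʳ (trans (*-congˡ (zeroˡ _)) (zeroʳ _))) (zeroˡ _)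

  private
    Y-assoc : ∀ f n → (Y ⊛ f) n ≈ q * (X ⊛ (X ⊛ f)) n
    Y-assoc f n = trans (at (S.trans (S.*-assoc (const q) (X ⊛ X) f) (S.*-congˡ {const q} (S.*-assoc X X f))) n)
                        (const-⊛ q (X ⊛ (X ⊛ f)) n)

  Y-⊛-1 : ∀ f → (Y ⊛ f) 1 ≈ 0#
  Y-⊛-1 f = trans (Y-assoc f 1) (trans (*-congˡ (trans (X-⊛-suc (X ⊛ f) 0) (X-⊛-zero f))) (zeroʳ _))

  Y-⊛-suc : ∀ f n → (Y ⊛ f) (suc (suc n)) ≈ q * f n
  Y-⊛-suc f n = trans (Y-assoc f (suc (suc n))) (*-congˡ (trans (X-⊛-suc (X ⊛ f) (suc n)) (X-⊛-suc f n)))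

  β-zero : β 0 ≋ 𝟙
  β-zero = pw λ { 0 → refl ; 1 → refl ; (suc (suc n)) → refl }

  β-suc : ∀ s → β (suc s) ≋ β s ⊕ Y ⊛ β (3 ℕ.+ s)
  β-suc s = pw λ
    { 0 → sym (trans (+-congˡ (Y-⊛-0 (β (3 ℕ.+ s)))) (+-identityʳ _))
    ; 1 → sym (trans (+-congˡ (Y-⊛-1 (β (3 ℕ.+ s)))) (+-identityʳ _))
    ; (suc (suc n)) → +-congˡ (sym (Y-⊛-suc (β (3 ℕ.+ s)) n)) }

  private
    β-+-at : ∀ n s t → β (s ℕ.+ t) n ≈ (β s ⊛ β t) n
    β-+-at n zero t = sym (trans (at (S.*-congʳ {β t} β-zero) n) (at (S.*-identityˡ (β t)) n))
    β-+-at n (suc s) t = trans (at (β-suc (s ℕ.+ t)) n)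
      (trans (+-cong (β-+-at n s t) (go n)) (sym (at expand n)))
      where
      open SetoidReasoning S.setoid
      expand : β (suc s) ⊛ β t ≋ β s ⊛ β t ⊕ Y ⊛ (β (3 ℕ.+ s) ⊛ β t)
      expand = begin
        β (suc s) ⊛ β t ≈⟨ S.*-congʳ {β t} (β-suc s) ⟩
        (β s ⊕ Y ⊛ β (3 ℕ.+ s)) ⊛ β t ≈⟨ S.distribʳ (β t) (β s) (Y ⊛ β (3 ℕ.+ s)) ⟩
        β s ⊛ β t ⊕ (Y ⊛ β (3 ℕ.+ s)) ⊛ β t ≈⟨ S.+-congˡ {β s ⊛ β t} (S.*-assoc Y (β (3 ℕ.+ s)) (β t)) ⟩
        β s ⊛ β t ⊕ Y ⊛ (β (3 ℕ.+ s) ⊛ β t) ∎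
      go : ∀ n → (Y ⊛ β (3 ℕ.+ s ℕ.+ t)) n ≈ (Y ⊛ (β (3 ℕ.+ s) ⊛ β t)) n
      go 0 = trans (Y-⊛-0 (β (3 ℕ.+ s ℕ.+ t))) (sym (Y-⊛-0 (β (3 ℕ.+ s) ⊛ β t)))
      go 1 = trans (Y-⊛-1 (β (3 ℕ.+ s ℕ.+ t))) (sym (Y-⊛-1 (β (3 ℕ.+ s) ⊛ β t)))
      go (suc (suc n)) = trans (Y-⊛-suc (β (3 ℕ.+ s ℕ.+ t)) n)
        (trans (*-congˡ (β-+-at n (3 ℕ.+ s) t)) (sym (Y-⊛-suc (β (3 ℕ.+ s) ⊛ β t) n)))

  β-+ : ∀ s t → β (s ℕ.+ t) ≋ β s ⊛ β t
  β-+ s t = pw λ n → β-+-at n s t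

  Z : Series
  Z = const q ⊛ X

  -- Enumerates the stack prefixes from which closing a chord leaves r open chords.
  P : ℕ → Series
  P r = pow Z (suc r) ⊛ β (suc (r ℕ.+ r))

  -- The equation of `B` times `q X`. In the automaton, a block with one open chord was either just
  -- opened or left behind by a closing.
  P-zero : P 0 ≋ Z ⊕ X ⊛ P 1
  P-zero = begin
    (Z ⊛ 𝟙) ⊛ β 1 ≈⟨ S.*-cong (S.*-identityʳ Z) (S.trans (β-suc 0) (S.+-congʳ {Y ⊛ β 3} β-zero)) ⟩
    Z ⊛ (𝟙 ⊕ Y ⊛ β 3) ≈⟨ S.distribˡ Z 𝟙 (Y ⊛ β 3) ⟩
    Z ⊛ 𝟙 ⊕ Z ⊛ (Y ⊛ β 3) ≈⟨ S.+-cong (S.*-identityʳ Z) (absorb-power (const q) X Z (β 3)) ⟩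
    Z ⊕ X ⊛ ((Z ⊛ Z) ⊛ β 3) ≈⟨ S.+-congˡ {Z} (S.*-congˡ {X} (S.*-congʳ {β 3} (S.*-congˡ {Z} (S.*-identityʳ Z)))) ⟨
    Z ⊕ X ⊛ P 1 ∎
    where open SetoidReasoning S.setoid

  -- `B^(2r+3) = B^(2r+2) + q X² B^(2r+5)` times `(q X)^(r+2)`. The two summands match the
  -- constructors `one` and `more` of `Split`.
  P-suc : ∀ r → P (suc r) ≋ X ⊛ P (2 ℕ.+ r) ⊕ P 0 ⊛ P r
  P-suc r = begin
    W ⊛ β (suc (suc r ℕ.+ suc r)) ≡⟨ ≡.cong (λ i → W ⊛ β (suc (suc i))) (ℕ.+-suc r r) ⟩
    W ⊛ β (3 ℕ.+ d) ≈⟨ S.*-congˡ {W} (β-suc (2 ℕ.+ d)) ⟩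
    W ⊛ (β (2 ℕ.+ d) ⊕ Y ⊛ β (5 ℕ.+ d)) ≈⟨ S.distribˡ W (β (2 ℕ.+ d)) (Y ⊛ β (5 ℕ.+ d)) ⟩
    W ⊛ β (2 ℕ.+ d) ⊕ W ⊛ (Y ⊛ β (5 ℕ.+ d)) ≈⟨ S.+-comm (W ⊛ β (2 ℕ.+ d)) (W ⊛ (Y ⊛ β (5 ℕ.+ d))) ⟩
    W ⊛ (Y ⊛ β (5 ℕ.+ d)) ⊕ W ⊛ β (2 ℕ.+ d) ≈⟨ S.+-cong (absorb-power (const q) X W (β (5 ℕ.+ d))) right ⟩
    X ⊛ ((Z ⊛ W) ⊛ β (5 ℕ.+ d)) ⊕ P 0 ⊛ P r ≡⟨ ≡.cong (λ i → X ⊛ ((Z ⊛ W) ⊛ β (suc i)) ⊕ P 0 ⊛ P r) eq ⟨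
    X ⊛ P (2 ℕ.+ r) ⊕ P 0 ⊛ P r ∎
    where
    open SetoidReasoning S.setoid
    d = r ℕ.+ r
    W = pow Z (2 ℕ.+ r)
    eq : (2 ℕ.+ r) ℕ.+ (2 ℕ.+ r) ≡ 4 ℕ.+ d
    eq = ≡.trans (≡.cong (2 ℕ.+_) (ℕ.+-suc r (suc r))) (≡.cong (3 ℕ.+_) (ℕ.+-suc r r))
    right : W ⊛ β (2 ℕ.+ d) ≋ P 0 ⊛ P r
    right = begin
      (Z ⊛ pow Z (suc r)) ⊛ β (1 ℕ.+ suc d) ≈⟨ S.*-congˡ {W} (β-+ 1 (suc d)) ⟩
      (Z ⊛ pow Z (suc r)) ⊛ (β 1 ⊛ β (suc d)) ≈⟨ *-interchange Z (pow Z (suc r)) (β 1) (β (suc d)) ⟩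
      (Z ⊛ β 1) ⊛ P r ≈⟨ S.*-congʳ {P r} (S.*-congʳ {β 1} (S.*-identityʳ Z)) ⟨
      P 0 ⊛ P r ∎

-- Exchanging the two variables of a bivariate series

module Transpose (A : CommutativeRing 0ℓ 0ℓ) where
  open CommutativeRing A
  open PowerSeries A
  private
    module S = CommutativeRing seriesRing
    module SS = PowerSeries seriesRing
  open import Algebra.Solver.Ring.NaturalCoefficients.Default commutativeSemiring
    using (solve; _:=_; _:+_; _:*_)

  transpose : SS.Series → SS.Series
  transpose g n k = g k n

  private
    -- `SS.⊛` peels the outer index by definition. Here the inner one is peeled, which is the outer
    -- one after transposition.
    peel : ∀ u v f n → (u SS.⊛ v) f (suc n)
      ≈ ((λ j → u j 0) ⊛ (λ j → v j (suc n))) f + ((λ j → u j ∘ suc) SS.⊛ v) f n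
    peel u v zero    n = refl
    peel u v (suc f) n = trans (+-congˡ (peel (u ∘ suc) v f n))
      (solve 4 (λ a b c d → ((a :+ b) :+ (c :+ d)) := ((a :+ c) :+ (b :+ d))) refl
        (u 0 0 * v (suc f) (suc n)) (((u 0 ∘ suc) ⊛ v (suc f)) n)
        (((λ j → u (suc j) 0) ⊛ (λ j → v j (suc n))) f)
        (((λ j → u (suc j) ∘ suc) SS.⊛ v) f n))

  transpose-⊛ : ∀ g h f n → transpose (g SS.⊛ h) f n ≈ (transpose g SS.⊛ transpose h) f n
  transpose-⊛ g h f zero    = sym (go (transpose g) (transpose h) f)
    where
    go : ∀ u v f → (u SS.⊛ v) f 0 ≈ ((λ j → u j 0) ⊛ (λ j → v j 0)) f
    go u v zero    = refl
    go u v (suc f) = +-congˡ (go (u ∘ suc) v f)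
  transpose-⊛ g h f (suc n) = sym (trans (peel (transpose g) (transpose h) f n)
    (+-congˡ (sym (transpose-⊛ (g ∘ suc) h f n))))

-- Generating functions of blocks and prefixes

open import Data.Integer as ℤ using (ℤ)
import Data.Integer.Properties as ℤ
open import Data.Integer.Tactic.RingSolver using (solve-∀)
open import Data.Nat.Tactic.RingSolver using () renaming (solve-∀ to ℕ-solve-∀)
open ≡ using (_≢_; refl; sym; trans; cong; cong₂; subst; module ≡-Reasoning)

module ℤ[[X]] = PowerSeries ℤ.+-*-commutativeRing
open ℤ[[X]] public
module S = CommutativeRing seriesRing
module Marked = PowerSeries seriesRing
open Transpose ℤ.+-*-commutativeRing using (transpose; transpose-⊛) public
module SS = CommutativeRing Marked.seriesRing

-- Each chord carries the weight 1 + ε, so that ε counts marked chords.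
1+ε : Series
1+ε 0 = + 1
1+ε 1 = + 1
1+ε _ = + 0

module B = TernarySeries ℤ.+-*-commutativeRing (+ 1)
module Bε = TernarySeries seriesRing 1+ε
open B using (β; Y) public

-- The coefficient of ε^f in `(1 + ε) X`: a chord just opened, unmarked or marked.
mark : ℕ → Series
mark 0 = X
mark 1 = X
mark _ = 𝟘

-- The coefficient of ε^f in P r.
prefixes : ℕ → ℕ → Series
prefixes r f = transpose (Bε.P r) f

-- A block with at least two open chords can only result from a closing, so it is one further point,
-- `X`, after a prefix that leaves as many open chords. A singleton may also be newly opened;
-- `P-zero` shows that both cases together give `prefixes 0`.
blockWeight : ℕ → ℕ → Series
blockWeight zero    f = prefixes 0 f
blockWeight (suc b) f = X ⊛ prefixes (2 ℕ.+ b) f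

transpose-X-⊛ : ∀ g f n → transpose (Marked.X Marked.⊛ g) f n ≡ (X ⊛ transpose g f) n
transpose-X-⊛ g f zero    = trans (at (Marked.X-⊛-zero g) f) (sym (X-⊛-zero (transpose g f)))
transpose-X-⊛ g f (suc n) =
  trans (at (Marked.X-⊛-suc g n) f) (sym (X-⊛-suc (transpose g f) n))

transpose-Z : ∀ f n → transpose Bε.Z f n ≡ mark f n
transpose-Z f n = trans (at (Marked.const-⊛ 1+ε Marked.X n) f) (go f n)
  where
  go : ∀ f n → (1+ε ⊛ Marked.X n) f ≡ mark f n
  go f 1 = trans (at (S.*-identityʳ 1+ε) f) (e f)
    where
    e : ∀ f → 1+ε f ≡ mark f 1
    e 0 = refl
    e 1 = refl
    e (suc (suc f)) = refl
  go f zero = trans (at (S.zeroʳ 1+ε) f) (e f)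
    where
    e : ∀ f → + 0 ≡ mark f 0
    e 0 = refl
    e 1 = refl
    e (suc (suc f)) = refl
  go f (suc (suc n)) = trans (at (S.zeroʳ 1+ε) f) (e f)
    where
    e : ∀ f → + 0 ≡ mark f (suc (suc n))
    e 0 = refl
    e 1 = refl
    e (suc (suc f)) = refl

block-zero : ∀ f → blockWeight 0 f ≋ mark f ⊕ X ⊛ prefixes 1 f
block-zero f = pw λ n → trans (at (Marked.at Bε.P-zero n) f)
  (≡.cong₂ ℤ._+_ (transpose-Z f n) (transpose-X-⊛ (Bε.P 1) f n))

prefixes-suc : ∀ r f → prefixes (suc r) f ≋ blockWeight (suc r) f ⊕ (blockWeight 0 Marked.⊛ prefixes r) f
prefixes-suc r f = pw λ n → trans (at (Marked.at (Bε.P-suc r) n) f)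
  (≡.cong₂ ℤ._+_ (transpose-X-⊛ (Bε.P (2 ℕ.+ r)) f n) (transpose-⊛ (Bε.P 0) (Bε.P r) f n))

-- The factor `X` is the last closing point of a component, which at that moment has one open chord
-- and must have one mark.
H : Series
H = X ⊛ blockWeight 0 1

open Powers seriesRing
open import Data.Bool using (Bool; true; false)
open import Data.Empty using (⊥; ⊥-elim)
open import Data.Fin as Fin using (Fin; toℕ; fromℕ<)
open import Data.Fin.Properties using (+↔⊎; *↔×; toℕ-injective; toℕ-fromℕ<; toℕ<n; injective⇒≤)
open import Data.List as List using (List; []; _∷_; [_]; _++_; _ʳ++_; length; map; filter; concatMap; allFin; upTo; applyUpTo)
open import Data.Product.Function.NonDependent.Propositional using (_×-↔_)
open import Data.Sum using (_⊎_; inj₁; inj₂)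
open import Data.Sum.Function.Propositional using (_⊎-↔_)
open import Function.Properties.Inverse using (↔-sym; ↔-trans)

-- The stack automaton

-- A block (b , f) is a set of b + 1 open chords lying in one component of the part of the diagram
-- read so far, f chords of that component being marked.  The head of a state is the block opened last.
State : Set
State = List (ℕ × ℕ)

fromBool : Bool → ℕ
fromBool false = 0
fromBool true  = 1

-- Split j q r f: closing a chord crossed by j open chords turns the prefix q of the state into
-- r open chords of one component with f marks.
data Split : ℕ → State → ℕ → ℕ → Set where
  one  : ∀ {r f} → Split 0 ((r , f) ∷ []) r f
  more : ∀ {j q r f₁ f₂ f} → f₁ ℕ.+ f₂ ≡ f → Split j q r f₂ → Split (suc j) ((0 , f₁) ∷ q) (suc r) f

-- `close` asks for `suc r` remaining chords, so a component can lose its last open chord only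
-- through `finish`. That constructor demands exactly one mark, which is where rootedness is
-- enforced.
data History : State → ℕ → ℕ → Set where
  start  : History [] 0 0
  push   : ∀ {s ℓ c} (x : Bool) → History s ℓ c → History ((0 , fromBool x) ∷ s) (suc ℓ) c
  close  : ∀ {j q r f s ℓ c} → Split j q (suc r) f → History (q ++ s) ℓ c → History ((r , f) ∷ s) (suc ℓ) c
  finish : ∀ {s ℓ c} → History ((0 , 1) ∷ s) ℓ c → History s (suc ℓ) (suc c)

antidiagonal : (ℕ → ℕ → ℕ) → ℕ → ℕ
antidiagonal X zero    = X 0 0
antidiagonal X (suc f) = X 0 (suc f) ℕ.+ antidiagonal (X ∘ suc) f

-- `pre` collects the singleton blocks already passed, in reverse order, so that `F` is always
-- applied to a complete state.
countSplits : (State → ℕ) → State → ℕ → ℕ → State → ℕ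
countSplits F pre zero    f s = F (pre ʳ++ (0 , f) ∷ s)
countSplits F pre (suc r) f s = F (pre ʳ++ (suc r , f) ∷ s)
  ℕ.+ antidiagonal (λ f₁ f₂ → countSplits F ((0 , f₁) ∷ pre) r f₂ s) f

countMarks : ℕ → ℕ → ℕ
countMarks zero    zero          = 1
countMarks zero    (suc zero)    = 1
countMarks zero    (suc (suc _)) = 0
countMarks (suc _) _             = 0

mutual
  countHistories : State → ℕ → ℕ → ℕ
  countHistories []            zero    zero    = 1
  countHistories []            zero    (suc c) = 0
  countHistories (_ ∷ _)       zero    c       = 0
  countHistories []            (suc ℓ) c       = countFinishes [] ℓ c
  countHistories ((b , f) ∷ s) (suc ℓ) c       = countFinishes ((b , f) ∷ s) ℓ c
    ℕ.+ (countMarks b f ℕ.* countHistories s ℓ c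
    ℕ.+ countSplits (λ s′ → countHistories s′ ℓ c) [] (suc b) f s)

  countFinishes : State → ℕ → ℕ → ℕ
  countFinishes s ℓ zero    = 0
  countFinishes s ℓ (suc c) = countHistories ((0 , 1) ∷ s) ℓ c

-- Histories are counted by `countHistories`

private
  ⊥↔ : ∀ {A : Set} → (A → ⊥) → A ↔ Fin 0
  ⊥↔ ¬a = mk↔ₛ′ (λ a → Data.Empty.⊥-elim (¬a a)) (λ ()) (λ ()) (λ a → Data.Empty.⊥-elim (¬a a))

  ⊎↔ : ∀ {A B : Set} {m n} → A ↔ Fin m → B ↔ Fin n → (A ⊎ B) ↔ Fin (m ℕ.+ n)
  ⊎↔ p q = ↔-trans (p ⊎-↔ q) (↔-sym +↔⊎)

  ×↔ : ∀ {A B : Set} {m n} → A ↔ Fin m → B ↔ Fin n → (A × B) ↔ Fin (m ℕ.* n)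
  ×↔ p q = ↔-trans (p ×-↔ q) (↔-sym *↔×)

  1↔ : ∀ {A : Set} (a : A) → (∀ a′ → a ≡ a′) → A ↔ Fin 1
  1↔ a u = mk↔ₛ′ (λ _ → Fin.zero) (λ _ → a) (λ { Fin.zero → refl ; (Fin.suc ()) }) u

  Antidiagonal : (ℕ → ℕ → Set) → ℕ → Set
  Antidiagonal T f = ∃ λ f₁ → ∃ λ f₂ → f₁ ℕ.+ f₂ ≡ f × T f₁ f₂

  antidiagonal↔ : ∀ {T : ℕ → ℕ → Set} {X} → (∀ f₁ f₂ → T f₁ f₂ ↔ Fin (X f₁ f₂)) →
    ∀ f → Antidiagonal T f ↔ Fin (antidiagonal X f)
  antidiagonal↔ {T} e zero = ↔-trans
    (mk↔ₛ′ (λ { (0 , 0 , refl , t) → t }) (λ t → 0 , 0 , refl , t) (λ _ → refl) (λ { (0 , 0 , refl , t) → refl }))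
    (e 0 0)
  antidiagonal↔ {T} e (suc f) = ↔-trans
    (mk↔ₛ′ (λ { (0 , _ , refl , t) → inj₁ t ; (suc f₁ , f₂ , refl , t) → inj₂ (f₁ , f₂ , refl , t) })
      (λ { (inj₁ t) → 0 , _ , refl , t ; (inj₂ (f₁ , f₂ , refl , t)) → suc f₁ , f₂ , refl , t })
      (λ { (inj₁ t) → refl ; (inj₂ (f₁ , f₂ , refl , t)) → refl })
      (λ { (0 , _ , refl , t) → refl ; (suc f₁ , f₂ , refl , t) → refl }))
    (⊎↔ (e 0 (suc f)) (antidiagonal↔ (λ f₁ → e (suc f₁)) f))

  Splits : (State → Set) → State → ℕ → ℕ → State → Set
  Splits T pre r f s = ∃ λ j → ∃ λ q → Split j q r f × T (pre ʳ++ (q ++ s))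

  splits↔ : ∀ {T F} → (∀ s → T s ↔ Fin (F s)) →
    ∀ pre r f s → Splits T pre r f s ↔ Fin (countSplits F pre r f s)
  splits↔ e pre zero f s = ↔-trans
    (mk↔ₛ′ (λ { (_ , _ , one , t) → t }) (λ t → _ , _ , one , t) (λ _ → refl) (λ { (_ , _ , one , t) → refl }))
    (e _)
  splits↔ e pre (suc r) f s = ↔-trans
    (mk↔ₛ′ (λ { (_ , _ , one , t) → inj₁ t
              ; (_ , _ , more p sp , t) → inj₂ (_ , _ , p , _ , _ , sp , t) })
      (λ { (inj₁ t) → _ , _ , one , t ; (inj₂ (_ , _ , p , _ , _ , sp , t)) → _ , _ , more p sp , t })
      (λ { (inj₁ t) → refl ; (inj₂ (_ , _ , p , _ , _ , sp , t)) → refl })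
      (λ { (_ , _ , one , t) → refl ; (_ , _ , more p sp , t) → refl }))
    (⊎↔ (e _) (antidiagonal↔ (λ f₁ f₂ → splits↔ e ((0 , f₁) ∷ pre) r f₂ s) f))

  Marks : ℕ → ℕ → Set
  Marks b f = b ≡ 0 × ∃ λ x → fromBool x ≡ f

  marks↔ : ∀ b f → Marks b f ↔ Fin (countMarks b f)
  marks↔ zero zero = 1↔ (refl , false , refl) λ { (refl , false , refl) → refl }
  marks↔ zero (suc zero) = 1↔ (refl , true , refl) λ { (refl , true , refl) → refl }
  marks↔ zero (suc (suc f)) = ⊥↔ λ { (_ , false , ()) ; (_ , true , ()) }
  marks↔ (suc b) f = ⊥↔ λ { (() , _) }

  data Finishes (s : State) (ℓ : ℕ) : ℕ → Set where
    fin : ∀ {c} → History ((0 , 1) ∷ s) ℓ c → Finishes s ℓ (suc c)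

mutual
  histories↔ : ∀ s ℓ c → History s ℓ c ↔ Fin (countHistories s ℓ c)
  histories↔ [] zero zero = 1↔ start λ { start → refl }
  histories↔ [] zero (suc c) = ⊥↔ λ ()
  histories↔ (_ ∷ _) zero c = ⊥↔ λ ()
  histories↔ [] (suc ℓ) c = ↔-trans
    (mk↔ₛ′ (λ { (finish h) → fin h }) (λ { (fin h) → finish h }) (λ { (fin h) → refl }) (λ { (finish h) → refl }))
    (finishes↔ [] ℓ c)
  histories↔ ((b , f) ∷ s) (suc ℓ) c = ↔-trans
    (mk↔ₛ′ to from to-from from-to)
    (⊎↔ (finishes↔ _ ℓ c) (⊎↔ (×↔ (marks↔ b f) (histories↔ s ℓ c))
      (splits↔ (λ s′ → histories↔ s′ ℓ c) [] (suc b) f s)))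
    where
    T : Set
    T = Finishes ((b , f) ∷ s) ℓ c ⊎ (Marks b f × History s ℓ c)
      ⊎ Splits (λ s′ → History s′ ℓ c) [] (suc b) f s
    to : History ((b , f) ∷ s) (suc ℓ) c → T
    to (push x h)   = inj₂ (inj₁ ((refl , x , refl) , h))
    to (close sp h) = inj₂ (inj₂ (_ , _ , sp , h))
    to (finish h)   = inj₁ (fin h)
    from : T → History ((b , f) ∷ s) (suc ℓ) c
    from (inj₁ (fin h)) = finish h
    from (inj₂ (inj₁ ((refl , x , refl) , h))) = push x h
    from (inj₂ (inj₂ (_ , _ , sp , h))) = close sp h
    to-from : ∀ t → to (from t) ≡ t
    to-from (inj₁ (fin h)) = refl
    to-from (inj₂ (inj₁ ((refl , x , refl) , h))) = refl
    to-from (inj₂ (inj₂ (_ , _ , sp , h))) = refl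
    from-to : ∀ h → from (to h) ≡ h
    from-to (push x h)   = refl
    from-to (close sp h) = refl
    from-to (finish h)   = refl

  finishes↔ : ∀ s ℓ c → Finishes s ℓ c ↔ Fin (countFinishes s ℓ c)
  finishes↔ s ℓ zero    = ⊥↔ λ ()
  finishes↔ s ℓ (suc c) = ↔-trans
    (mk↔ₛ′ (λ { (fin h) → h }) fin (λ _ → refl) (λ { (fin h) → refl }))
    (histories↔ ((0 , 1) ∷ s) ℓ c)

-- The coefficient functional and its recursion

C-absorb : ∀ n k → suc k ℕ.* (suc n C suc k) ≡ suc n ℕ.* (n C k)
C-absorb zero    zero    = refl
C-absorb zero    (suc k) = ℕ.*-zeroʳ (suc (suc k))
C-absorb (suc n) zero    = begin
  1 ℕ.* (suc (suc n) C 1) ≡⟨ cong (1 ℕ.*_) (nCk+nC[k+1]≡[n+1]C[k+1] (suc n) 0) ⟨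
  1 ℕ.* (1 ℕ.+ (suc n C 1)) ≡⟨ ℕ.*-distribˡ-+ 1 1 (suc n C 1) ⟩
  1 ℕ.+ 1 ℕ.* (suc n C 1) ≡⟨ cong suc (C-absorb n 0) ⟩
  1 ℕ.+ suc n ℕ.* 1 ∎
  where open ≡-Reasoning
C-absorb (suc n) (suc k) = begin
  suc (suc k) ℕ.* (suc (suc n) C suc (suc k))
    ≡⟨ cong (suc (suc k) ℕ.*_) (nCk+nC[k+1]≡[n+1]C[k+1] (suc n) (suc k)) ⟨
  suc (suc k) ℕ.* (a ℕ.+ (suc n C suc (suc k)))
    ≡⟨ ℕ.*-distribˡ-+ (suc (suc k)) a _ ⟩
  a ℕ.+ suc k ℕ.* a ℕ.+ suc (suc k) ℕ.* (suc n C suc (suc k))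
    ≡⟨ cong₂ (λ x y → a ℕ.+ x ℕ.+ y) (C-absorb n k) (C-absorb n (suc k)) ⟩
  a ℕ.+ suc n ℕ.* (n C k) ℕ.+ suc n ℕ.* (n C suc k)
    ≡⟨ ℕ.+-assoc a _ _ ⟩
  a ℕ.+ (suc n ℕ.* (n C k) ℕ.+ suc n ℕ.* (n C suc k))
    ≡⟨ cong (a ℕ.+_) (ℕ.*-distribˡ-+ (suc n) (n C k) (n C suc k)) ⟨
  a ℕ.+ suc n ℕ.* ((n C k) ℕ.+ (n C suc k))
    ≡⟨ cong (λ x → a ℕ.+ suc n ℕ.* x) (nCk+nC[k+1]≡[n+1]C[k+1] n k) ⟩
  suc (suc n) ℕ.* a ∎
  where
  open ≡-Reasoning
  a = suc n C suc k

ℤ-swap : ∀ a b c → a ℤ.* (b ℤ.* c) ≡ b ℤ.* (a ℤ.* c)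
ℤ-swap = solve-∀

-- The Euler operator `X d/dX`. It preserves degrees, so its product rule can be read off at a
-- single coefficient.
θ : Series → Series
θ f n = + n ℤ.* f n

θ-cong : ∀ {f g} → f ≋ g → θ f ≋ θ g
θ-cong p = pw λ n → cong (+ n ℤ.*_) (at p n)

θ-⊛ : ∀ f g → θ (f ⊛ g) ≋ θ f ⊛ g ⊕ f ⊛ θ g
θ-⊛ f g = pw (go f)
  where
  -- Peeling `f` shifts its index, and `tail` records that `θ` then gains one copy of the shifted
  -- series. The last bracket is zero by the induction hypothesis.
  assemble : ∀ a c m u v p → (ℤ.1ℤ ℤ.+ m) ℤ.* (a ℤ.* c ℤ.+ p)
    ≡ ((ℤ.0ℤ ℤ.* a) ℤ.* c ℤ.+ (p ℤ.+ u)) ℤ.+ (a ℤ.* ((ℤ.1ℤ ℤ.+ m) ℤ.* c) ℤ.+ v)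
      ℤ.+ (m ℤ.* p ℤ.- (u ℤ.+ v))
  assemble = solve-∀
  cancel : ∀ x y → x ℤ.+ (y ℤ.- y) ≡ x
  cancel = solve-∀
  base : ∀ a c → ℤ.0ℤ ℤ.* (a ℤ.* c) ≡ (ℤ.0ℤ ℤ.* a) ℤ.* c ℤ.+ a ℤ.* (ℤ.0ℤ ℤ.* c)
  base = solve-∀
  tail : ∀ f → θ f ∘ suc ≋ (f ∘ suc) ⊕ θ (f ∘ suc)
  tail f = pw λ n → one-more (f (suc n)) (+ n)
    where
    one-more : ∀ a n → (ℤ.1ℤ ℤ.+ n) ℤ.* a ≡ a ℤ.+ n ℤ.* a
    one-more = solve-∀
  go : ∀ f n → θ (f ⊛ g) n ≡ (θ f ⊛ g ⊕ f ⊛ θ g) n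
  go f zero    = base (f 0) (g 0)
  go f (suc n) = begin
    + suc n ℤ.* (f 0 ℤ.* g (suc n) ℤ.+ p)
      ≡⟨ assemble (f 0) (g (suc n)) (+ n) u v p ⟩
    main ℤ.+ (+ n ℤ.* p ℤ.- (u ℤ.+ v))
      ≡⟨ cong (λ x → main ℤ.+ (x ℤ.- (u ℤ.+ v))) (go (f ∘ suc) n) ⟩
    main ℤ.+ (u ℤ.+ v ℤ.- (u ℤ.+ v))
      ≡⟨ cancel main (u ℤ.+ v) ⟩
    main
      ≡⟨ cong (λ x → (ℤ.0ℤ ℤ.* f 0) ℤ.* g (suc n) ℤ.+ x ℤ.+ (f ⊛ θ g) (suc n))
          (trans (at (S.*-congʳ {g} (tail f)) n) (at (S.distribʳ g (f ∘ suc) (θ (f ∘ suc))) n)) ⟨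
    (θ f ⊛ g ⊕ f ⊛ θ g) (suc n) ∎
    where
    open ≡-Reasoning
    p = ((f ∘ suc) ⊛ g) n
    u = (θ (f ∘ suc) ⊛ g) n
    v = ((f ∘ suc) ⊛ θ g) n
    main = (ℤ.0ℤ ℤ.* f 0) ℤ.* g (suc n) ℤ.+ (p ℤ.+ u) ℤ.+ (f 0 ℤ.* (+ suc n ℤ.* g (suc n)) ℤ.+ v)

θ-X : θ X ≋ X
θ-X = pw λ { 0 → refl ; 1 → refl ; (suc (suc n)) → ℤ.*-zeroʳ (+ suc (suc n)) }

θ-𝟙 : θ 𝟙 ≋ 𝟘
θ-𝟙 = pw λ { 0 → refl ; (suc n) → ℤ.*-zeroʳ (+ suc n) }

θ-pow : ∀ h c → θ (pow h (suc c)) ≋ const (+ suc c) ⊛ (θ h ⊛ pow h c)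
θ-pow h zero = begin
  θ (h ⊛ 𝟙) ≈⟨ θ-cong (S.*-identityʳ h) ⟩
  θ h ≈⟨ S.*-identityʳ (θ h) ⟨
  θ h ⊛ 𝟙 ≈⟨ S.*-identityˡ (θ h ⊛ 𝟙) ⟨
  𝟙 ⊛ (θ h ⊛ 𝟙) ∎
  where open SetoidReasoning S.setoid
θ-pow h (suc c) = begin
  θ (h ⊛ pow h (suc c))
    ≈⟨ θ-⊛ h (pow h (suc c)) ⟩
  θ h ⊛ pow h (suc c) ⊕ h ⊛ θ (pow h (suc c))
    ≈⟨ S.+-congˡ {θ h ⊛ pow h (suc c)} (S.*-congˡ {h} (θ-pow h c)) ⟩
  θ h ⊛ pow h (suc c) ⊕ h ⊛ (const (+ suc c) ⊛ (θ h ⊛ pow h c))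
    ≈⟨ derivation-power h (θ h) (const (+ suc c)) (pow h c) ⟩
  (𝟙 ⊕ const (+ suc c)) ⊛ (θ h ⊛ pow h (suc c))
    ≈⟨ S.*-congʳ {θ h ⊛ pow h (suc c)} (pw λ { 0 → refl ; (suc n) → refl }) ⟩
  const (+ suc (suc c)) ⊛ (θ h ⊛ pow h (suc c)) ∎
  where open SetoidReasoning S.setoid

-- By Lagrange inversion the histories of length ℓ with c finished components that end in a state of
-- weight M number functional ℓ c M / (ℓ + 1); the lemmas below verify this by induction on ℓ instead.
functional : ℕ → ℕ → Series → ℤ
functional ℓ c M = + (suc ℓ C c) ℤ.* (θ (X ⊛ M) ⊛ pow H c) (suc ℓ)

functional-cong : ∀ ℓ c {M N} → M ≋ N → functional ℓ c M ≡ functional ℓ c N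
functional-cong ℓ c p = cong (+ (suc ℓ C c) ℤ.*_)
  (at (S.*-congʳ {pow H c} (θ-cong (S.*-congˡ {X} p))) (suc ℓ))

functional-⊕ : ∀ ℓ c M N → functional ℓ c (M ⊕ N) ≡ functional ℓ c M ℤ.+ functional ℓ c N
functional-⊕ ℓ c M N = trans
  (cong (+ (suc ℓ C c) ℤ.*_) (at expand (suc ℓ)))
  (ℤ.*-distribˡ-+ (+ (suc ℓ C c)) _ _)
  where
  open SetoidReasoning S.setoid
  expand : θ (X ⊛ (M ⊕ N)) ⊛ pow H c ≋ θ (X ⊛ M) ⊛ pow H c ⊕ θ (X ⊛ N) ⊛ pow H c
  expand = begin
    θ (X ⊛ (M ⊕ N)) ⊛ pow H c
      ≈⟨ S.*-congʳ {pow H c} (θ-cong (S.distribˡ X M N)) ⟩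
    θ (X ⊛ M ⊕ X ⊛ N) ⊛ pow H c
      ≈⟨ S.*-congʳ {pow H c} (pw λ n → ℤ.*-distribˡ-+ (+ n) ((X ⊛ M) n) ((X ⊛ N) n)) ⟩
    (θ (X ⊛ M) ⊕ θ (X ⊛ N)) ⊛ pow H c
      ≈⟨ S.distribʳ (pow H c) (θ (X ⊛ M)) (θ (X ⊛ N)) ⟩
    θ (X ⊛ M) ⊛ pow H c ⊕ θ (X ⊛ N) ⊛ pow H c ∎

module _ (M : Series) (ℓ c : ℕ) where
  private
    N = suc ℓ
    a = (θ M ⊛ pow H (suc c)) N
    b = (M ⊛ (θ H ⊛ pow H c)) N
    e = (M ⊛ pow H (suc c)) N

    leibniz : + N ℤ.* e ≡ a ℤ.+ + suc c ℤ.* b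
    leibniz = trans (at (θ-⊛ M (pow H (suc c))) N) (cong (λ x → a ℤ.+ x)
      (trans (at (S.trans (S.*-congˡ {M} (θ-pow H c)) (*-swap M (const (+ suc c)) (θ H ⊛ pow H c))) N)
               (const-⊛ (+ suc c) (M ⊛ (θ H ⊛ pow H c)) N)))

    finished : (θ (X ⊛ (blockWeight 0 1 ⊛ M)) ⊛ pow H c) N ≡ a ℤ.+ b
    finished = at (begin
      θ (X ⊛ (blockWeight 0 1 ⊛ M)) ⊛ pow H c ≈⟨ S.*-congʳ {pow H c} (θ-cong (S.*-assoc X (blockWeight 0 1) M)) ⟨
      θ (H ⊛ M) ⊛ pow H c ≈⟨ S.*-congʳ {pow H c} (θ-⊛ H M) ⟩
      (θ H ⊛ M ⊕ H ⊛ θ M) ⊛ pow H c ≈⟨ collect-derivative H (θ H) M (θ M) (pow H c) ⟩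
      θ M ⊛ pow H (suc c) ⊕ M ⊛ (θ H ⊛ pow H c) ∎) N
      where open SetoidReasoning S.setoid

  shifted : ∀ p → (θ (X ⊛ M) ⊛ p) (suc N) ≡ (M ⊛ p) N ℤ.+ (θ M ⊛ p) N
  shifted p = trans (at (begin
      θ (X ⊛ M) ⊛ p ≈⟨ S.*-congʳ {p} (θ-⊛ X M) ⟩
      (θ X ⊛ M ⊕ X ⊛ θ M) ⊛ p ≈⟨ S.*-congʳ {p} (S.+-congʳ {X ⊛ θ M} (S.*-congʳ {M} θ-X)) ⟩
      (X ⊛ M ⊕ X ⊛ θ M) ⊛ p ≈⟨ factor-sum X M (θ M) p ⟩
      X ⊛ (M ⊛ p ⊕ θ M ⊛ p) ∎) (suc N)) (X-⊛-suc (M ⊛ p ⊕ θ M ⊛ p) N)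
    where open SetoidReasoning S.setoid

  -- `M` is the weight of the state reached. The first summand comes from `finish`, whose source
  -- state has the additional block `(0 , 1)`. The second comes from `push` and `close`; it is
  -- written with `θ M` because undoing them divides `M` by `X`, which the functional multiplies
  -- back. Pascal's rule collects the terms in `a`, absorption those in `b`, and the product rule
  -- for `M H^(c+1)` brings in `e`.
  functional-step : + suc N ℤ.* (functional ℓ c (blockWeight 0 1 ⊛ M)
      ℤ.+ + (N C suc c) ℤ.* (θ M ⊛ pow H (suc c)) N)
    ≡ + N ℤ.* functional N (suc c) M
  functional-step = begin
    + suc N ℤ.* (+ (N C c) ℤ.* (θ (X ⊛ (blockWeight 0 1 ⊛ M)) ⊛ pow H c) N ℤ.+ k ℤ.* a)
      ≡⟨ cong (λ x → + suc N ℤ.* (+ (N C c) ℤ.* x ℤ.+ k ℤ.* a)) finished ⟩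
    + suc N ℤ.* (+ (N C c) ℤ.* (a ℤ.+ b) ℤ.+ k ℤ.* a)
      ≡⟨ regroup (+ suc N) (+ (N C c)) k a b ⟩
    + suc N ℤ.* (+ (N C c) ℤ.+ k) ℤ.* a ℤ.+ (+ suc N ℤ.* + (N C c)) ℤ.* b
      ≡⟨ cong₂ (λ x y → + suc N ℤ.* x ℤ.* a ℤ.+ y ℤ.* b) pascal absorb ⟩
    + suc N ℤ.* K ℤ.* a ℤ.+ (+ suc c ℤ.* K) ℤ.* b
      ≡⟨ regroup′ (+ N) (+ suc c) K a b ⟩
    K ℤ.* ((a ℤ.+ + suc c ℤ.* b) ℤ.+ + N ℤ.* a)
      ≡⟨ cong (λ x → K ℤ.* (x ℤ.+ + N ℤ.* a)) leibniz ⟨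
    K ℤ.* (+ N ℤ.* e ℤ.+ + N ℤ.* a)
      ≡⟨ regroup″ (+ N) K a e ⟩
    + N ℤ.* (K ℤ.* (e ℤ.+ a))
      ≡⟨ cong (λ x → + N ℤ.* (K ℤ.* x)) (shifted (pow H (suc c))) ⟨
    + N ℤ.* functional N (suc c) M ∎
    where
    open ≡-Reasoning
    k = + (N C suc c)
    K = + (suc N C suc c)
    pascal : + (N C c) ℤ.+ k ≡ K
    pascal = cong +_ (nCk+nC[k+1]≡[n+1]C[k+1] N c)
    absorb : + suc N ℤ.* + (N C c) ≡ + suc c ℤ.* K
    absorb = trans (sym (ℤ.pos-* (suc N) (N C c)))
      (trans (cong +_ (sym (C-absorb N c))) (ℤ.pos-* (suc c) (suc N C suc c)))
    regroup : ∀ n j k a b → n ℤ.* (j ℤ.* (a ℤ.+ b) ℤ.+ k ℤ.* a) ≡ n ℤ.* (j ℤ.+ k) ℤ.* a ℤ.+ (n ℤ.* j) ℤ.* b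
    regroup = solve-∀
    regroup′ : ∀ n c k a b → (ℤ.1ℤ ℤ.+ n) ℤ.* k ℤ.* a ℤ.+ (c ℤ.* k) ℤ.* b ≡ k ℤ.* ((a ℤ.+ c ℤ.* b) ℤ.+ n ℤ.* a)
    regroup′ = solve-∀
    regroup″ : ∀ n k a e → k ℤ.* (n ℤ.* e ℤ.+ n ℤ.* a) ≡ n ℤ.* (k ℤ.* (e ℤ.+ a))
    regroup″ = solve-∀

functional-step-zero : ∀ M ℓ → + suc (suc ℓ) ℤ.* (+ (suc ℓ C 0) ℤ.* (θ M ⊛ pow H 0) (suc ℓ))
  ≡ + suc ℓ ℤ.* functional (suc ℓ) 0 M
functional-step-zero M ℓ = begin
  + suc N ℤ.* (+ 1 ℤ.* (θ M ⊛ 𝟙) N)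
    ≡⟨ cong (λ x → + suc N ℤ.* (+ 1 ℤ.* x)) (at (S.*-identityʳ (θ M)) N) ⟩
  + suc N ℤ.* (+ 1 ℤ.* (+ N ℤ.* M N))
    ≡⟨ regroup (+ N) (M N) ⟩
  + N ℤ.* (+ 1 ℤ.* (M N ℤ.+ + N ℤ.* M N))
    ≡⟨ cong₂ (λ x y → + N ℤ.* (+ 1 ℤ.* (x ℤ.+ y))) (at (S.*-identityʳ M) N) (at (S.*-identityʳ (θ M)) N) ⟨
  + N ℤ.* (+ 1 ℤ.* ((M ⊛ 𝟙) N ℤ.+ (θ M ⊛ 𝟙) N))
    ≡⟨ cong (λ x → + N ℤ.* (+ 1 ℤ.* x)) (shifted M ℓ 0 𝟙) ⟨
  + N ℤ.* functional N 0 M ∎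
  where
  open ≡-Reasoning
  N = suc ℓ
  regroup : ∀ n m → (ℤ.1ℤ ℤ.+ n) ℤ.* (ℤ.1ℤ ℤ.* (n ℤ.* m)) ≡ n ℤ.* (ℤ.1ℤ ℤ.* (m ℤ.+ n ℤ.* m))
  regroup = solve-∀

-- The weight of a state counts its histories

weight : State → Series
weight []            = 𝟙
weight ((b , f) ∷ s) = blockWeight b f ⊛ weight s

weight-ʳ++ : ∀ pre s → weight (pre ʳ++ s) ≋ weight pre ⊛ weight s
weight-ʳ++ []              s = S.sym (S.*-identityˡ (weight s))
weight-ʳ++ ((b , f) ∷ pre) s = begin
  weight (pre ʳ++ (b , f) ∷ s) ≈⟨ weight-ʳ++ pre ((b , f) ∷ s) ⟩
  weight pre ⊛ (blockWeight b f ⊛ weight s) ≈⟨ *-swap (weight pre) (blockWeight b f) (weight s) ⟩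
  blockWeight b f ⊛ (weight pre ⊛ weight s) ≈⟨ S.*-assoc (blockWeight b f) (weight pre) (weight s) ⟨
  (blockWeight b f ⊛ weight pre) ⊛ weight s ∎
  where open SetoidReasoning S.setoid

-- A block without the point read last: nothing if the chord was pushed, a prefix if the block
-- results from a closing.
remainder : ℕ → ℕ → Series
remainder b f = const (+ countMarks b f) ⊕ prefixes (suc b) f

block-remainder : ∀ b f → blockWeight b f ≋ X ⊛ remainder b f
block-remainder zero f = begin
  blockWeight 0 f ≈⟨ block-zero f ⟩
  mark f ⊕ X ⊛ prefixes 1 f ≈⟨ S.+-congʳ {X ⊛ prefixes 1 f} (mark-X f) ⟩
  X ⊛ const (+ countMarks 0 f) ⊕ X ⊛ prefixes 1 f ≈⟨ S.distribˡ X (const (+ countMarks 0 f)) (prefixes 1 f) ⟨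
  X ⊛ remainder 0 f ∎
  where
  open SetoidReasoning S.setoid
  const-zero : const (+ 0) ≋ 𝟘
  const-zero = pw λ { 0 → refl ; (suc n) → refl }
  mark-X : ∀ f → mark f ≋ X ⊛ const (+ countMarks 0 f)
  mark-X 0 = S.sym (S.*-identityʳ X)
  mark-X 1 = S.sym (S.*-identityʳ X)
  mark-X (suc (suc f)) = S.sym (S.trans (S.*-congˡ {X} const-zero) (S.zeroʳ X))
block-remainder (suc b) f = S.*-congˡ {X} (S.sym (S.trans
  (S.+-congʳ {prefixes (2 ℕ.+ b) f} {const (+ 0)} {𝟘} (pw λ { 0 → refl ; (suc n) → refl }))
  (S.+-identityˡ (prefixes (2 ℕ.+ b) f))))

private
  scaled-+ : ∀ k x y {u v} → k ℤ.* + x ≡ u → k ℤ.* + y ≡ v → k ℤ.* + (x ℕ.+ y) ≡ u ℤ.+ v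
  scaled-+ k x y refl refl = trans (cong (k ℤ.*_) (ℤ.pos-+ x y)) (ℤ.*-distribˡ-+ k (+ x) (+ y))

module _ (ℓ c : ℕ) where
  private
    L = functional ℓ c
    N = + suc ℓ

  -- Summing over all distributions of `f` marks is the Cauchy product in ε. `D` and `E` are the
  -- weights of the blocks on either side of the varying part.
  antidiagonal-weight : ∀ D E (u v : ℕ → Series) Q →
    (∀ f₁ f₂ → N ℤ.* + Q f₁ f₂ ≡ L (D ⊛ ((u f₁ ⊛ v f₂) ⊛ E))) →
    ∀ f → N ℤ.* + antidiagonal Q f ≡ L (D ⊛ ((u Marked.⊛ v) f ⊛ E))
  antidiagonal-weight D E u v Q eq zero    = eq 0 0
  antidiagonal-weight D E u v Q eq (suc f) = trans
    (scaled-+ N (Q 0 (suc f)) _ (eq 0 (suc f))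
      (antidiagonal-weight D E (u ∘ suc) v (Q ∘ suc) (λ f₁ → eq (suc f₁)) f))
    (trans (sym (functional-⊕ ℓ c _ _)) (functional-cong ℓ c (S.sym expand)))
    where
    open SetoidReasoning S.setoid
    a = u 0 ⊛ v (suc f)
    b = ((u ∘ suc) Marked.⊛ v) f
    expand : D ⊛ ((a ⊕ b) ⊛ E) ≋ D ⊛ (a ⊛ E) ⊕ D ⊛ (b ⊛ E)
    expand = begin
      D ⊛ ((a ⊕ b) ⊛ E) ≈⟨ S.*-congˡ {D} (S.distribʳ E a b) ⟩
      D ⊛ (a ⊛ E ⊕ b ⊛ E) ≈⟨ S.distribˡ D (a ⊛ E) (b ⊛ E) ⟩
      D ⊛ (a ⊛ E) ⊕ D ⊛ (b ⊛ E) ∎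

  splits-weight : ∀ F → (∀ s → N ℤ.* + F s ≡ L (weight s)) → ∀ pre r f s →
    N ℤ.* + countSplits F pre r f s ≡ L (weight pre ⊛ (prefixes r f ⊛ weight s))
  splits-weight F eq pre zero    f s = trans (eq (pre ʳ++ (0 , f) ∷ s))
    (functional-cong ℓ c (weight-ʳ++ pre ((0 , f) ∷ s)))
  splits-weight F eq pre (suc r) f s = trans
    (scaled-+ N (F (pre ʳ++ (suc r , f) ∷ s)) _
      (trans (eq (pre ʳ++ (suc r , f) ∷ s)) (functional-cong ℓ c (weight-ʳ++ pre ((suc r , f) ∷ s))))
      (antidiagonal-weight (weight pre) (weight s) (blockWeight 0) (prefixes r)
        (λ f₁ f₂ → countSplits F ((0 , f₁) ∷ pre) r f₂ s)
        (λ f₁ f₂ → trans (splits-weight F eq ((0 , f₁) ∷ pre) r f₂ s) (functional-cong ℓ c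
          (S.trans (S.*-assoc (blockWeight 0 f₁) (weight pre) (prefixes r f₂ ⊛ weight s))
                   (*-reassoc (blockWeight 0 f₁) (weight pre) (prefixes r f₂) (weight s)))))
        f))
    (trans (sym (functional-⊕ ℓ c _ _)) (functional-cong ℓ c (S.sym expand)))
    where
    open SetoidReasoning S.setoid
    a = blockWeight (suc r) f
    b = (blockWeight 0 Marked.⊛ prefixes r) f
    expand : weight pre ⊛ (prefixes (suc r) f ⊛ weight s)
      ≋ weight pre ⊛ (a ⊛ weight s) ⊕ weight pre ⊛ (b ⊛ weight s)
    expand = begin
      weight pre ⊛ (prefixes (suc r) f ⊛ weight s)
        ≈⟨ S.*-congˡ {weight pre} (S.*-congʳ {weight s} (prefixes-suc r f)) ⟩
      weight pre ⊛ ((a ⊕ b) ⊛ weight s)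
        ≈⟨ S.*-congˡ {weight pre} (S.distribʳ (weight s) a b) ⟩
      weight pre ⊛ (a ⊛ weight s ⊕ b ⊛ weight s)
        ≈⟨ S.distribˡ (weight pre) (a ⊛ weight s) (b ⊛ weight s) ⟩
      weight pre ⊛ (a ⊛ weight s) ⊕ weight pre ⊛ (b ⊛ weight s) ∎

  -- Undoing the last step leaves `remainder b f` times the weight of `s`. The functional multiplies
  -- this by `X`, which restores the full weight; hence the form required by `functional-step`.
  unfinished-weight : ∀ b f s → (∀ s → N ℤ.* + countHistories s ℓ c ≡ L (weight s)) →
    N ℤ.* + (countMarks b f ℕ.* countHistories s ℓ c ℕ.+ countSplits (λ s′ → countHistories s′ ℓ c) [] (suc b) f s)
    ≡ + (suc ℓ C c) ℤ.* (θ (weight ((b , f) ∷ s)) ⊛ pow H c) (suc ℓ)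
  unfinished-weight b f s ih = trans
    (scaled-+ N (countMarks b f ℕ.* countHistories s ℓ c) _ marked
      (trans (splits-weight _ ih [] (suc b) f s) (functional-cong ℓ c (S.*-identityˡ (prefixes (suc b) f ⊛ weight s)))))
    (trans (sym (functional-⊕ ℓ c _ _))
      (cong (+ (suc ℓ C c) ℤ.*_) (at (S.*-congʳ {pow H c} (θ-cong (S.sym collect))) (suc ℓ))))
    where
    k = const (+ countMarks b f)
    module R = SetoidReasoning S.setoid
    collect : weight ((b , f) ∷ s) ≋ X ⊛ (k ⊛ weight s ⊕ prefixes (suc b) f ⊛ weight s)
    collect = R.begin
      blockWeight b f ⊛ weight s R.≈⟨ S.*-congʳ {weight s} (block-remainder b f) ⟩
      (X ⊛ remainder b f) ⊛ weight s R.≈⟨ S.*-assoc X (remainder b f) (weight s) ⟩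
      X ⊛ (remainder b f ⊛ weight s) R.≈⟨ S.*-congˡ {X} (S.distribʳ (weight s) k (prefixes (suc b) f)) ⟩
      X ⊛ (k ⊛ weight s ⊕ prefixes (suc b) f ⊛ weight s) R.∎
    scale : ∀ j → + (suc ℓ C c) ℤ.* (θ (X ⊛ (const j ⊛ weight s)) ⊛ pow H c) (suc ℓ) ≡ j ℤ.* L (weight s)
    scale j = trans (cong (+ (suc ℓ C c) ℤ.*_) (at expand (suc ℓ)))
      (trans (cong (+ (suc ℓ C c) ℤ.*_) (const-⊛ j (θ (X ⊛ weight s) ⊛ pow H c) (suc ℓ)))
        (ℤ-swap (+ (suc ℓ C c)) j _))
      where
      θ-const : θ (const j) ≋ 𝟘
      θ-const = pw λ { 0 → ℤ.*-zeroˡ j ; (suc n) → ℤ.*-zeroʳ (+ suc n) }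
      expand : θ (X ⊛ (const j ⊛ weight s)) ⊛ pow H c ≋ const j ⊛ (θ (X ⊛ weight s) ⊛ pow H c)
      expand = R.begin
        θ (X ⊛ (const j ⊛ weight s)) ⊛ pow H c
          R.≈⟨ S.*-congʳ {pow H c} (θ-cong (*-swap X (const j) (weight s))) ⟩
        θ (const j ⊛ (X ⊛ weight s)) ⊛ pow H c
          R.≈⟨ S.*-congʳ {pow H c} (θ-⊛ (const j) (X ⊛ weight s)) ⟩
        (θ (const j) ⊛ (X ⊛ weight s) ⊕ const j ⊛ θ (X ⊛ weight s)) ⊛ pow H c
          R.≈⟨ S.*-congʳ {pow H c} (S.+-congʳ {const j ⊛ θ (X ⊛ weight s)}
                (S.trans (S.*-congʳ {X ⊛ weight s} θ-const) (S.zeroˡ (X ⊛ weight s)))) ⟩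
        (𝟘 ⊕ const j ⊛ θ (X ⊛ weight s)) ⊛ pow H c
          R.≈⟨ S.*-congʳ {pow H c} (S.+-identityˡ (const j ⊛ θ (X ⊛ weight s))) ⟩
        (const j ⊛ θ (X ⊛ weight s)) ⊛ pow H c
          R.≈⟨ S.*-assoc (const j) (θ (X ⊛ weight s)) (pow H c) ⟩
        const j ⊛ (θ (X ⊛ weight s) ⊛ pow H c) R.∎
    marked : N ℤ.* + (countMarks b f ℕ.* countHistories s ℓ c) ≡ L (k ⊛ weight s)
    marked = begin
      N ℤ.* + (countMarks b f ℕ.* countHistories s ℓ c)
        ≡⟨ cong (N ℤ.*_) (ℤ.pos-* (countMarks b f) (countHistories s ℓ c)) ⟩
      N ℤ.* (+ countMarks b f ℤ.* + countHistories s ℓ c)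
        ≡⟨ ℤ-swap N (+ countMarks b f) _ ⟩
      + countMarks b f ℤ.* (N ℤ.* + countHistories s ℓ c)
        ≡⟨ cong (+ countMarks b f ℤ.*_) (ih s) ⟩
      + countMarks b f ℤ.* L (weight s)
        ≡⟨ scale (+ countMarks b f) ⟨
      L (k ⊛ weight s) ∎
      where
      open ≡-Reasoning

private
  cancel-suc : ∀ n {x y} → + suc n ℤ.* x ≡ + suc n ℤ.* y → x ≡ y
  cancel-suc n {x} {y} = ℤ.*-cancelˡ-≡ (+ suc n) x y

  -- Turns a recursion scaled by ℓ + 1 and a step identity into the claim scaled by ℓ + 2,
  -- cancelling the common factor.
  rescale : ∀ n {v a x} → + suc n ℤ.* v ≡ a → + suc (suc n) ℤ.* a ≡ + suc n ℤ.* x → + suc (suc n) ℤ.* v ≡ x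
  rescale n {v} {_} {x} refl q = cancel-suc n (trans (ℤ-swap (+ suc n) (+ suc (suc n)) v) q)

-- Every block accounts for at least one point read.
weight-at-0 : ∀ b f s → weight ((b , f) ∷ s) 0 ≡ + 0
weight-at-0 b f s = cong (ℤ._* weight s 0) (trans (at (block-remainder b f) 0) (X-⊛-zero (remainder b f)))

-- Neither `push` nor `close` ends in the empty state, and `θ` correspondingly kills its weight `𝟙`.
constant-weight : ∀ ℓ c → + suc ℓ ℤ.* + 0 ≡ + (suc ℓ C c) ℤ.* (θ 𝟙 ⊛ pow H c) (suc ℓ)
constant-weight ℓ c = trans (ℤ.*-zeroʳ (+ suc ℓ)) (sym (trans
  (cong (+ (suc ℓ C c) ℤ.*_) (at (S.trans (S.*-congʳ {pow H c} θ-𝟙) (S.zeroˡ (pow H c))) (suc ℓ)))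
  (ℤ.*-zeroʳ (+ (suc ℓ C c)))))

histories-weight : ∀ ℓ c s → + suc ℓ ℤ.* + countHistories s ℓ c ≡ functional ℓ c (weight s)
histories-weight zero    c s = trans (initial s c) (sym base)
  where
  base : functional 0 c (weight s) ≡ + (1 C c) ℤ.* (weight s 0 ℤ.* pow H c 0)
  base = cong (+ (1 C c) ℤ.*_) (trans
    (cong₂ ℤ._+_ (ℤ.*-zeroˡ (pow H c 1))
      (cong (ℤ._* pow H c 0) (trans (ℤ.*-identityˡ _) (X-⊛-suc (weight s) 0))))
    (ℤ.+-identityˡ _))
  initial : ∀ s c → + 1 ℤ.* + countHistories s 0 c ≡ + (1 C c) ℤ.* (weight s 0 ℤ.* pow H c 0)
  initial []            zero    = refl
  initial []            (suc c) = sym (ℤ.*-zeroʳ (+ (1 C suc c)))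
  initial ((b , f) ∷ s) c       = sym (trans
    (cong (λ x → + (1 C c) ℤ.* (x ℤ.* pow H c 0)) (weight-at-0 b f s)) (ℤ.*-zeroʳ (+ (1 C c))))
histories-weight (suc ℓ) zero [] = rescale ℓ
  (constant-weight ℓ 0) (functional-step-zero 𝟙 ℓ)
histories-weight (suc ℓ) (suc c) [] = rescale ℓ
  (trans (cong (λ x → + suc ℓ ℤ.* + x) (sym (ℕ.+-identityʳ _)))
    (scaled-+ (+ suc ℓ) (countHistories ((0 , 1) ∷ []) ℓ c) 0
      (histories-weight ℓ c ((0 , 1) ∷ [])) (constant-weight ℓ (suc c))))
  (functional-step 𝟙 ℓ c)
histories-weight (suc ℓ) zero ((b , f) ∷ s) = rescale ℓ
  (unfinished-weight ℓ 0 b f s (histories-weight ℓ 0))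
  (functional-step-zero (weight ((b , f) ∷ s)) ℓ)
histories-weight (suc ℓ) (suc c) ((b , f) ∷ s) = rescale ℓ
  (scaled-+ (+ suc ℓ) (countHistories ((0 , 1) ∷ (b , f) ∷ s) ℓ c) _
    (histories-weight ℓ c ((0 , 1) ∷ (b , f) ∷ s))
    (unfinished-weight ℓ (suc c) b f s (histories-weight ℓ (suc c))))
  (functional-step (weight ((b , f) ∷ s)) ℓ c)

-- For the weight `𝟙` the functional contains `θ X = X`, which lowers the degree by one. Absorption
-- turns `C(ℓ+1, c+1) / (ℓ+1)` into `C(ℓ, c) / (c+1)`.
closed-histories : ∀ ℓ c → + suc c ℤ.* + countHistories [] ℓ (suc c) ≡ + (ℓ C c) ℤ.* pow H (suc c) ℓ
closed-histories ℓ c = cancel-suc ℓ (begin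
  + suc ℓ ℤ.* (+ suc c ℤ.* v) ≡⟨ ℤ-swap (+ suc ℓ) (+ suc c) v ⟩
  + suc c ℤ.* (+ suc ℓ ℤ.* v) ≡⟨ cong (+ suc c ℤ.*_) (histories-weight ℓ (suc c) []) ⟩
  + suc c ℤ.* (K ℤ.* (θ (X ⊛ 𝟙) ⊛ p) (suc ℓ)) ≡⟨ cong (λ x → + suc c ℤ.* (K ℤ.* x)) coefficient ⟩
  + suc c ℤ.* (K ℤ.* p ℓ) ≡⟨ ℤ.*-assoc (+ suc c) K (p ℓ) ⟨
  + suc c ℤ.* K ℤ.* p ℓ ≡⟨ cong (ℤ._* p ℓ) absorb ⟩
  + suc ℓ ℤ.* + (ℓ C c) ℤ.* p ℓ ≡⟨ ℤ.*-assoc (+ suc ℓ) (+ (ℓ C c)) (p ℓ) ⟩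
  + suc ℓ ℤ.* (+ (ℓ C c) ℤ.* p ℓ) ∎)
  where
  open ≡-Reasoning
  v = + countHistories [] ℓ (suc c)
  p = pow H (suc c)
  K = + (suc ℓ C suc c)
  absorb : + suc c ℤ.* K ≡ + suc ℓ ℤ.* + (ℓ C c)
  absorb = trans (sym (ℤ.pos-* (suc c) (suc ℓ C suc c)))
    (trans (cong +_ (C-absorb ℓ c)) (ℤ.pos-* (suc ℓ) (ℓ C c)))
  coefficient : (θ (X ⊛ 𝟙) ⊛ p) (suc ℓ) ≡ p ℓ
  coefficient = trans
    (at (S.*-congʳ {p} (S.trans (θ-cong (S.*-identityʳ X)) θ-X)) (suc ℓ)) (X-⊛-suc p ℓ)

open import Data.Nat using (_<_; s≤s; z≤n)

-- The coefficients of H^m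

private
  -- A finished tree has exactly one mark, so it suffices to work modulo ε²: `π` evaluates at ε = 0
  -- and `D` differentiates there.
  D π : Marked.Series → Series
  D g = transpose g 1
  π g = transpose g 0

  D-⊛ : ∀ g h → D (g Marked.⊛ h) ≋ π g ⊛ D h ⊕ D g ⊛ π h
  D-⊛ g h = pw (transpose-⊛ g h 1)

  π-⊛ : ∀ g h → π (g Marked.⊛ h) ≋ π g ⊛ π h
  π-⊛ g h = pw (transpose-⊛ g h 0)

  D-cong : ∀ {g h} → g Marked.≋ h → D g ≋ D h
  D-cong p = pw λ n → at (Marked.at p n) 1

  π-β : ∀ s n → π (Bε.β s) n ≡ β s n
  π-β s       0             = refl
  π-β s       1             = refl
  π-β zero    (suc (suc n)) = refl
  π-β (suc s) (suc (suc n)) = cong₂ ℤ._+_ (π-β s (suc (suc n))) (cong (+ 1 ℤ.*_) (π-β (3 ℕ.+ s) n))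

  π-const : π (Marked.const 1+ε) ≋ 𝟙
  π-const = pw λ { 0 → refl ; (suc n) → refl }

  D-const : D (Marked.const 1+ε) ≋ 𝟙
  D-const = pw λ { 0 → refl ; (suc n) → refl }

  π-X : π Marked.X ≋ X
  π-X = pw λ { 0 → refl ; 1 → refl ; (suc (suc n)) → refl }

  D-X : D Marked.X ≋ 𝟘
  D-X = pw λ { 0 → refl ; 1 → refl ; (suc (suc n)) → refl }

  π-Y : π Bε.Y ≋ Y
  π-Y = S.trans (π-⊛ (Marked.const 1+ε) (Marked.X Marked.⊛ Marked.X))
    (S.*-cong {x = π (Marked.const 1+ε)} π-const (S.trans (π-⊛ Marked.X Marked.X) (S.*-cong {x = π Marked.X} π-X π-X)))

  D-XX : D (Marked.X Marked.⊛ Marked.X) ≋ 𝟘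
  D-XX = begin
    D (Marked.X Marked.⊛ Marked.X) ≈⟨ D-⊛ Marked.X Marked.X ⟩
    π Marked.X ⊛ D Marked.X ⊕ D Marked.X ⊛ π Marked.X
      ≈⟨ S.+-cong (S.trans (S.*-congˡ {π Marked.X} D-X) (S.zeroʳ (π Marked.X)))
                  (S.trans (S.*-congʳ {π Marked.X} D-X) (S.zeroˡ (π Marked.X))) ⟩
    𝟘 ⊕ 𝟘 ≈⟨ S.+-identityˡ 𝟘 ⟩
    𝟘 ∎
    where open SetoidReasoning S.setoid

  D-Y : D Bε.Y ≋ Y
  D-Y = begin
    D Bε.Y
      ≈⟨ D-⊛ (Marked.const 1+ε) XX ⟩
    π (Marked.const 1+ε) ⊛ D XX ⊕ D (Marked.const 1+ε) ⊛ π XX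
      ≈⟨ S.+-cong (S.trans (S.*-congˡ {π (Marked.const 1+ε)} D-XX) (S.zeroʳ (π (Marked.const 1+ε))))
                  (S.*-cong {x = D (Marked.const 1+ε)} D-const
                    (S.trans (π-⊛ Marked.X Marked.X) (S.*-cong {x = π Marked.X} π-X π-X))) ⟩
    𝟘 ⊕ Y
      ≈⟨ S.+-identityˡ Y ⟩
    Y ∎
    where
    open SetoidReasoning S.setoid
    XX = Marked.X Marked.⊛ Marked.X

  DB : Series
  DB = D (Bε.β 1)

  β-three : β 3 ≋ β 2 ⊛ β 1
  β-three = B.β-+ 2 1

  D-β-2 : D (Bε.β 2) ≋ β 1 ⊛ DB ⊕ DB ⊛ β 1
  D-β-2 = S.trans (D-cong (Bε.β-+ 1 1)) (S.trans (D-⊛ (Bε.β 1) (Bε.β 1))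
    (S.+-cong (S.*-congʳ {DB} (pw (π-β 1))) (S.*-congˡ {DB} (pw (π-β 1)))))

  D-β-3 : D (Bε.β 3) ≋ β 1 ⊛ (β 1 ⊛ DB ⊕ DB ⊛ β 1) ⊕ DB ⊛ β 2
  D-β-3 = S.trans (D-cong (Bε.β-+ 1 2)) (S.trans (D-⊛ (Bε.β 1) (Bε.β 2))
    (S.+-cong (S.*-cong {x = π (Bε.β 1)} (pw (π-β 1)) D-β-2) (S.*-congˡ {DB} (pw (π-β 2)))))

-- `h` is the derivative of `(1 + ε) B` at ε = 0. The quotient of the closed form is
-- `h = E / (1 - u)`; `v` is kept apart from `u = Y ⊛ v` because `Y` only shifts by two degrees.
u v h E : Series
v = const (+ 3) ⊛ β 2
u = Y ⊛ v
h = β 1 ⊕ DB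
E = const (+ 2) ⊕ ⊖ β 1

private
  -- The derivative of `B = 1 + (1 + ε) X² B³` at ε = 0.
  DB-equation : DB ≋ u ⊛ DB ⊕ Y ⊛ β 3
  DB-equation = begin
    DB
      ≈⟨ D-cong (SS.trans (Bε.β-suc 0) (SS.+-congʳ {Bε.Y Marked.⊛ Bε.β 3} Bε.β-zero)) ⟩
    D Marked.𝟙 ⊕ D (Bε.Y Marked.⊛ Bε.β 3)
      ≈⟨ S.+-cong {x = D Marked.𝟙} {y = 𝟘} (pw λ { 0 → refl ; (suc n) → refl }) (D-⊛ Bε.Y (Bε.β 3)) ⟩
    𝟘 ⊕ (π Bε.Y ⊛ D (Bε.β 3) ⊕ D Bε.Y ⊛ π (Bε.β 3))
      ≈⟨ S.+-identityˡ (π Bε.Y ⊛ D (Bε.β 3) ⊕ D Bε.Y ⊛ π (Bε.β 3)) ⟩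
    π Bε.Y ⊛ D (Bε.β 3) ⊕ D Bε.Y ⊛ π (Bε.β 3)
      ≈⟨ S.+-cong (S.*-cong {x = π Bε.Y} π-Y D-β-3) (S.*-cong {x = D Bε.Y} D-Y (pw (π-β 3))) ⟩
    Y ⊛ (β 1 ⊛ (β 1 ⊛ DB ⊕ DB ⊛ β 1) ⊕ DB ⊛ β 2) ⊕ Y ⊛ β 3
      ≈⟨ S.+-congʳ {Y ⊛ β 3} (triple Y (β 1) DB (β 2) (B.β-+ 1 1)) ⟩
    (Y ⊛ ((𝟙 ⊕ (𝟙 ⊕ 𝟙)) ⊛ β 2)) ⊛ DB ⊕ Y ⊛ β 3
      ≈⟨ S.+-congʳ {Y ⊛ β 3} (S.*-congʳ {DB} (S.*-congˡ {Y} (S.*-congʳ {β 2}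
           (pw λ { 0 → refl ; (suc n) → refl })))) ⟩
    u ⊛ DB ⊕ Y ⊛ β 3 ∎
    where open SetoidReasoning S.setoid

-- With `t = X² B³`, hence `B = 1 + t` and `u B = 3 t`, both sides are `1 + 2 t + u DB`.
h-equation : h ≋ E ⊕ u ⊛ h
h-equation = pw λ n → begin
  β 1 n ℤ.+ DB n
    ≡⟨ cong (λ x → β 1 n ℤ.+ x) (at DB-equation n) ⟩
  β 1 n ℤ.+ ((u ⊛ DB) n ℤ.+ t n)
    ≡⟨ cong (λ x → x ℤ.+ ((u ⊛ DB) n ℤ.+ t n)) (β-1 n) ⟩
  𝟙 n ℤ.+ t n ℤ.+ ((u ⊛ DB) n ℤ.+ t n)
    ≡⟨ assemble (𝟙 n) (t n) ((u ⊛ DB) n) ⟩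
  (𝟙 n ℤ.+ 𝟙 n ℤ.+ ℤ.- (𝟙 n ℤ.+ t n)) ℤ.+ (+ 3 ℤ.* t n ℤ.+ (u ⊛ DB) n)
    ≡⟨ cong₂ (λ x y → (x ℤ.+ ℤ.- y) ℤ.+ (+ 3 ℤ.* t n ℤ.+ (u ⊛ DB) n)) (two n) (sym (β-1 n)) ⟩
  E n ℤ.+ (+ 3 ℤ.* t n ℤ.+ (u ⊛ DB) n)
    ≡⟨ cong (λ x → E n ℤ.+ (x ℤ.+ (u ⊛ DB) n)) (trans (sym (const-⊛ (+ 3) t n)) (at three n)) ⟩
  E n ℤ.+ ((u ⊛ β 1) n ℤ.+ (u ⊛ DB) n)
    ≡⟨ cong (λ x → E n ℤ.+ x) (at (S.distribˡ u (β 1) DB) n) ⟨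
  (E ⊕ u ⊛ h) n ∎
  where
  open ≡-Reasoning
  t = Y ⊛ β 3
  β-1 : ∀ n → β 1 n ≡ 𝟙 n ℤ.+ t n
  β-1 n = at (S.trans (B.β-suc 0) (S.+-congʳ {t} B.β-zero)) n
  two : ∀ n → 𝟙 n ℤ.+ 𝟙 n ≡ const (+ 2) n
  two 0 = refl
  two (suc n) = refl
  assemble : ∀ i t w → i ℤ.+ t ℤ.+ (w ℤ.+ t) ≡ (i ℤ.+ i ℤ.+ ℤ.- (i ℤ.+ t)) ℤ.+ (+ 3 ℤ.* t ℤ.+ w)
  assemble = solve-∀
  three : const (+ 3) ⊛ t ≋ u ⊛ β 1
  three = S.trans (S.*-congˡ {const (+ 3)} (S.*-congˡ {Y} β-three))
                  (*-tuck (const (+ 3)) Y (β 2) (β 1))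

H-factor : H ≋ Y ⊛ h
H-factor = begin
  X ⊛ D (Bε.P 0)
    ≈⟨ S.*-congˡ {X} (D-⊛ (Marked._⊛_ Bε.Z Marked.𝟙) (Bε.β 1)) ⟩
  X ⊛ (π Z1 ⊛ DB ⊕ D Z1 ⊛ π (Bε.β 1))
    ≈⟨ S.*-congˡ {X} (S.+-cong (S.*-congʳ {DB} (Z-marks 0 refl)) (S.*-cong {x = D Z1} (Z-marks 1 refl) (pw (π-β 1)))) ⟩
  X ⊛ (X ⊛ DB ⊕ X ⊛ β 1)
    ≈⟨ S.*-congˡ {X} (S.distribˡ X DB (β 1)) ⟨
  X ⊛ (X ⊛ (DB ⊕ β 1))
    ≈⟨ S.*-congˡ {X} (S.*-congˡ {X} (S.+-comm DB (β 1))) ⟩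
  X ⊛ (X ⊛ h)
    ≈⟨ S.*-assoc X X h ⟨
  (X ⊛ X) ⊛ h
    ≈⟨ S.*-congʳ {h} (S.*-identityˡ (X ⊛ X)) ⟨
  Y ⊛ h ∎
  where
  open SetoidReasoning S.setoid
  Z1 = Bε.Z Marked.⊛ Marked.𝟙
  Z-marks : ∀ f → mark f ≡ X → transpose Z1 f ≋ X
  Z-marks f p = S.trans (pw λ n → at (Marked.at (SS.*-identityʳ Bε.Z) n) f)
    (S.trans (pw (transpose-Z f)) (pw λ n → cong (λ g → g n) p))

-- Finite sums and binomial expansions

Σ< : ℕ → (ℕ → ℤ) → ℤ
Σ< zero    f = + 0
Σ< (suc n) f = f 0 ℤ.+ Σ< n (f ∘ suc)

Σ<-cong : ∀ n {f g} → (∀ i → i < n → f i ≡ g i) → Σ< n f ≡ Σ< n g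
Σ<-cong zero    p = refl
Σ<-cong (suc n) p = cong₂ ℤ._+_ (p 0 (s≤s z≤n)) (Σ<-cong n λ i i<n → p (suc i) (s≤s i<n))

Σ<-+ : ∀ n f g → Σ< n f ℤ.+ Σ< n g ≡ Σ< n (λ i → f i ℤ.+ g i)
Σ<-+ zero    f g = refl
Σ<-+ (suc n) f g = trans (interchange (f 0) (Σ< n (f ∘ suc)) (g 0) (Σ< n (g ∘ suc)))
  (cong (λ x → f 0 ℤ.+ g 0 ℤ.+ x) (Σ<-+ n (f ∘ suc) (g ∘ suc)))
  where
  interchange : ∀ a b c d → (a ℤ.+ b) ℤ.+ (c ℤ.+ d) ≡ (a ℤ.+ c) ℤ.+ (b ℤ.+ d)
  interchange = solve-∀

Σ<-* : ∀ n a f → a ℤ.* Σ< n f ≡ Σ< n (λ i → a ℤ.* f i)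
Σ<-* zero    a f = ℤ.*-zeroʳ a
Σ<-* (suc n) a f = trans (ℤ.*-distribˡ-+ a (f 0) _) (cong (λ x → a ℤ.* f 0 ℤ.+ x) (Σ<-* n a (f ∘ suc)))

Σ<-zero : ∀ n → Σ< n (λ _ → + 0) ≡ + 0
Σ<-zero zero    = refl
Σ<-zero (suc n) = trans (ℤ.+-identityˡ _) (Σ<-zero n)

Σ<-last : ∀ n f → Σ< (suc n) f ≡ Σ< n f ℤ.+ f n
Σ<-last zero    f = ℤ.+-comm (f 0) (+ 0)
Σ<-last (suc n) f = trans (cong (λ x → f 0 ℤ.+ x) (Σ<-last n (f ∘ suc))) (sym (ℤ.+-assoc (f 0) _ _))

Σ<-swap : ∀ m n (f : ℕ → ℕ → ℤ) → Σ< m (λ i → Σ< n (f i)) ≡ Σ< n (λ j → Σ< m (λ i → f i j))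
Σ<-swap zero    n f = sym (Σ<-zero n)
Σ<-swap (suc m) n f = trans (cong (λ x → Σ< n (f 0) ℤ.+ x) (Σ<-swap m n (f ∘ suc)))
  (Σ<-+ n (f 0) (λ j → Σ< m (λ i → f (suc i) j)))

-- The coefficient of `u^j` in `(1 - u)^(-m)`. With truncated subtraction the case `m = 0` also
-- comes out right: 1 at `j = 0` and 0 beyond, so Pascal's rule starts there.
multichoose : ℕ → ℕ → ℕ
multichoose m j = (m ℕ.+ j ∸ 1) C j

multichoose-pascal : ∀ m j → multichoose (suc m) (suc j) ≡ multichoose m (suc j) ℕ.+ multichoose (suc m) j
multichoose-pascal m j rewrite ℕ.+-suc m j =
  trans (sym (nCk+nC[k+1]≡[n+1]C[k+1] (m ℕ.+ j) j)) (ℕ.+-comm ((m ℕ.+ j) C j) _)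

private
  u-assoc : ∀ f → u ⊛ f ≋ Y ⊛ (v ⊛ f)
  u-assoc f = S.*-assoc Y v f

  u-0 : ∀ f → (u ⊛ f) 0 ≡ + 0
  u-0 f = trans (at (u-assoc f) 0) (B.Y-⊛-0 (v ⊛ f))

  u-1 : ∀ f → (u ⊛ f) 1 ≡ + 0
  u-1 f = trans (at (u-assoc f) 1) (B.Y-⊛-1 (v ⊛ f))

  Y-suc : ∀ f n → (Y ⊛ f) (suc (suc n)) ≡ f n
  Y-suc f n = trans (B.Y-⊛-suc f n) (ℤ.*-identityˡ (f n))

  u-suc : ∀ f n → (u ⊛ f) (suc (suc n)) ≡ (v ⊛ f) n
  u-suc f n = trans (at (u-assoc f) (suc (suc n))) (Y-suc (v ⊛ f) n)

-- h = E + u h gives h^m = E^m (1 - u)^{-m}; since u is divisible by X², J terms of the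
-- binomial series determine the coefficients below 2J.
negative-binomial : ∀ m J F n → n < J ℕ.+ J →
  (pow h m ⊛ F) n ≡ Σ< J (λ j → + multichoose m j ℤ.* (pow u j ⊛ (pow E m ⊛ F)) n)
negative-binomial zero (suc J) F n _ = sym (trans
  (cong₂ ℤ._+_ (trans (ℤ.*-identityˡ _) (at (S.*-identityˡ (𝟙 ⊛ F)) n))
    (trans (Σ<-cong J λ j _ → trans
      (cong (λ x → + x ℤ.* (pow u (suc j) ⊛ (𝟙 ⊛ F)) n) (k>n⇒nCk≡0 (ℕ.n<1+n j))) (ℤ.*-zeroˡ ((pow u (suc j) ⊛ (𝟙 ⊛ F)) n)))
      (Σ<-zero J)))
  (ℤ.+-identityʳ _))
negative-binomial (suc m) (suc J) F n n<2J = begin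
  (pow h (suc m) ⊛ F) n
    ≡⟨ at (unfold-power h E u (pow h m) F h-equation) n ⟩
  (pow h m ⊛ (E ⊛ F)) n ℤ.+ (u ⊛ (pow h (suc m) ⊛ F)) n
    ≡⟨ cong₂ ℤ._+_ (trans (negative-binomial m (suc J) (E ⊛ F) n n<2J) (Σ<-cong (suc J) λ j _ →
         cong (+ multichoose m j ℤ.*_) (at (S.*-congˡ {pow u j} (S.sym (*-shift E (pow E m) F))) n))) (rest n n<2J) ⟩
  Σ< (suc J) (λ j → + multichoose m j ℤ.* G j) ℤ.+ Σ< J (λ j → + multichoose (suc m) j ℤ.* G (suc j))
    ≡⟨ ℤ.+-assoc (+ multichoose m 0 ℤ.* G 0) _ _ ⟩
  + 1 ℤ.* G 0 ℤ.+ (Σ< J (λ j → + multichoose m (suc j) ℤ.* G (suc j))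
    ℤ.+ Σ< J (λ j → + multichoose (suc m) j ℤ.* G (suc j)))
    ≡⟨ cong (λ x → + 1 ℤ.* G 0 ℤ.+ x) (trans
         (Σ<-+ J (λ j → + multichoose m (suc j) ℤ.* G (suc j)) (λ j → + multichoose (suc m) j ℤ.* G (suc j)))
         (Σ<-cong J λ j _ → trans
           (sym (ℤ.*-distribʳ-+ (G (suc j)) (+ multichoose m (suc j)) (+ multichoose (suc m) j)))
           (cong (λ x → + x ℤ.* G (suc j)) (sym (multichoose-pascal m j))))) ⟩
  Σ< (suc J) (λ j → + multichoose (suc m) j ℤ.* G j) ∎
  where
  open ≡-Reasoning
  G : ℕ → ℤ
  G j = (pow u j ⊛ (pow E (suc m) ⊛ F)) n
  *-shift : ∀ e p f → (e ⊛ p) ⊛ f ≋ p ⊛ (e ⊛ f)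
  *-shift = *-rotate
  vanish : ∀ n → (∀ f → (u ⊛ f) n ≡ + 0) → (u ⊛ (pow h (suc m) ⊛ F)) n
    ≡ Σ< J (λ j → + multichoose (suc m) j ℤ.* (pow u (suc j) ⊛ (pow E (suc m) ⊛ F)) n)
  vanish n z = trans (z (pow h (suc m) ⊛ F)) (sym (trans
    (Σ<-cong J λ j _ → trans
      (cong (+ multichoose (suc m) j ℤ.*_)
        (trans (at (S.*-assoc u (pow u j) (pow E (suc m) ⊛ F)) n) (z (pow u j ⊛ (pow E (suc m) ⊛ F)))))
      (ℤ.*-zeroʳ (+ multichoose (suc m) j)))
    (Σ<-zero J)))
  rest : ∀ n → n < suc J ℕ.+ suc J → (u ⊛ (pow h (suc m) ⊛ F)) n
    ≡ Σ< J (λ j → + multichoose (suc m) j ℤ.* (pow u (suc j) ⊛ (pow E (suc m) ⊛ F)) n)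
  rest 0 _ = vanish 0 u-0
  rest 1 _ = vanish 1 u-1
  -- The factor `Y` of `u` uses up two degrees and hence one unit of `J`; the factor `v` is moved
  -- into the arbitrary series `F`.
  rest (suc (suc n)) (s≤s lt) = begin
    (u ⊛ (pow h (suc m) ⊛ F)) (suc (suc n))
      ≡⟨ u-suc (pow h (suc m) ⊛ F) n ⟩
    (v ⊛ (pow h (suc m) ⊛ F)) n
      ≡⟨ at (*-swap v (pow h (suc m)) F) n ⟩
    (pow h (suc m) ⊛ (v ⊛ F)) n
      ≡⟨ negative-binomial (suc m) J (v ⊛ F) n (ℕ.s≤s⁻¹ (subst (suc (suc n) ℕ.≤_) (ℕ.+-suc J J) lt)) ⟩
    Σ< J (λ j → + multichoose (suc m) j ℤ.* (pow u j ⊛ (pow E (suc m) ⊛ (v ⊛ F))) n)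
      ≡⟨ Σ<-cong J (λ j _ → cong (+ multichoose (suc m) j ℤ.*_) (trans
           (at (*-pull (pow u j) (pow E (suc m)) F v) n)
           (sym (trans (at (S.*-assoc u (pow u j) (pow E (suc m) ⊛ F)) (suc (suc n)))
             (u-suc (pow u j ⊛ (pow E (suc m) ⊛ F)) n))))) ⟩
    Σ< J (λ j → + multichoose (suc m) j ℤ.* (pow u (suc j) ⊛ (pow E (suc m) ⊛ F)) (suc (suc n))) ∎

-- The coefficient of `B^k` in `(2 - B)^m`.
binomial : ℕ → ℕ → ℤ
binomial m k = sgn k ℤ.* + ((m C k) ℕ.* 2 ℕ.^ (m ∸ k))

private
  binomial-top : ∀ m → binomial m (suc m) ≡ + 0
  binomial-top m = trans
    (cong (λ x → sgn (suc m) ℤ.* + (x ℕ.* 2 ℕ.^ (m ∸ suc m))) (k>n⇒nCk≡0 (ℕ.n<1+n m))) (ℤ.*-zeroʳ (sgn (suc m)))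

  -- For `k < m` the exponent really drops by one; for `k ≥ m` truncation stops it, but the binomial
  -- coefficient vanishes.
  double-power : ∀ m k → (m C suc k) ℕ.* 2 ℕ.^ (m ∸ k) ≡ 2 ℕ.* ((m C suc k) ℕ.* 2 ℕ.^ (m ∸ suc k))
  double-power m k with ℕ.<-≤-connex k m
  ... | inj₁ k<m rewrite ℕ.+-∸-assoc 1 k<m = swap (m C suc k) (2 ℕ.^ (m ∸ suc k))
    where
    swap : ∀ a b → a ℕ.* (2 ℕ.* b) ≡ 2 ℕ.* (a ℕ.* b)
    swap = ℕ-solve-∀
  ... | inj₂ m≤k rewrite k>n⇒nCk≡0 (s≤s m≤k) = refl

  binomial-zero : ∀ m → binomial (suc m) 0 ≡ + 2 ℤ.* binomial m 0
  binomial-zero m = begin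
    + 1 ℤ.* + (1 ℕ.* (2 ℕ.* 2 ℕ.^ m)) ≡⟨ ℤ.*-identityˡ _ ⟩
    + (1 ℕ.* (2 ℕ.* 2 ℕ.^ m)) ≡⟨ cong +_ (ℕ.*-identityˡ _) ⟩
    + (2 ℕ.* 2 ℕ.^ m) ≡⟨ ℤ.pos-* 2 (2 ℕ.^ m) ⟩
    + 2 ℤ.* + (2 ℕ.^ m) ≡⟨ cong (λ x → + 2 ℤ.* + x) (ℕ.*-identityˡ (2 ℕ.^ m)) ⟨
    + 2 ℤ.* + (1 ℕ.* 2 ℕ.^ m) ≡⟨ cong (+ 2 ℤ.*_) (ℤ.*-identityˡ _) ⟨
    + 2 ℤ.* binomial m 0 ∎
    where open ≡-Reasoning

  binomial-suc : ∀ m k → binomial (suc m) (suc k) ≡ + 2 ℤ.* binomial m (suc k) ℤ.- binomial m k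
  binomial-suc m k = begin
    sgn (suc k) ℤ.* + ((suc m C suc k) ℕ.* p)
      ≡⟨ cong (λ x → sgn (suc k) ℤ.* + (x ℕ.* p)) (nCk+nC[k+1]≡[n+1]C[k+1] m k) ⟨
    sgn (suc k) ℤ.* + (((m C k) ℕ.+ (m C suc k)) ℕ.* p)
      ≡⟨ cong (λ x → sgn (suc k) ℤ.* + x) (ℕ.*-distribʳ-+ p (m C k) (m C suc k)) ⟩
    sgn (suc k) ℤ.* + ((m C k) ℕ.* p ℕ.+ (m C suc k) ℕ.* p)
      ≡⟨ cong (λ x → sgn (suc k) ℤ.* + ((m C k) ℕ.* p ℕ.+ x)) (double-power m k) ⟩
    sgn (suc k) ℤ.* (+ ((m C k) ℕ.* p) ℤ.+ + (2 ℕ.* q))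
      ≡⟨ cong (λ x → sgn (suc k) ℤ.* (+ ((m C k) ℕ.* p) ℤ.+ x)) (ℤ.pos-* 2 q) ⟩
    (ℤ.- (+ 1) ℤ.* sgn k) ℤ.* (+ ((m C k) ℕ.* p) ℤ.+ + 2 ℤ.* + q)
      ≡⟨ regroup (sgn k) (+ ((m C k) ℕ.* p)) (+ q) ⟩
    + 2 ℤ.* ((ℤ.- (+ 1) ℤ.* sgn k) ℤ.* + q) ℤ.- sgn k ℤ.* + ((m C k) ℕ.* p) ∎
    where
    open ≡-Reasoning
    p = 2 ℕ.^ (m ∸ k)
    q = (m C suc k) ℕ.* 2 ℕ.^ (m ∸ suc k)
    regroup : ∀ s a b → (ℤ.- (+ 1) ℤ.* s) ℤ.* (a ℤ.+ + 2 ℤ.* b) ≡ + 2 ℤ.* ((ℤ.- (+ 1) ℤ.* s) ℤ.* b) ℤ.- s ℤ.* a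
    regroup = solve-∀

  -- One more factor `2 - B` acts on `x k = B^k` as twice the term minus its shift. Extending the
  -- first sum by the vanishing index `m + 1` lets both sums be joined by Pascal's rule.
  binomial-sum : ∀ m (x : ℕ → ℤ) → Σ< (suc m) (λ k → binomial m k ℤ.* (+ 2 ℤ.* x k ℤ.- x (suc k)))
    ≡ Σ< (suc (suc m)) (λ k → binomial (suc m) k ℤ.* x k)
  binomial-sum m x = begin
    Σ< (suc m) (λ k → binomial m k ℤ.* (+ 2 ℤ.* x k ℤ.- x (suc k)))
      ≡⟨ Σ<-cong (suc m) {λ k → binomial m k ℤ.* (+ 2 ℤ.* x k ℤ.- x (suc k))} {λ k → a k ℤ.+ b k} (λ k _ → split (binomial m k) (x k) (x (suc k))) ⟩
    Σ< (suc m) (λ k → a k ℤ.+ b k)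
      ≡⟨ Σ<-+ (suc m) a b ⟨
    Σ< (suc m) a ℤ.+ Σ< (suc m) b
      ≡⟨ cong (ℤ._+ Σ< (suc m) b) (ℤ.+-identityʳ (Σ< (suc m) a)) ⟨
    (Σ< (suc m) a ℤ.+ + 0) ℤ.+ Σ< (suc m) b
      ≡⟨ cong (λ y → (Σ< (suc m) a ℤ.+ y) ℤ.+ Σ< (suc m) b) a-top ⟨
    (Σ< (suc m) a ℤ.+ a (suc m)) ℤ.+ Σ< (suc m) b
      ≡⟨ cong (ℤ._+ Σ< (suc m) b) (Σ<-last (suc m) a) ⟨
    (a 0 ℤ.+ Σ< (suc m) (a ∘ suc)) ℤ.+ Σ< (suc m) b
      ≡⟨ ℤ.+-assoc (a 0) (Σ< (suc m) (a ∘ suc)) (Σ< (suc m) b) ⟩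
    a 0 ℤ.+ (Σ< (suc m) (a ∘ suc) ℤ.+ Σ< (suc m) b)
      ≡⟨ cong (λ y → a 0 ℤ.+ y) (Σ<-+ (suc m) (a ∘ suc) b) ⟩
    a 0 ℤ.+ Σ< (suc m) (λ k → a (suc k) ℤ.+ b k)
      ≡⟨ cong₂ ℤ._+_ (cong (ℤ._* x 0) (sym (binomial-zero m))) (Σ<-cong (suc m) {λ k → a (suc k) ℤ.+ b k} {λ k → binomial (suc m) (suc k) ℤ.* x (suc k)} (λ k _ →
           trans (join (binomial m (suc k)) (binomial m k) (x (suc k)))
                   (cong (ℤ._* x (suc k)) (sym (binomial-suc m k))))) ⟩
    Σ< (suc (suc m)) (λ k → binomial (suc m) k ℤ.* x k) ∎
    where
    open ≡-Reasoning
    a b : ℕ → ℤ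
    a k = + 2 ℤ.* binomial m k ℤ.* x k
    b k = ℤ.- (binomial m k ℤ.* x (suc k))
    a-top : a (suc m) ≡ + 0
    a-top = trans (cong (λ y → + 2 ℤ.* y ℤ.* x (suc m)) (binomial-top m)) (ℤ.*-zeroˡ (x (suc m)))
    split : ∀ c x y → c ℤ.* (+ 2 ℤ.* x ℤ.- y) ≡ + 2 ℤ.* c ℤ.* x ℤ.+ ℤ.- (c ℤ.* y)
    split = solve-∀
    join : ∀ c d x → + 2 ℤ.* c ℤ.* x ℤ.+ ℤ.- (d ℤ.* x) ≡ (+ 2 ℤ.* c ℤ.- d) ℤ.* x
    join = solve-∀

E-power : ∀ m F n → (pow E m ⊛ F) n ≡ Σ< (suc m) (λ k → binomial m k ℤ.* (β k ⊛ F) n)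
E-power zero    F n = sym (trans (ℤ.+-identityʳ _) (trans (ℤ.*-identityˡ _)
  (at (S.*-congʳ {F} B.β-zero) n)))
E-power (suc m) F n = begin
  (pow E (suc m) ⊛ F) n
    ≡⟨ at (*-rotate E (pow E m) F) n ⟩
  (pow E m ⊛ (E ⊛ F)) n
    ≡⟨ E-power m (E ⊛ F) n ⟩
  Σ< (suc m) (λ k → binomial m k ℤ.* (β k ⊛ (E ⊛ F)) n)
    ≡⟨ Σ<-cong (suc m) {λ k → binomial m k ℤ.* (β k ⊛ (E ⊛ F)) n} (λ k _ → cong (binomial m k ℤ.*_) (term k)) ⟩
  Σ< (suc m) (λ k → binomial m k ℤ.* (+ 2 ℤ.* (β k ⊛ F) n ℤ.- (β (suc k) ⊛ F) n))
    ≡⟨ binomial-sum m (λ k → (β k ⊛ F) n) ⟩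
  Σ< (suc (suc m)) (λ k → binomial (suc m) k ℤ.* (β k ⊛ F) n) ∎
  where
  open ≡-Reasoning
  open import Algebra.Properties.Ring S.ring using (-‿distribˡ-*)
  term : ∀ k → (β k ⊛ (E ⊛ F)) n ≡ + 2 ℤ.* (β k ⊛ F) n ℤ.- (β (suc k) ⊛ F) n
  term k = trans (at (*-swap (β k) E F) n) (trans
    (at (S.distribʳ (β k ⊛ F) (const (+ 2)) (⊖ β 1)) n)
    (cong₂ ℤ._+_ (const-⊛ (+ 2) (β k ⊛ F) n) (trans
      (at (S.sym (-‿distribˡ-* (β 1) (β k ⊛ F))) n)
      (cong ℤ.-_ (at (S.trans (S.sym (S.*-assoc (β 1) (β k) F)) (S.*-congʳ {F} (S.sym (B.β-+ 1 k)))) n)))))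

-- Doubling by steps of two follows the recursion of `β`, where `2 * n` would not reduce.
twice : ℕ → ℕ
twice zero    = 0
twice (suc n) = suc (suc (twice n))

twice-+ : ∀ n → twice n ≡ n ℕ.+ n
twice-+ zero    = refl
twice-+ (suc n) = cong suc (trans (cong suc (twice-+ n)) (sym (ℕ.+-suc n n)))

Y-power : ∀ j F i → (pow Y j ⊛ F) (twice (j ℕ.+ i)) ≡ F (twice i)
Y-power zero    F i = at (S.*-identityˡ F) (twice i)
Y-power (suc j) F i = trans (at (S.*-assoc Y (pow Y j) F) (twice (suc j ℕ.+ i)))
  (trans (Y-suc (pow Y j ⊛ F) (twice (j ℕ.+ i))) (Y-power j F i))

u-power : ∀ j k i → (pow u j ⊛ β k) (twice (j ℕ.+ i)) ≡ + (3 ℕ.^ j) ℤ.* β (j ℕ.+ j ℕ.+ k) (twice i)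
u-power j k i = begin
  (pow u j ⊛ β k) (twice (j ℕ.+ i))
    ≡⟨ at expand (twice (j ℕ.+ i)) ⟩
  (pow Y j ⊛ (const (+ (3 ℕ.^ j)) ⊛ β (j ℕ.+ j ℕ.+ k))) (twice (j ℕ.+ i))
    ≡⟨ Y-power j _ i ⟩
  (const (+ (3 ℕ.^ j)) ⊛ β (j ℕ.+ j ℕ.+ k)) (twice i)
    ≡⟨ const-⊛ (+ (3 ℕ.^ j)) (β (j ℕ.+ j ℕ.+ k)) (twice i) ⟩
  + (3 ℕ.^ j) ℤ.* β (j ℕ.+ j ℕ.+ k) (twice i) ∎
  where
  open ≡-Reasoning
  three : ∀ j → pow (const (+ 3)) j ≋ const (+ (3 ℕ.^ j))
  three zero    = S.refl {𝟙}
  three (suc j) = S.trans (S.*-congˡ {const (+ 3)} (three j)) (pw λ n → trans (const-⊛ (+ 3) (const (+ (3 ℕ.^ j))) n) (go n))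
    where
    go : ∀ n → + 3 ℤ.* const (+ (3 ℕ.^ j)) n ≡ const (+ (3 ℕ.^ suc j)) n
    go zero    = sym (ℤ.pos-* 3 (3 ℕ.^ j))
    go (suc n) = refl
  squares : ∀ j → pow (β 2) j ≋ β (j ℕ.+ j)
  squares zero    = S.sym B.β-zero
  squares (suc j) rewrite ℕ.+-suc j j = S.trans (S.*-congˡ {β 2} (squares j)) (S.sym (B.β-+ 2 (j ℕ.+ j)))
  module R = SetoidReasoning S.setoid
  expand : pow u j ⊛ β k ≋ pow Y j ⊛ (const (+ (3 ℕ.^ j)) ⊛ β (j ℕ.+ j ℕ.+ k))
  expand = R.begin
    pow (Y ⊛ v) j ⊛ β k
      R.≈⟨ S.*-congʳ {β k} (S.trans (pow-* Y v j) (S.*-congˡ {pow Y j} (S.trans (pow-* (const (+ 3)) (β 2) j)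
             (S.*-cong (three j) (squares j))))) ⟩
    (pow Y j ⊛ (const (+ (3 ℕ.^ j)) ⊛ β (j ℕ.+ j))) ⊛ β k
      R.≈⟨ S.*-assoc (pow Y j) (const (+ (3 ℕ.^ j)) ⊛ β (j ℕ.+ j)) (β k) ⟩
    pow Y j ⊛ ((const (+ (3 ℕ.^ j)) ⊛ β (j ℕ.+ j)) ⊛ β k)
      R.≈⟨ S.*-congˡ {pow Y j} (S.trans (S.*-assoc (const (+ (3 ℕ.^ j))) (β (j ℕ.+ j)) (β k))
             (S.*-congˡ {const (+ (3 ℕ.^ j))} (S.sym (B.β-+ (j ℕ.+ j) k)))) ⟩
    pow Y j ⊛ (const (+ (3 ℕ.^ j)) ⊛ β (j ℕ.+ j ℕ.+ k)) R.∎

summand : ℕ → ℕ → ℕ → ℕ → ℤ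
summand m M k j = + multichoose m j ℤ.* (binomial m k ℤ.* (+ (3 ℕ.^ j) ℤ.* β (j ℕ.+ j ℕ.+ k) (twice (M ∸ j))))

H-power : ∀ m M → pow H m (twice (m ℕ.+ M)) ≡ Σ< (suc m) (λ k → Σ< (suc M) (summand m M k))
H-power m M = begin
  pow H m (twice (m ℕ.+ M))
    ≡⟨ at (S.trans (pow-cong m H-factor) (pow-* Y h m)) (twice (m ℕ.+ M)) ⟩
  (pow Y m ⊛ pow h m) (twice (m ℕ.+ M))
    ≡⟨ Y-power m (pow h m) M ⟩
  pow h m (twice M)
    ≡⟨ at (S.*-identityʳ (pow h m)) (twice M) ⟨
  (pow h m ⊛ 𝟙) (twice M)
    -- Degree `2M` is below `2(M + 1)`, so the terms `j = 0, ..., M` suffice; the last of them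
    -- becomes `Σ₂`.
    ≡⟨ negative-binomial m (suc M) 𝟙 (twice M) (ℕ.s≤s (subst (ℕ._≤ M ℕ.+ suc M) (sym (twice-+ M)) (ℕ.+-monoʳ-≤ M (ℕ.n≤1+n M)))) ⟩
  Σ< (suc M) (λ j → + multichoose m j ℤ.* (pow u j ⊛ (pow E m ⊛ 𝟙)) (twice M))
    ≡⟨ Σ<-cong (suc M) {λ j → + multichoose m j ℤ.* (pow u j ⊛ (pow E m ⊛ 𝟙)) (twice M)}
         {λ j → Σ< (suc m) (λ k → summand m M k j)} (λ j j≤M → trans (cong (+ multichoose m j ℤ.*_) (inner j (ℕ.s≤s⁻¹ j≤M)))
         (Σ<-* (suc m) (+ multichoose m j)
           (λ k → binomial m k ℤ.* (+ (3 ℕ.^ j) ℤ.* β (j ℕ.+ j ℕ.+ k) (twice (M ∸ j)))))) ⟩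
  Σ< (suc M) (λ j → Σ< (suc m) (λ k → summand m M k j))
    ≡⟨ Σ<-swap (suc M) (suc m) (λ j k → summand m M k j) ⟩
  Σ< (suc m) (λ k → Σ< (suc M) (summand m M k)) ∎
  where
  open ≡-Reasoning
  inner : ∀ j → j ≤ M → (pow u j ⊛ (pow E m ⊛ 𝟙)) (twice M)
    ≡ Σ< (suc m) (λ k → binomial m k ℤ.* (+ (3 ℕ.^ j) ℤ.* β (j ℕ.+ j ℕ.+ k) (twice (M ∸ j))))
  inner j j≤M = begin
    (pow u j ⊛ (pow E m ⊛ 𝟙)) (twice M)
      ≡⟨ at (S.trans (S.*-congˡ {pow u j} (S.*-identityʳ (pow E m))) (S.*-comm (pow u j) (pow E m))) (twice M) ⟩
    (pow E m ⊛ pow u j) (twice M)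
      ≡⟨ E-power m (pow u j) (twice M) ⟩
    Σ< (suc m) (λ k → binomial m k ℤ.* (β k ⊛ pow u j) (twice M))
      ≡⟨ Σ<-cong (suc m) (λ k _ → cong (binomial m k ℤ.*_) (trans (at (S.*-comm (β k) (pow u j)) (twice M))
           (trans (cong (λ i → (pow u j ⊛ β k) (twice i)) (sym (ℕ.m+[n∸m]≡n j≤M))) (u-power j k (M ∸ j))))) ⟩
    Σ< (suc m) (λ k → binomial m k ℤ.* (+ (3 ℕ.^ j) ℤ.* β (j ℕ.+ j ℕ.+ k) (twice (M ∸ j)))) ∎

-- Raney's formula.
β-closed : ∀ N s → + suc N ℤ.* β s (twice (suc N)) ≡ + s ℤ.* + ((3 ℕ.* N ℕ.+ 2 ℕ.+ s) C N)
β-closed N zero = trans (ℤ.*-zeroʳ (+ suc N)) (sym (ℤ.*-zeroˡ (+ ((3 ℕ.* N ℕ.+ 2 ℕ.+ 0) C N))))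
β-closed zero (suc s) = begin
  + 1 ℤ.* (β s 2 ℤ.+ + 1) ≡⟨ ℤ.*-distribˡ-+ (+ 1) (β s 2) (+ 1) ⟩
  + 1 ℤ.* β s 2 ℤ.+ + 1 ≡⟨ cong (ℤ._+ + 1) (trans (β-closed zero s) (ℤ.*-identityʳ (+ s))) ⟩
  + (s ℕ.+ 1) ≡⟨ cong +_ (ℕ.+-comm s 1) ⟩
  + suc s ≡⟨ ℤ.*-identityʳ (+ suc s) ⟨
  + suc s ℤ.* + 1 ∎
  where open ≡-Reasoning
-- The recursion of `β` leads to `s` in the same degree and to `s + 3` one degree lower. The
-- additional factor `N + 1` makes both hypotheses applicable and lets everything be compared
-- through the neighbouring binomials `p` and `q`.
β-closed (suc N) (suc s) = ℤ.*-cancelˡ-≡ (+ suc N) _ _ (begin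
  + suc N ℤ.* (+ suc (suc N) ℤ.* (x ℤ.+ + 1 ℤ.* y))
    ≡⟨ expand (+ N) x y ⟩
  + suc N ℤ.* (+ suc (suc N) ℤ.* x) ℤ.+ + suc (suc N) ℤ.* (+ suc N ℤ.* y)
    ≡⟨ cong₂ (λ i j → + suc N ℤ.* i ℤ.+ + suc (suc N) ℤ.* j) (β-closed (suc N) s) y-closed ⟩
  + suc N ℤ.* (+ s ℤ.* q) ℤ.+ + suc (suc N) ℤ.* ((+ 3 ℤ.+ + s) ℤ.* p)
    ≡⟨ collect (+ N) (+ s) p q ⟩
  + s ℤ.* (+ suc N ℤ.* q) ℤ.+ + suc (suc N) ℤ.* ((+ 3 ℤ.+ + s) ℤ.* p)
    ≡⟨ cong (λ i → + s ℤ.* i ℤ.+ + suc (suc N) ℤ.* ((+ 3 ℤ.+ + s) ℤ.* p)) q-closed ⟩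
  + s ℤ.* ((+ 2 ℤ.* + N ℤ.+ + 5 ℤ.+ + s) ℤ.* p) ℤ.+ + suc (suc N) ℤ.* ((+ 3 ℤ.+ + s) ℤ.* p)
    ≡⟨ rearrange (+ N) (+ s) p ⟩
  + suc s ℤ.* (+ suc N ℤ.* p ℤ.+ (+ 2 ℤ.* + N ℤ.+ + 5 ℤ.+ + s) ℤ.* p)
    ≡⟨ cong (λ i → + suc s ℤ.* (+ suc N ℤ.* p ℤ.+ i)) q-closed ⟨
  + suc s ℤ.* (+ suc N ℤ.* p ℤ.+ + suc N ℤ.* q)
    ≡⟨ factor (+ N) (+ s) p q ⟩
  + suc N ℤ.* (+ suc s ℤ.* (p ℤ.+ q))
    ≡⟨ cong (λ i → + suc N ℤ.* (+ suc s ℤ.* + i)) (nCk+nC[k+1]≡[n+1]C[k+1] a N) ⟩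
  + suc N ℤ.* (+ suc s ℤ.* + (suc a C suc N))
    ≡⟨ cong (λ i → + suc N ℤ.* (+ suc s ℤ.* + (i C suc N))) (ℕ.+-suc (3 ℕ.* suc N ℕ.+ 2) s) ⟨
  + suc N ℤ.* (+ suc s ℤ.* + ((3 ℕ.* suc N ℕ.+ 2 ℕ.+ suc s) C suc N)) ∎)
  where
  open ≡-Reasoning
  a = 3 ℕ.* suc N ℕ.+ 2 ℕ.+ s
  x = β s (twice (suc (suc N)))
  y = β (3 ℕ.+ s) (twice (suc N))
  p = + (a C N)
  q = + (a C suc N)
  y-closed : + suc N ℤ.* y ≡ (+ 3 ℤ.+ + s) ℤ.* p
  y-closed = trans (β-closed N (3 ℕ.+ s)) (cong (λ i → + (3 ℕ.+ s) ℤ.* + (i C N)) (index N s))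
    where
    index : ∀ N s → 3 ℕ.* N ℕ.+ 2 ℕ.+ (3 ℕ.+ s) ≡ 3 ℕ.* (1 ℕ.+ N) ℕ.+ 2 ℕ.+ s
    index = ℕ-solve-∀
  -- The ratio `(a - N) / (N + 1)` of `C(a, N+1)` to `C(a, N)`, where `a - N = 2N + 5 + s`.
  q-closed : + suc N ℤ.* q ≡ (+ 2 ℤ.* + N ℤ.+ + 5 ℤ.+ + s) ℤ.* p
  q-closed = begin
    + suc N ℤ.* q
      ≡⟨ isolate (+ suc N) p q ⟩
    + suc N ℤ.* (p ℤ.+ q) ℤ.- + suc N ℤ.* p
      ≡⟨ cong (ℤ._- + suc N ℤ.* p) absorb ⟩
    + suc a ℤ.* p ℤ.- + suc N ℤ.* p
      ≡⟨ cong (λ i → i ℤ.* p ℤ.- + suc N ℤ.* p) size ⟩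
    (+ 3 ℤ.* + N ℤ.+ + 6 ℤ.+ + s) ℤ.* p ℤ.- + suc N ℤ.* p
      ≡⟨ subtract (+ N) (+ s) p ⟩
    (+ 2 ℤ.* + N ℤ.+ + 5 ℤ.+ + s) ℤ.* p ∎
    where
    isolate : ∀ n p q → n ℤ.* q ≡ n ℤ.* (p ℤ.+ q) ℤ.- n ℤ.* p
    isolate = solve-∀
    absorb : + suc N ℤ.* (p ℤ.+ q) ≡ + suc a ℤ.* p
    absorb = trans (cong (λ i → + suc N ℤ.* + i) (nCk+nC[k+1]≡[n+1]C[k+1] a N))
      (trans (sym (ℤ.pos-* (suc N) (suc a C suc N))) (trans (cong +_ (C-absorb a N)) (ℤ.pos-* (suc a) (a C N))))
    size : + suc a ≡ + 3 ℤ.* + N ℤ.+ + 6 ℤ.+ + s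
    size = trans (cong +_ (index N s)) (cong (λ i → i ℤ.+ + 6 ℤ.+ + s) (ℤ.pos-* 3 N))
      where
      index : ∀ N s → 1 ℕ.+ (3 ℕ.* (1 ℕ.+ N) ℕ.+ 2 ℕ.+ s) ≡ 3 ℕ.* N ℕ.+ 6 ℕ.+ s
      index = ℕ-solve-∀
    subtract : ∀ n s p → (+ 3 ℤ.* n ℤ.+ + 6 ℤ.+ s) ℤ.* p ℤ.- (+ 1 ℤ.+ n) ℤ.* p ≡ (+ 2 ℤ.* n ℤ.+ + 5 ℤ.+ s) ℤ.* p
    subtract = solve-∀
  expand : ∀ n x y → (+ 1 ℤ.+ n) ℤ.* ((+ 2 ℤ.+ n) ℤ.* (x ℤ.+ + 1 ℤ.* y))
    ≡ (+ 1 ℤ.+ n) ℤ.* ((+ 2 ℤ.+ n) ℤ.* x) ℤ.+ (+ 2 ℤ.+ n) ℤ.* ((+ 1 ℤ.+ n) ℤ.* y)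
  expand = solve-∀
  collect : ∀ n s p q → (+ 1 ℤ.+ n) ℤ.* (s ℤ.* q) ℤ.+ (+ 2 ℤ.+ n) ℤ.* ((+ 3 ℤ.+ s) ℤ.* p)
    ≡ s ℤ.* ((+ 1 ℤ.+ n) ℤ.* q) ℤ.+ (+ 2 ℤ.+ n) ℤ.* ((+ 3 ℤ.+ s) ℤ.* p)
  collect = solve-∀
  rearrange : ∀ n s p → s ℤ.* ((+ 2 ℤ.* n ℤ.+ + 5 ℤ.+ s) ℤ.* p) ℤ.+ (+ 2 ℤ.+ n) ℤ.* ((+ 3 ℤ.+ s) ℤ.* p)
    ≡ (+ 1 ℤ.+ s) ℤ.* ((+ 1 ℤ.+ n) ℤ.* p ℤ.+ (+ 2 ℤ.* n ℤ.+ + 5 ℤ.+ s) ℤ.* p)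
  rearrange = solve-∀
  factor : ∀ n s p q → (+ 1 ℤ.+ s) ℤ.* ((+ 1 ℤ.+ n) ℤ.* p ℤ.+ (+ 1 ℤ.+ n) ℤ.* q)
    ≡ (+ 1 ℤ.+ n) ℤ.* ((+ 1 ℤ.+ s) ℤ.* (p ℤ.+ q))
  factor = solve-∀

-- From integer coefficients to the rational formula

open import Data.List.Properties using (map-applyUpTo; length-tabulate; ∷-injective; ∷-injectiveˡ)
open import Data.Rational as ℚ using (ℚ; _/_; fromℚᵘ)
import Data.Rational.Properties as ℚ
open import Data.Rational.Unnormalised as ℚᵘ using (mkℚᵘ; *≡*)
import Data.Rational.Unnormalised.Properties as ℚᵘ

fraction-≡ : ∀ a b d e → a ℤ.* + suc e ≡ b ℤ.* + suc d → a / suc d ≡ b / suc e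
fraction-≡ a b d e p = ℚ.fromℚᵘ-cong {mkℚᵘ a d} {mkℚᵘ b e} (*≡* p)

fromℚᵘ-+ : ∀ p q → fromℚᵘ p ℚ.+ fromℚᵘ q ≡ fromℚᵘ (p ℚᵘ.+ q)
fromℚᵘ-+ p q = ℚ.toℚᵘ-injective (ℚᵘ.≃-trans (ℚ.toℚᵘ-homo-+ (fromℚᵘ p) (fromℚᵘ q))
  (ℚᵘ.≃-trans (ℚᵘ.+-cong (ℚ.toℚᵘ-fromℚᵘ p) (ℚ.toℚᵘ-fromℚᵘ q)) (ℚᵘ.≃-sym (ℚ.toℚᵘ-fromℚᵘ (p ℚᵘ.+ q)))))

fromℚᵘ-* : ∀ p q → fromℚᵘ p ℚ.* fromℚᵘ q ≡ fromℚᵘ (p ℚᵘ.* q)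
fromℚᵘ-* p q = ℚ.toℚᵘ-injective (ℚᵘ.≃-trans (ℚ.toℚᵘ-homo-* (fromℚᵘ p) (fromℚᵘ q))
  (ℚᵘ.≃-trans (ℚᵘ.*-cong (ℚ.toℚᵘ-fromℚᵘ p) (ℚ.toℚᵘ-fromℚᵘ q)) (ℚᵘ.≃-sym (ℚ.toℚᵘ-fromℚᵘ (p ℚᵘ.* q)))))

integer-+ : ∀ a b → a / 1 ℚ.+ b / 1 ≡ (a ℤ.+ b) / 1
integer-+ a b = trans (fromℚᵘ-+ (mkℚᵘ a 0) (mkℚᵘ b 0)) (cong (_/ 1) (drop a b))
  where
  drop : ∀ a b → a ℤ.* + 1 ℤ.+ b ℤ.* + 1 ≡ a ℤ.+ b
  drop = solve-∀

sumL-upTo : ∀ n f g → (∀ i → i < n → f i ≡ g i / 1) → sumL (map f (upTo n)) ≡ Σ< n g / 1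
sumL-upTo n f g p = trans (cong sumL (map-applyUpTo id f n)) (go n f g p)
  where
  go : ∀ n f g → (∀ i → i < n → f i ≡ g i / 1) → sumL (applyUpTo f n) ≡ Σ< n g / 1
  go zero    f g p = refl
  go (suc n) f g p = trans
    (cong₂ ℚ._+_ (p 0 (s≤s z≤n)) (go n (f ∘ suc) (g ∘ suc) (λ i lt → p (suc i) (s≤s lt))))
    (integer-+ (g 0) (Σ< n (g ∘ suc)))

private
  shuffle₁ : ∀ d s a c t b → d ℤ.* b ≡ s → 
    (a ℤ.* (c ℤ.* (t ℤ.* b))) ℤ.* d ≡ a ℤ.* c ℤ.* t ℤ.* s
  shuffle₁ d _ a c t b refl = go d a c t b
    where
    go : ∀ d a c t b → (a ℤ.* (c ℤ.* (t ℤ.* b))) ℤ.* d ≡ a ℤ.* c ℤ.* t ℤ.* (d ℤ.* b)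
    go = solve-∀

  cast : ∀ g a b c d e f → (g ℤ.* + (a ℕ.* b ℕ.* c ℕ.* d ℕ.* e ℕ.* f))
    ≡ + b ℤ.* (g ℤ.* + (a ℕ.* c)) ℤ.* + d ℤ.* (+ e ℤ.* + f)
  cast g a b c d e f = begin
    g ℤ.* + (a ℕ.* b ℕ.* c ℕ.* d ℕ.* e ℕ.* f)
      ≡⟨ cong (λ x → g ℤ.* + x) (reorder a b c d e f) ⟩
    g ℤ.* + (b ℕ.* ((a ℕ.* c) ℕ.* (d ℕ.* (e ℕ.* f))))
      ≡⟨ cong (g ℤ.*_) (trans (ℤ.pos-* b _) (cong (+ b ℤ.*_) (trans (ℤ.pos-* (a ℕ.* c) _)
           (cong (+ (a ℕ.* c) ℤ.*_) (trans (ℤ.pos-* d _) (cong (+ d ℤ.*_) (ℤ.pos-* e f))))))) ⟩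
    g ℤ.* (+ b ℤ.* (+ (a ℕ.* c) ℤ.* (+ d ℤ.* (+ e ℤ.* + f))))
      ≡⟨ regroup g (+ b) (+ (a ℕ.* c)) (+ d) (+ e) (+ f) ⟩
    + b ℤ.* (g ℤ.* + (a ℕ.* c)) ℤ.* + d ℤ.* (+ e ℤ.* + f) ∎
    where
    open ≡-Reasoning
    reorder : ∀ a b c d e f → a ℕ.* b ℕ.* c ℕ.* d ℕ.* e ℕ.* f ≡ b ℕ.* ((a ℕ.* c) ℕ.* (d ℕ.* (e ℕ.* f)))
    reorder = ℕ-solve-∀
    regroup : ∀ g b m d e f → g ℤ.* (b ℤ.* (m ℤ.* (d ℤ.* (e ℤ.* f)))) ≡ b ℤ.* (g ℤ.* m) ℤ.* d ℤ.* (e ℤ.* f)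
    regroup = solve-∀

module _ (m M : ℕ) where
  private
    n = m ℕ.+ M

    n∸m : n ∸ m ≡ M
    n∸m = ℕ.m+n∸m≡n m M

  -- By Raney's formula the quotient `(2j + k) / (n - m - j)` times its binomial is a coefficient of
  -- `B^(2j+k)`, so each rational term is in fact an integer.
  Σ₁-term : ∀ k j → j < M →
    (sgn k ℤ.* + ((m C k) ℕ.* ((m ℕ.+ j ∸ 1) C j) ℕ.* (2 ℕ.^ (m ∸ k)) ℕ.* (3 ℕ.^ j)
                  ℕ.* (2 ℕ.* j ℕ.+ k)
                  ℕ.* ((3 ℕ.* n ∸ 3 ℕ.* m ℕ.+ k ∸ j ∸ 1) C (n ∸ m ∸ j ∸ 1)))) / suc (n ∸ m ∸ suc j)
    ≡ summand m M k j / 1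
  Σ₁-term k j j<M = fraction-≡ numerator (summand m M k j) (n ∸ m ∸ suc j) 0 (trans (ℤ.*-identityʳ numerator) (begin
    sgn k ℤ.* + ((m C k) ℕ.* multichoose m j ℕ.* (2 ℕ.^ (m ∸ k)) ℕ.* (3 ℕ.^ j) ℕ.* (2 ℕ.* j ℕ.+ k) ℕ.*
      ((3 ℕ.* n ∸ 3 ℕ.* m ℕ.+ k ∸ j ∸ 1) C (n ∸ m ∸ j ∸ 1)))
      ≡⟨ cast (sgn k) (m C k) (multichoose m j) (2 ℕ.^ (m ∸ k)) (3 ℕ.^ j) (2 ℕ.* j ℕ.+ k) _ ⟩
    + multichoose m j ℤ.* binomial m k ℤ.* + (3 ℕ.^ j) ℤ.*
      (+ (2 ℕ.* j ℕ.+ k) ℤ.* + ((3 ℕ.* n ∸ 3 ℕ.* m ℕ.+ k ∸ j ∸ 1) C (n ∸ m ∸ j ∸ 1)))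
      ≡⟨ shuffle₁ (+ suc (n ∸ m ∸ suc j)) _ (+ multichoose m j) (binomial m k) (+ (3 ℕ.^ j)) (β (j ℕ.+ j ℕ.+ k) (twice (M ∸ j))) raney ⟨
    summand m M k j ℤ.* + suc (n ∸ m ∸ suc j) ∎))
    where
    numerator = sgn k ℤ.* + ((m C k) ℕ.* multichoose m j ℕ.* (2 ℕ.^ (m ∸ k)) ℕ.* (3 ℕ.^ j) ℕ.* (2 ℕ.* j ℕ.+ k) ℕ.*
      ((3 ℕ.* n ∸ 3 ℕ.* m ℕ.+ k ∸ j ∸ 1) C (n ∸ m ∸ j ∸ 1)))
    open ≡-Reasoning
    N = M ∸ suc j
    M≡ : M ≡ suc j ℕ.+ N
    M≡ = sym (ℕ.m+[n∸m]≡n j<M)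
    M∸j : M ∸ j ≡ suc N
    M∸j = trans (cong (_∸ j) (trans M≡ (sym (ℕ.+-suc j N)))) (ℕ.m+n∸m≡n j (suc N))
    upper : 3 ℕ.* n ∸ 3 ℕ.* m ℕ.+ k ∸ j ∸ 1 ≡ 3 ℕ.* N ℕ.+ 2 ℕ.+ (j ℕ.+ j ℕ.+ k)
    upper = begin
      3 ℕ.* n ∸ 3 ℕ.* m ℕ.+ k ∸ j ∸ 1
        ≡⟨ cong (λ x → x ℕ.+ k ∸ j ∸ 1) (trans (sym (ℕ.*-distribˡ-∸ 3 n m)) (cong (3 ℕ.*_) (trans n∸m M≡))) ⟩
      3 ℕ.* (suc j ℕ.+ N) ℕ.+ k ∸ j ∸ 1
        ≡⟨ cong (λ x → x ∸ j ∸ 1) (rearrange j N k) ⟩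
      j ℕ.+ (1 ℕ.+ (3 ℕ.* N ℕ.+ 2 ℕ.+ (j ℕ.+ j ℕ.+ k))) ∸ j ∸ 1
        ≡⟨ cong (_∸ 1) (ℕ.m+n∸m≡n j _) ⟩
      3 ℕ.* N ℕ.+ 2 ℕ.+ (j ℕ.+ j ℕ.+ k) ∎
      where
      rearrange : ∀ j N k → 3 ℕ.* (1 ℕ.+ j ℕ.+ N) ℕ.+ k ≡ j ℕ.+ (1 ℕ.+ (3 ℕ.* N ℕ.+ 2 ℕ.+ (j ℕ.+ j ℕ.+ k)))
      rearrange = ℕ-solve-∀
    raney : + suc (n ∸ m ∸ suc j) ℤ.* β (j ℕ.+ j ℕ.+ k) (twice (M ∸ j))
      ≡ + (2 ℕ.* j ℕ.+ k) ℤ.* + ((3 ℕ.* n ∸ 3 ℕ.* m ℕ.+ k ∸ j ∸ 1) C (n ∸ m ∸ j ∸ 1))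
    raney = begin
      + suc (n ∸ m ∸ suc j) ℤ.* β (j ℕ.+ j ℕ.+ k) (twice (M ∸ j))
        ≡⟨ cong₂ (λ x y → + suc (x ∸ suc j) ℤ.* β (j ℕ.+ j ℕ.+ k) (twice y)) n∸m M∸j ⟩
      + suc N ℤ.* β (j ℕ.+ j ℕ.+ k) (twice (suc N))
        ≡⟨ β-closed N (j ℕ.+ j ℕ.+ k) ⟩
      + (j ℕ.+ j ℕ.+ k) ℤ.* + ((3 ℕ.* N ℕ.+ 2 ℕ.+ (j ℕ.+ j ℕ.+ k)) C N)
        ≡⟨ cong₂ (λ x y → + (x ℕ.+ k) ℤ.* + y) (cong (j ℕ.+_) (sym (ℕ.+-identityʳ j)))
             (cong₂ _C_ (sym upper) (sym (cong (_∸ 1) (trans (cong (_∸ j) n∸m) M∸j)))) ⟩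
      + (2 ℕ.* j ℕ.+ k) ℤ.* + ((3 ℕ.* n ∸ 3 ℕ.* m ℕ.+ k ∸ j ∸ 1) C (n ∸ m ∸ j ∸ 1)) ∎

  -- At `j = M` the coefficient of `B^(2M+k)` that is wanted is the constant one, which is 1.
  Σ₂-term : ∀ k → (sgn k ℤ.* + ((m C k) ℕ.* ((n ∸ 1) C (n ∸ m)) ℕ.* (2 ℕ.^ (m ∸ k)) ℕ.* (3 ℕ.^ (n ∸ m)))) / 1
    ≡ summand m M k M / 1
  Σ₂-term k = cong (_/ 1) (begin
    sgn k ℤ.* + ((m C k) ℕ.* ((n ∸ 1) C (n ∸ m)) ℕ.* (2 ℕ.^ (m ∸ k)) ℕ.* (3 ℕ.^ (n ∸ m)))
      ≡⟨ cong (λ x → sgn k ℤ.* + ((m C k) ℕ.* ((n ∸ 1) C x) ℕ.* (2 ℕ.^ (m ∸ k)) ℕ.* (3 ℕ.^ x))) n∸m ⟩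
    sgn k ℤ.* + ((m C k) ℕ.* multichoose m M ℕ.* (2 ℕ.^ (m ∸ k)) ℕ.* (3 ℕ.^ M))
      ≡⟨ cong (λ x → sgn k ℤ.* + x) (pad _) ⟩
    sgn k ℤ.* + ((m C k) ℕ.* multichoose m M ℕ.* (2 ℕ.^ (m ∸ k)) ℕ.* (3 ℕ.^ M) ℕ.* 1 ℕ.* 1)
      ≡⟨ cast (sgn k) (m C k) (multichoose m M) (2 ℕ.^ (m ∸ k)) (3 ℕ.^ M) 1 1 ⟩
    + multichoose m M ℤ.* binomial m k ℤ.* + (3 ℕ.^ M) ℤ.* (+ 1 ℤ.* + 1)
      ≡⟨ regroup (+ multichoose m M) (binomial m k) (+ (3 ℕ.^ M)) ⟩
    + multichoose m M ℤ.* (binomial m k ℤ.* (+ (3 ℕ.^ M) ℤ.* + 1))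
      ≡⟨ cong (λ x → + multichoose m M ℤ.* (binomial m k ℤ.* (+ (3 ℕ.^ M) ℤ.* β (M ℕ.+ M ℕ.+ k) (twice x)))) (ℕ.n∸n≡0 M) ⟨
    summand m M k M ∎)
    where
    open ≡-Reasoning
    pad : ∀ x → x ≡ x ℕ.* 1 ℕ.* 1
    pad = ℕ-solve-∀
    regroup : ∀ a b c → a ℤ.* b ℤ.* c ℤ.* (+ 1 ℤ.* + 1) ≡ a ℤ.* (b ℤ.* (c ℤ.* + 1))
    regroup = solve-∀

  Σ₁+Σ₂ : Σ₁ n m ℚ.+ Σ₂ n m ≡ pow H m (2 ℕ.* n) / 1
  Σ₁+Σ₂ = begin
    Σ₁ n m ℚ.+ Σ₂ n m
      ≡⟨ cong₂ ℚ._+_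
           (sumL-upTo (suc m) _ (λ k → Σ< M (summand m M k)) λ k _ → trans
             (sumL-upTo (n ∸ m) _ (summand m M k) λ j j< → Σ₁-term k j (subst (j <_) n∸m j<))
             (cong (λ x → Σ< x (summand m M k) / 1) n∸m))
           (sumL-upTo (suc m) _ (λ k → summand m M k M) λ k _ → Σ₂-term k) ⟩
    Σ< (suc m) (λ k → Σ< M (summand m M k)) / 1 ℚ.+ Σ< (suc m) (λ k → summand m M k M) / 1
      ≡⟨ integer-+ (Σ< (suc m) (λ k → Σ< M (summand m M k))) (Σ< (suc m) (λ k → summand m M k M)) ⟩
    (Σ< (suc m) (λ k → Σ< M (summand m M k)) ℤ.+ Σ< (suc m) (λ k → summand m M k M)) / 1
      ≡⟨ cong (_/ 1) (Σ<-+ (suc m) (λ k → Σ< M (summand m M k)) (λ k → summand m M k M)) ⟩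
    Σ< (suc m) (λ k → Σ< M (summand m M k) ℤ.+ summand m M k M) / 1
      ≡⟨ cong (_/ 1) (Σ<-cong (suc m) {λ k → Σ< M (summand m M k) ℤ.+ summand m M k M}
           {λ k → Σ< (suc M) (summand m M k)} λ k _ → sym (Σ<-last M (summand m M k))) ⟩
    Σ< (suc m) (λ k → Σ< (suc M) (summand m M k)) / 1
      ≡⟨ cong (_/ 1) (H-power m M) ⟨
    pow H m (twice n) / 1
      ≡⟨ cong (λ x → pow H m x / 1) (trans (twice-+ n) (cong (n ℕ.+_) (sym (ℕ.+-identityʳ n)))) ⟩
    pow H m (2 ℕ.* n) / 1 ∎
    where open ≡-Reasoning

closed-formula : (n m : ℕ) → .{{_ : NonZero m}} → m ≤ n →
  (+ countHistories [] (2 ℕ.* n) m) / 1 ≡ ((+ ((2 ℕ.* n) C (m ∸ 1))) / m) ℚ.* (Σ₁ n m ℚ.+ Σ₂ n m)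
closed-formula n m@(suc c) m≤n = begin
  + V / 1
    ≡⟨ fraction-≡ (+ V) (+ ((2 ℕ.* n) C c) ℤ.* pow H m (2 ℕ.* n)) 0 c (trans (ℤ.*-comm (+ V) (+ suc c)) (trans (closed-histories (2 ℕ.* n) c)
         (sym (ℤ.*-identityʳ (+ ((2 ℕ.* n) C c) ℤ.* pow H m (2 ℕ.* n)))))) ⟩
  (+ ((2 ℕ.* n) C c) ℤ.* pow H m (2 ℕ.* n)) / suc c
    ≡⟨ cong (λ d → fromℚᵘ (mkℚᵘ (+ ((2 ℕ.* n) C c) ℤ.* pow H m (2 ℕ.* n)) d)) (ℕ.*-identityʳ c) ⟨
  (+ ((2 ℕ.* n) C c) ℤ.* pow H m (2 ℕ.* n)) / suc (c ℕ.* 1)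
    ≡⟨ fromℚᵘ-* (mkℚᵘ (+ ((2 ℕ.* n) C c)) c) (mkℚᵘ (pow H m (2 ℕ.* n)) 0) ⟨
  (+ ((2 ℕ.* n) C c)) / suc c ℚ.* (pow H m (2 ℕ.* n) / 1)
    ≡⟨ cong ((+ ((2 ℕ.* n) C c)) / suc c ℚ.*_) (subst (λ x → Σ₁ x m ℚ.+ Σ₂ x m ≡ pow H m (2 ℕ.* x) / 1)
         (ℕ.m+[n∸m]≡n m≤n) (Σ₁+Σ₂ m (n ∸ m))) ⟨
  (+ ((2 ℕ.* n) C c)) / suc c ℚ.* (Σ₁ n m ℚ.+ Σ₂ n m) ∎
  where
  open ≡-Reasoning
  V = countHistories [] (2 ℕ.* n) m

open import Data.Bool using (T; _∧_; _∨_; not)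
open import Data.Bool.ListAction using (any; all)
open import Data.Bool.Properties using (T-∧; T-∨; T-≡)
open import Data.Fin.Subset using (Subset)
open import Data.List.Membership.Propositional using (_∈_; _∉_; lose; find)
open import Data.List.Membership.Propositional.Properties
  using (∈-++⁺ˡ; ∈-++⁺ʳ; ∈-++⁻; ∈-lookup; ∈-upTo⁺; ∈-allFin; ∈-concatMap⁺; ∈-map⁺; ∈-map⁻; ∈-filter⁺; ∈-filter⁻; ∈-tabulate⁺; ∈-tabulate⁻)
open import Data.List.Membership.Propositional.Properties.WithK using (unique∧set⇒bag)
open import Data.List.Relation.Binary.BagAndSetEquality using (∼bag⇒↭)
open import Data.List.Relation.Binary.Permutation.Propositional.Properties using (↭-length)
open import Data.List.Relation.Unary.All as All using (All; []; _∷_)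
import Data.List.Relation.Unary.All.Properties as All
open import Data.List.Relation.Unary.AllPairs as AllPairs using (AllPairs; []; _∷_)
import Data.List.Relation.Unary.AllPairs.Properties as AllPairs
open import Data.List.Relation.Unary.Any using (here; there; any?)
open import Data.List.Relation.Unary.Any.Properties using (any⁺; any⁻)
open import Data.List.Relation.Unary.Unique.Propositional using (Unique)
import Data.List.Relation.Unary.Unique.Propositional.Properties as Unique
open import Data.Product.Properties using (,-injective)
open import Data.Unit using (tt)
open import Data.Vec as Vec using (Vec; []; _∷_; lookup; tabulate; toList; fromList)
open import Data.Vec.Properties using (toList∘fromList; lookup∘tabulate; tabulate∘lookup; tabulate-cong)
open import Relation.Nullary using (¬_; yes; no)
open import Relation.Nullary.Decidable using (⌊_⌋; toWitness; fromWitness; T?)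
open Equivalence using (to; from)

-- Trees and cycles

module _ {V : Set} where

  -- Two disjoint trees are joined by an edge that is the only one between them, so the derivation
  -- certifies connectedness and acyclicity at once. A closing chord merges components in just this
  -- way.
  data Tree (E : V → V → Set) : List V → Set where
    leaf : ∀ v → Tree E [ v ]
    join : ∀ {A B u v} → Tree E A → Tree E B → u ∈ A → v ∈ B → E u v →
      (∀ {a b} → a ∈ A → b ∈ B → a ≢ b) →
      (∀ {a b} → a ∈ A → b ∈ B → E a b → a ≡ u × b ≡ v) →
      Tree E (A ++ B)

  -- New edges are harmless as long as none of them joins two vertices of `A`; this is how a tree
  -- survives the reading of another point.
  tree-map : ∀ {E E′ : V → V → Set} {A} → (∀ {a b} → E a b → E′ a b) →
    (∀ {a b} → a ∈ A → b ∈ A → E′ a b → E a b) → Tree E A → Tree E′ A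
  tree-map f g (leaf v) = leaf v
  tree-map f g (join {A} {B} s t u∈ v∈ e d b) = join
    (tree-map f (λ p q → g (∈-++⁺ˡ p) (∈-++⁺ˡ q)) s)
    (tree-map f (λ p q → g (∈-++⁺ʳ A p) (∈-++⁺ʳ A q)) t)
    u∈ v∈ (f e) d (λ p q e′ → b p q (g (∈-++⁺ˡ p) (∈-++⁺ʳ A q) e′))

  tree-unique : ∀ {E A} → Tree E A → Unique A
  tree-unique (leaf v) = [] ∷ []
  tree-unique (join s t _ _ _ d _) =
    Unique.++⁺ (tree-unique s) (tree-unique t) (λ { (p , q) → d p q refl })

  tree-root : ∀ {E A} → Tree E A → ∃ λ v → v ∈ A
  tree-root (leaf v) = v , here refl
  tree-root (join s t u∈ _ _ _ _) = _ , ∈-++⁺ˡ u∈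

  data Path (E : V → V → Set) : V → List V → V → Set where
    []  : ∀ {x} → Path E x [] x
    _∷_ : ∀ {x y ys z} → E x y → Path E y ys z → Path E x (y ∷ ys) z

  path-map : ∀ {E E′ : V → V → Set} → (∀ {a b} → E a b → E′ a b) → ∀ {x xs y} → Path E x xs y → Path E′ x xs y
  path-map f []      = []
  path-map f (e ∷ p) = f e ∷ path-map f p

  path-++ : ∀ {E x xs u v ys y} → Path E x xs u → E u v → Path E v ys y → Path E x (xs ++ v ∷ ys) y
  path-++ []      e q = e ∷ q
  path-++ (d ∷ p) e q = d ∷ path-++ p e q

  path-trivial : ∀ {E x y} → Path E x [] y → x ≡ y
  path-trivial [] = refl

  path-single : ∀ {E x y z} → Path E x [ z ] y → E x y
  path-single (e ∷ []) = e

  path-end : ∀ {E x xs y} → Path E x xs y → y ∈ x ∷ xs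
  path-end []      = here refl
  path-end (e ∷ p) = there (path-end p)

  record SimplePath (E : V → V → Set) (A : List V) (x y : V) : Set where
    constructor simple
    field
      {vertices} : List V
      path   : Path E x vertices y
      unique : Unique (x ∷ vertices)
      inside : All (_∈ A) (x ∷ vertices)

  record Cycle (E : V → V → Set) (x : V) (xs : List V) : Set where
    constructor cycle
    field
      {end} : V
      path   : Path E x xs end
      unique : Unique (x ∷ xs)
      back   : E end x
      long   : 2 ≤ length xs

  private
    bridge : ∀ {E : V → V → Set} {A B u v x y} → (∀ {a b} → a ∈ A → b ∈ B → a ≢ b) → E u v →
      SimplePath E A x u → SimplePath E B v y →
      SimplePath E (A ++ B) x y
    bridge {A = A} d e (simple p up ip) (simple q uq iq) = simple (path-++ p e q)
      (Unique.++⁺ up uq λ { (a , b) → d (All.lookup ip a) (All.lookup iq b) refl })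
      (All.++⁺ (All.map ∈-++⁺ˡ ip) (All.map (∈-++⁺ʳ A) iq))

  module _ {E : V → V → Set} (E-sym : ∀ {a b} → E a b → E b a) where

    tree-path : ∀ {A} → Tree E A → ∀ {x y} → x ∈ A → y ∈ A → SimplePath E A x y
    tree-path (leaf v) (here refl) (here refl) = simple [] ([] ∷ []) (here refl ∷ [])
    tree-path (join {A} {B} s t u∈ v∈ e d b) x∈ y∈ with ∈-++⁻ A x∈ | ∈-++⁻ A y∈
    ... | inj₁ x∈A | inj₁ y∈A with simple p u i ← tree-path s x∈A y∈A = simple p u (All.map ∈-++⁺ˡ i)
    ... | inj₂ x∈B | inj₂ y∈B with simple p u i ← tree-path t x∈B y∈B = simple p u (All.map (∈-++⁺ʳ A) i)
    ... | inj₁ x∈A | inj₂ y∈B = bridge d e (tree-path s x∈A u∈) (tree-path t v∈ y∈B)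
    ... | inj₂ x∈B | inj₁ y∈A
      with simple p u i ← bridge (λ p q r → d q p (sym r)) (E-sym e) (tree-path t x∈B v∈) (tree-path s u∈ y∈A)
      = simple p u (All.map (λ q → swap (∈-++⁻ B q)) i)
      where
      swap : ∀ {z} → z ∈ B ⊎ z ∈ A → z ∈ A ++ B
      swap (inj₁ q) = ∈-++⁺ʳ A q
      swap (inj₂ q) = ∈-++⁺ˡ q

    -- A cycle cannot cross the only edge u–v between A and B: having left A through u it
    -- could come back only through u.
    private
      module Cut {A B : List V} {u v : V}
        (disjoint : ∀ {a b} → a ∈ A → b ∈ B → a ≢ b)
        (only : ∀ {a b} → a ∈ A → b ∈ B → E a b → a ≡ u × b ≡ v) where

        stay : ∀ {y ys z} → Path E y ys z → y ∈ B → u ∉ ys → All (λ w → w ∈ A ⊎ w ∈ B) ys → z ∈ B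
        stay []      y∈B u∉ [] = y∈B
        stay (e ∷ p) y∈B u∉ (inj₂ w∈B ∷ i) = stay p w∈B (λ q → u∉ (there q)) i
        stay (e ∷ p) y∈B u∉ (inj₁ w∈A ∷ i) = ⊥-elim (u∉ (here (sym (proj₁ (only w∈A y∈B (E-sym e))))))

        leave : ∀ {x xs z} → Path E x xs z → Unique (x ∷ xs) → x ∈ A → All (λ w → w ∈ A ⊎ w ∈ B) xs →
          All (_∈ A) xs ⊎ (z ∈ B × (u ∈ xs ⊎ (x ≡ u × ∃ λ ys → xs ≡ v ∷ ys)))
        leave [] _ _ [] = inj₁ []
        leave (e ∷ p) (_ ∷ un) x∈A (inj₁ w∈A ∷ i) with leave p un w∈A i
        ... | inj₁ all = inj₁ (w∈A ∷ all)
        ... | inj₂ (z∈B , inj₁ u∈) = inj₂ (z∈B , inj₁ (there u∈))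
        ... | inj₂ (z∈B , inj₂ (refl , _)) = inj₂ (z∈B , inj₁ (here refl))
        leave (e ∷ p) (x∉ ∷ un) x∈A (inj₂ w∈B ∷ i) with only x∈A w∈B e
        ... | refl , refl = inj₂ (stay p w∈B (λ q → All.lookup x∉ (there q) refl) i , inj₂ (refl , _ , refl))

        last-∈ : ∀ {y ys z w} → Path E y (w ∷ ys) z → z ∈ w ∷ ys
        last-∈ (_ ∷ p) = path-end p

        inside : ∀ {x xs} → Cycle E x xs → x ∈ A → All (λ w → w ∈ A ⊎ w ∈ B) xs → All (_∈ A) xs
        inside (cycle p un@(x∉ ∷ _) b l) x∈A i with leave p un x∈A i
        ... | inj₁ all = all
        ... | inj₂ (z∈B , c) with only x∈A z∈B (E-sym b) | c
        -- The closing edge of the cycle is the cut edge itself, so `x` is `u` and the end of the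
        -- path is `v`. Then `u` or `v` is visited twice, or the path from `x` is that edge alone
        -- and too short.
        ... | refl , refl | inj₁ u∈ = ⊥-elim (All.lookup x∉ u∈ refl)
        ... | refl , refl | inj₂ (_ , [] , refl) with s≤s () ← l
        inside (cycle (_ ∷ p) un@(x∉ ∷ (z∉ ∷ _)) b l) x∈A i | inj₂ (z∈B , c) | refl , refl | inj₂ (_ , _ ∷ _ , refl) =
          ⊥-elim (All.lookup z∉ (last-∈ p) refl)

    tree-acyclic : ∀ {A} → Tree E A → ∀ {x xs} → Cycle E x xs → All (_∈ A) (x ∷ xs) → ⊥
    tree-acyclic (leaf v) (cycle _ ((x≢ ∷ _) ∷ _) _ _) (here refl ∷ here refl ∷ _) = x≢ refl
    tree-acyclic (leaf v) (cycle _ _ _ ()) (here refl ∷ [])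
    tree-acyclic (join {A} {B} s t u∈ v∈ e d b) c (x∈ ∷ i) with ∈-++⁻ A x∈
    ... | inj₁ x∈A = tree-acyclic s c (x∈A ∷ Cut.inside d b c x∈A (All.map (∈-++⁻ A) i))
    ... | inj₂ x∈B = tree-acyclic t c (x∈B ∷ Cut.inside
          (λ p q r → d q p (sym r))
          (λ p q f → let r , s = b q p (E-sym f) in s , r) c x∈B (All.map (λ w → swap (∈-++⁻ A w)) i))
      where
      swap : ∀ {w} → w ∈ A ⊎ w ∈ B → w ∈ B ⊎ w ∈ A
      swap (inj₁ w) = inj₂ w
      swap (inj₂ w) = inj₁ w

-- The invariant of the automaton

-- In the stack of open chords `j` is the number of entries above `x`, hence the number of chords
-- crossed when `x` closes.
data Insert {A : Set} (x : A) : ℕ → List A → List A → Set where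
  here  : ∀ {ys} → Insert x 0 ys (x ∷ ys)
  there : ∀ {j y ys zs} → Insert x j ys zs → Insert x (suc j) (y ∷ ys) (y ∷ zs)

module _ {A : Set} {x : A} where

  insert-∈ : ∀ {j ys zs} → Insert x j ys zs → x ∈ zs
  insert-∈ here      = here refl
  insert-∈ (there i) = there (insert-∈ i)

  insert-⊆ : ∀ {j ys zs y} → Insert x j ys zs → y ∈ ys → y ∈ zs
  insert-⊆ here      y∈         = there y∈
  insert-⊆ (there i) (here p)   = here p
  insert-⊆ (there i) (there y∈) = there (insert-⊆ i y∈)

  insert-⊇ : ∀ {j ys zs y} → Insert x j ys zs → y ∈ zs → y ≡ x ⊎ y ∈ ys
  insert-⊇ here      (here p)   = inj₁ p
  insert-⊇ here      (there y∈) = inj₂ y∈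
  insert-⊇ (there i) (here p)   = inj₂ (here p)
  insert-⊇ (there i) (there y∈) with insert-⊇ i y∈
  ... | inj₁ p = inj₁ p
  ... | inj₂ p = inj₂ (there p)

  insert-pairs : ∀ {R : A → A → Set} {j ys zs} → Insert x j ys zs → AllPairs R zs → AllPairs R ys
  insert-pairs here      (_ ∷ ps) = ps
  insert-pairs (there i) (p ∷ ps) =
    All.tabulate (λ q → All.lookup p (insert-⊆ i q)) ∷ insert-pairs i ps

module Scan {N : ℕ} (F : Fin N → Fin N) (R : Fin N → Bool) where

  Point : Set
  Point = Fin N

  infix 4 _≺_
  _≺_ : Point → Point → Set
  a ≺ b = toℕ a < toℕ b

  Chord : Point → Set
  Chord a = a ≺ F a

  Crosses : Point → Point → Set
  Crosses a b = (a ≺ b × b ≺ F a × F a ≺ F b) ⊎ (b ≺ a × a ≺ F b × F b ≺ F a)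

  Adj : Point → Point → Set
  Adj a b = Chord a × Chord b × Crosses a b

  adj-sym : ∀ {a b} → Adj a b → Adj b a
  adj-sym (p , q , inj₁ c) = q , p , inj₂ c
  adj-sym (p , q , inj₂ c) = q , p , inj₁ c

  -- The crossings detected once the points below ℓ have been read.
  Edge : ℕ → Point → Point → Set
  Edge ℓ a b = Adj a b × (toℕ (F a) < ℓ ⊎ toℕ (F b) < ℓ)

  edge-sym : ∀ {ℓ a b} → Edge ℓ a b → Edge ℓ b a
  edge-sym (e , inj₁ p) = adj-sym e , inj₂ p
  edge-sym (e , inj₂ p) = adj-sym e , inj₁ p

  edge-suc : ∀ {ℓ a b} → Edge ℓ a b → Edge (suc ℓ) a b
  edge-suc (e , inj₁ p) = e , inj₁ (ℕ.m≤n⇒m≤1+n p)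
  edge-suc (e , inj₂ p) = e , inj₂ (ℕ.m≤n⇒m≤1+n p)

  -- K lists the other endpoints of the open chords, the chord opened last coming first.
  data Reads : ∀ {s ℓ c} → History s ℓ c → List Point → Set where
    start  : Reads start []
    push   : ∀ {s ℓ c x k K} {h : History s ℓ c} i → toℕ i ≡ ℓ → F i ≡ k → F k ≡ i → R i ≡ x →
             Reads h K → Reads (push x h) (k ∷ K)
    close  : ∀ {j q r f s ℓ c K K′} {sp : Split j q (suc r) f} {h : History (q ++ s) ℓ c} i →
             toℕ i ≡ ℓ → R i ≡ false → Insert i j K K′ → Reads h K′ → Reads (close sp h) K
    finish : ∀ {s ℓ c K} {h : History ((0 , 1) ∷ s) ℓ c} i → toℕ i ≡ ℓ → R i ≡ false →
             Reads h (i ∷ K) → Reads (finish h) K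

  -- `Reads` does not ask that pending partners are still unread. Imposed on the final list, this
  -- condition propagates to all earlier ones and makes every pushed chord close later than it
  -- opens.
  Bounded : ℕ → List Point → Set
  Bounded ℓ K = ∀ {k} → k ∈ K → ℓ ≤ toℕ k

  record Pairing (ℓ : ℕ) (K : List Point) : Set where
    field
      partner    : ∀ {k} → k ∈ K → F (F k) ≡ k × toℕ (F k) < ℓ
      involutive : ∀ {i} → toℕ i < ℓ → F (F i) ≡ i × F i ≢ i
      complete   : ∀ {a} → toℕ a < ℓ → ℓ ≤ toℕ (F a) → F a ∈ K
      sorted     : AllPairs (λ k k′ → F k′ ≺ F k) K
      unmarked   : ∀ {i} → toℕ i < ℓ → F i ≺ i → R i ≡ false
  open Pairing public

  split-suc : ∀ {m n} → m < suc n → m < n ⊎ m ≡ n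
  split-suc (s≤s p) = ℕ.m≤n⇒m<n∨m≡n p

  pairing-push : ∀ {ℓ K} i → toℕ i ≡ ℓ → i ≺ F i → F (F i) ≡ i → Pairing ℓ K → Pairing (suc ℓ) (F i ∷ K)
  pairing-push {ℓ} {K} i refl i<k inv P = record
    { partner = λ
      { (here refl) → cong F inv , subst (λ a → toℕ a < suc ℓ) (sym inv) ℕ.≤-refl
      ; (there q) → proj₁ (partner P q) , ℕ.m≤n⇒m≤1+n (proj₂ (partner P q)) }
    ; involutive = λ lt → case₁ (split-suc lt)
    ; complete = λ lt ge → case₂ (split-suc lt) ge
    ; sorted = All.tabulate (λ q → subst (λ a → F _ ≺ a) (sym inv) (proj₂ (partner P q))) ∷ sorted P
    ; unmarked = λ lt F< → case₃ (split-suc lt) F< }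
    where
    case₁ : ∀ {j} → toℕ j < ℓ ⊎ toℕ j ≡ ℓ → F (F j) ≡ j × F j ≢ j
    case₁ (inj₁ lt) = involutive P lt
    case₁ (inj₂ eq) with refl ← toℕ-injective eq = inv , λ p → ℕ.<-irrefl (cong toℕ (sym p)) i<k
    case₂ : ∀ {a} → toℕ a < ℓ ⊎ toℕ a ≡ ℓ → suc ℓ ≤ toℕ (F a) → F a ∈ F i ∷ K
    case₂ (inj₁ lt) ge = there (complete P lt (ℕ.<⇒≤ ge))
    case₂ (inj₂ eq) ge with refl ← toℕ-injective eq = here refl
    case₃ : ∀ {j} → toℕ j < ℓ ⊎ toℕ j ≡ ℓ → F j ≺ j → R j ≡ false
    case₃ (inj₁ lt) F< = unmarked P lt F<
    case₃ (inj₂ eq) F< with refl ← toℕ-injective eq = ⊥-elim (ℕ.<-asym i<k F<)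

  pairing-close : ∀ {ℓ j K K′} i → toℕ i ≡ ℓ → R i ≡ false → Insert i j K K′ → Pairing ℓ K′ → Pairing (suc ℓ) K
  pairing-close {ℓ} {j} {K} {K′} i refl Ri ins P = record
    { partner = λ q → let p , lt = partner P (insert-⊆ ins q) in p , ℕ.m≤n⇒m≤1+n lt
    ; involutive = λ lt → case₁ (split-suc lt)
    ; complete = λ lt ge → case₂ (split-suc lt) ge
    ; sorted = insert-pairs ins (sorted P)
    ; unmarked = λ lt F< → case₃ (split-suc lt) F< }
    where
    i-partner = partner P (insert-∈ ins)
    case₁ : ∀ {k} → toℕ k < ℓ ⊎ toℕ k ≡ ℓ → F (F k) ≡ k × F k ≢ k
    case₁ (inj₁ lt) = involutive P lt
    case₁ (inj₂ eq) with refl ← toℕ-injective eq =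
      proj₁ i-partner , λ p → ℕ.<-irrefl (cong toℕ p) (proj₂ i-partner)
    case₂ : ∀ {a} → toℕ a < ℓ ⊎ toℕ a ≡ ℓ → suc ℓ ≤ toℕ (F a) → F a ∈ K
    case₂ (inj₁ lt) ge with insert-⊇ ins (complete P lt (ℕ.<⇒≤ ge))
    ... | inj₁ eq = ⊥-elim (ℕ.<-irrefl (cong toℕ (sym eq)) ge)
    ... | inj₂ q  = q
    case₂ (inj₂ eq) ge with refl ← toℕ-injective eq = ⊥-elim (ℕ.<-asym ge (proj₂ i-partner))
    case₃ : ∀ {k} → toℕ k < ℓ ⊎ toℕ k ≡ ℓ → F k ≺ k → R k ≡ false
    case₃ (inj₁ lt) F< = unmarked P lt F<
    case₃ (inj₂ eq) F< with refl ← toℕ-injective eq = Ri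

  bounded-tail : ∀ {ℓ k K} → Bounded (suc ℓ) (k ∷ K) → Bounded ℓ K
  bounded-tail B q = ℕ.<⇒≤ (B (there q))

  bounded-insert : ∀ {ℓ i j K K′} → toℕ i ≡ ℓ → Insert i j K K′ → Bounded (suc ℓ) K → Bounded ℓ K′
  bounded-insert refl ins B q with insert-⊇ ins q
  ... | inj₁ refl = ℕ.≤-refl
  ... | inj₂ q′   = ℕ.<⇒≤ (B q′)

  pairing : ∀ {s ℓ c K} {h : History s ℓ c} → Reads h K → Bounded ℓ K → Pairing ℓ K
  pairing start B = record
    { partner = λ () ; involutive = λ () ; complete = λ () ; sorted = [] ; unmarked = λ () }
  pairing (push i refl refl inv _ rd) B =
    pairing-push i refl (B (here refl)) inv (pairing rd (bounded-tail B))
  pairing (close i eq Ri ins rd) B = pairing-close i eq Ri ins (pairing rd (bounded-insert eq ins B))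
  pairing (finish i eq Ri rd) B = pairing-close i eq Ri here (pairing rd (bounded-insert eq here B))

  marks : List Point → ℕ
  marks []      = 0
  marks (a ∷ M) = fromBool (R a) ℕ.+ marks M

  marks-++ : ∀ A B → marks (A ++ B) ≡ marks A ℕ.+ marks B
  marks-++ []      B = refl
  marks-++ (a ∷ A) B = trans (cong (fromBool (R a) ℕ.+_) (marks-++ A B)) (sym (ℕ.+-assoc (fromBool (R a)) _ _))

  -- Ms lists, for the blocks of the state, the chords of the corresponding components.
  data Layout (ℓ : ℕ) : State → List Point → List (List Point) → Set where
    []    : Layout ℓ [] [] []
    block : ∀ {b f s k Kb K M Ms} → length Kb ≡ b →
            (∀ {k′} → k′ ∈ k ∷ Kb → F k′ ∈ M) →
            (∀ {a} → a ∈ M → ℓ ≤ toℕ (F a) → F a ∈ k ∷ Kb) →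
            marks M ≡ f → Layout ℓ s K Ms → Layout ℓ ((b , f) ∷ s) (k ∷ Kb ++ K) (M ∷ Ms)

  layout-suc : ∀ {ℓ s K Ms} → Layout ℓ s K Ms → Layout (suc ℓ) s K Ms
  layout-suc []                = []
  layout-suc (block p f g m l) = block p f (λ q le → g q (ℕ.<⇒≤ le)) m (layout-suc l)

  Separate : ℕ → List Point → List Point → Set
  Separate ℓ M M′ = ∀ {a b} → a ∈ M → b ∈ M′ → a ≢ b × ¬ Edge ℓ a b

  separate-sym : ∀ {ℓ M M′} → Separate ℓ M M′ → Separate ℓ M′ M
  separate-sym S p q = (λ e → proj₁ (S q p) (sym e)) , (λ e → proj₂ (S q p) (edge-sym e))

  record Components (ℓ : ℕ) (parts : List (List Point)) : Set where
    field
      trees    : All (Tree (Edge ℓ)) parts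
      separate : AllPairs (Separate ℓ) parts
      sound    : ∀ {M a} → M ∈ parts → a ∈ M → toℕ a < ℓ × Chord a
      cover    : ∀ {a} → toℕ a < ℓ → Chord a → ∃ λ M → M ∈ parts × a ∈ M
  open Components public

  record Invariant (ℓ : ℕ) (s : State) (c : ℕ) (K : List Point) : Set where
    field
      open-parts  : List (List Point)
      done        : List (List Point)
      layout      : Layout ℓ s K open-parts
      done-length : length done ≡ c
      done-marks  : All (λ M → marks M ≡ 1) done
      partition  : Components ℓ (open-parts ++ done)
  open Invariant public

  module Closing {ℓ j K K′} (i : Point) (i≡ℓ : toℕ i ≡ ℓ) (ins : Insert i j K K′)
                 (P : Pairing ℓ K′) (B : Bounded (suc ℓ) K) where
    c : Point
    c = F i

    c<ℓ : toℕ c < ℓ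
    c<ℓ = proj₂ (partner P (insert-∈ ins))

    F-c : F c ≡ i
    F-c = proj₁ (partner P (insert-∈ ins))

    is-c : ∀ {a} → toℕ a < ℓ → toℕ (F a) ≡ ℓ → a ≡ c
    is-c a<ℓ eq = trans (sym (proj₁ (involutive P a<ℓ))) (cong F (toℕ-injective (trans eq (sym i≡ℓ))))

    Opened-above : Point → Set
    Opened-above b = suc ℓ ≤ toℕ (F b) × c ≺ b

    -- A crossing first detected at time ℓ involves the chord closing there, which is `c`. The other
    -- chord must have been opened after `c`: opened earlier, it would also have closed earlier and
    -- the crossing would be known.
    new-edge : ∀ {a b} → toℕ a < ℓ → toℕ b < ℓ → Edge (suc ℓ) a b →
      Edge ℓ a b ⊎ ((a ≡ c × Opened-above b) ⊎ (b ≡ c × Opened-above a))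
    new-edge {a} {b} a<ℓ b<ℓ (e@(_ , _ , x) , cl) with ℕ.<-≤-connex (toℕ (F a)) ℓ | ℕ.<-≤-connex (toℕ (F b)) ℓ
    ... | inj₁ lt | _       = inj₁ (e , inj₁ lt)
    ... | _       | inj₁ lt = inj₁ (e , inj₂ lt)
    new-edge {a} {b} a<ℓ b<ℓ (e@(_ , _ , inj₁ (p , _ , q)) , inj₁ (s≤s le)) | inj₂ ge | inj₂ _
      with eq ← ℕ.≤-antisym le ge with refl ← is-c a<ℓ eq = inj₂ (inj₁ (refl , subst (_< toℕ (F b)) eq q , p))
    new-edge {a} {b} a<ℓ b<ℓ (e@(_ , _ , inj₂ (p , _ , q)) , inj₁ (s≤s le)) | inj₂ ge | inj₂ ge′ =
      ⊥-elim (ℕ.<⇒≱ (ℕ.<-≤-trans q le) ge′)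
    new-edge {a} {b} a<ℓ b<ℓ (e@(_ , _ , inj₂ (p , _ , q)) , inj₂ (s≤s le)) | inj₂ _ | inj₂ ge
      with eq ← ℕ.≤-antisym le ge with refl ← is-c b<ℓ eq = inj₂ (inj₂ (refl , subst (_< toℕ (F a)) eq q , p))
    new-edge {a} {b} a<ℓ b<ℓ (e@(_ , _ , inj₁ (p , _ , q)) , inj₂ (s≤s le)) | inj₂ ge | inj₂ _ =
      ⊥-elim (ℕ.<⇒≱ (ℕ.<-≤-trans q le) ge)

    edge-above : ∀ {a} → toℕ a < ℓ → Opened-above a → Edge (suc ℓ) a c
    edge-above a<ℓ (le , c≺a) =
      ( ℕ.<-trans a<ℓ le
      , subst (toℕ c <_) (sym Fc≡ℓ) c<ℓ
      , inj₂ (c≺a , subst (_ <_) (sym Fc≡ℓ) a<ℓ , subst (_< _) (sym Fc≡ℓ) le) )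
      , inj₂ (subst (_< suc ℓ) (sym Fc≡ℓ) ℕ.≤-refl)
      where
      Fc≡ℓ : toℕ (F c) ≡ ℓ
      Fc≡ℓ = trans (cong toℕ F-c) i≡ℓ

    -- `L′` and `L` are the stacks before and after the closing, taken as variables so that `merge`
    -- can descend through them. The field `above` is what later keeps the remaining parts free of
    -- edges to `c`.
    record Merged (s : State) (r f : ℕ) (L L′ : List Point) (Ms : List (List Point)) : Set where
      field
        merged     : List Point
        rest       : List (List Point)
        Kb Kr      : List Point
        splits     : L ≡ Kb ++ Kr
        Kb-length  : length Kb ≡ r
        opened     : ∀ {k} → k ∈ Kb → F k ∈ merged
        opened⁻    : ∀ {a} → a ∈ merged → suc ℓ ≤ toℕ (F a) → F a ∈ Kb
        merged-marks : marks merged ≡ f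
        rest-layout : Layout ℓ s Kr rest
        tree       : Tree (Edge (suc ℓ)) merged
        c∈         : c ∈ merged
        above      : ∀ {k} → k ∈ L′ → c ≺ F k → F k ∈ merged
        apart      : All (Separate ℓ merged) rest
        rest⊆      : ∀ {M} → M ∈ rest → M ∈ Ms
        rest-pairs : AllPairs (Separate ℓ) rest
        merged⊆    : ∀ {a} → a ∈ merged → ∃ λ M → M ∈ Ms × a ∈ M
        covers     : ∀ {M a} → M ∈ Ms → a ∈ M → a ∈ merged ⊎ M ∈ rest

    -- For `one`, `c` is the top of the stack and crosses nothing open. For `more`, the block on top
    -- has a single open chord; as the only chord of `M₁` that can still gain an edge, it is joined
    -- to `c`, and this is the single edge between `M₁` and the tree merged so far.
    merge : ∀ {j q r f s L L′ Ms} → Split j q r f → Insert i j L L′ → Layout ℓ (q ++ s) L′ Ms →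
      (∀ {k} → k ∈ L′ → k ∈ K′) → (∀ {k} → k ∈ L → suc ℓ ≤ toℕ k) → AllPairs (λ k k′ → F k′ ≺ F k) L′ →
      All (Tree (Edge ℓ)) Ms → AllPairs (Separate ℓ) Ms →
      (∀ {M a} → M ∈ Ms → a ∈ M → toℕ a < ℓ) → Merged s r f L L′ Ms
    merge one here (block {k = .i} {Kb = Kb} {M = M} len f g m lay) ⊆K big (below ∷ _) (t ∷ ts) (sep ∷ seps) snd = record
      { merged = M ; rest = _ ; Kb = Kb ; Kr = _ ; splits = refl ; Kb-length = len
      ; opened = λ q → f (there q)
      ; opened⁻ = λ q le → tail-∈ (g q (ℕ.<⇒≤ le)) le
      ; merged-marks = m ; rest-layout = lay
      ; tree = tree-map edge-suc (λ a∈ b∈ e → old a∈ b∈ (new-edge (snd (here refl) a∈) (snd (here refl) b∈) e)) t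
      ; c∈ = f (here refl)
      ; above = λ { (here refl) lt → ⊥-elim (ℕ.<-irrefl refl lt)
                  ; (there q) lt → ⊥-elim (ℕ.<-asym lt (All.lookup below q)) }
      ; apart = sep ; rest⊆ = there ; rest-pairs = seps
      ; merged⊆ = λ q → M , here refl , q
      ; covers = λ { (here refl) q → inj₁ q ; (there p) q → inj₂ p } }
      where
      tail-∈ : ∀ {x} → x ∈ i ∷ Kb → suc ℓ ≤ toℕ x → x ∈ Kb
      tail-∈ (here refl) le = ⊥-elim (ℕ.<-irrefl (sym i≡ℓ) le)
      tail-∈ (there q)   le = q
      not-above : ∀ {a} → a ∈ M → ¬ Opened-above a
      not-above a∈ (le , lt) with tail-∈ (g a∈ (ℕ.<⇒≤ le)) le
      ... | q = ℕ.<-asym lt (subst (_≺ c) (proj₁ (involutive P (snd (here refl) a∈)))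
                  (All.lookup below (∈-++⁺ˡ q)))
      old : ∀ {a b} → a ∈ M → b ∈ M →
        Edge ℓ a b ⊎ ((a ≡ c × Opened-above b) ⊎ (b ≡ c × Opened-above a)) → Edge ℓ a b
      old a∈ b∈ (inj₁ e) = e
      old a∈ b∈ (inj₂ (inj₁ (_ , ab))) = ⊥-elim (not-above b∈ ab)
      old a∈ b∈ (inj₂ (inj₂ (_ , ab))) = ⊥-elim (not-above a∈ ab)
    merge {f = f} (more {f₁ = f₁} {f₂ = f₂} f-sum sp) (there {y = k} ins′) (block {Kb = []} {M = M₁} {Ms = Ms} refl op g m lay)
      ⊆K big (below ∷ srt) (t ∷ ts) (sep ∷ seps) snd = record
      { merged = M₁ ++ merged ; rest = rest ; Kb = k ∷ Kb ; Kr = Kr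
      ; splits = cong (k ∷_) splits ; Kb-length = cong suc Kb-length
      ; opened = λ { (here refl) → ∈-++⁺ˡ (op (here refl)) ; (there q) → ∈-++⁺ʳ M₁ (opened q) }
      ; opened⁻ = λ q le → opens (∈-++⁻ M₁ q) le
      ; merged-marks = trans (marks-++ M₁ merged) (trans (cong₂ ℕ._+_ m merged-marks) f-sum)
      ; rest-layout = rest-layout
      ; tree = join (tree-map edge-suc (λ a∈ b∈ e → old a∈ b∈ (new-edge (snd (here refl) a∈) (snd (here refl) b∈) e)) t)
          tree (op (here refl)) c∈
          (edge-above (snd (here refl) (op (here refl)))
            (subst (suc ℓ ≤_) (cong toℕ (sym (proj₁ (partner P (⊆K (here refl)))))) (big (here refl))
            , All.lookup below (insert-∈ ins′)))
          (λ a∈ b∈ → proj₁ (sep-merged a∈ b∈))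
          (λ a∈ b∈ e → bridge a∈ b∈ (new-edge (snd (here refl) a∈) (in-merged b∈) e))
      ; c∈ = ∈-++⁺ʳ M₁ c∈
      ; above = λ { (here refl) lt → ∈-++⁺ˡ (op (here refl)) ; (there q) lt → ∈-++⁺ʳ M₁ (above q lt) }
      ; apart = All.tabulate λ {M} q a∈ b∈ → far q (∈-++⁻ M₁ a∈) b∈
      ; rest⊆ = λ q → there (rest⊆ q) ; rest-pairs = rest-pairs
      ; merged⊆ = λ q → sources (∈-++⁻ M₁ q)
      ; covers = λ { (here refl) q → inj₁ (∈-++⁺ˡ q) ; (there p) q → cover′ (covers p q) } }
      where
      open Merged (merge sp ins′ lay (λ q → ⊆K (there q)) (λ q → big (there q)) srt ts seps (λ p q → snd (there p) q))
      sep-merged : Separate ℓ M₁ merged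
      sep-merged a∈ b∈ with M , M∈ , b∈M ← merged⊆ b∈ = All.lookup sep M∈ a∈ b∈M
      in-merged : ∀ {b} → b ∈ merged → toℕ b < ℓ
      in-merged b∈ with M , M∈ , b∈M ← merged⊆ b∈ = snd (there M∈) b∈M
      opens : ∀ {a} → a ∈ M₁ ⊎ a ∈ merged → suc ℓ ≤ toℕ (F a) → F a ∈ k ∷ Kb
      opens (inj₁ q) le with here p ← g q (ℕ.<⇒≤ le) = here p
      opens (inj₂ q) le = there (opened⁻ q le)
      old : ∀ {a b} → a ∈ M₁ → b ∈ M₁ →
        Edge ℓ a b ⊎ ((a ≡ c × Opened-above b) ⊎ (b ≡ c × Opened-above a)) → Edge ℓ a b
      old a∈ b∈ (inj₁ e) = e
      old a∈ b∈ (inj₂ (inj₁ (refl , _))) = ⊥-elim (proj₁ (sep-merged a∈ c∈) refl)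
      old a∈ b∈ (inj₂ (inj₂ (refl , _))) = ⊥-elim (proj₁ (sep-merged b∈ c∈) refl)
      bridge : ∀ {a b} → a ∈ M₁ → b ∈ merged →
        Edge ℓ a b ⊎ ((a ≡ c × Opened-above b) ⊎ (b ≡ c × Opened-above a)) → a ≡ F k × b ≡ c
      bridge a∈ b∈ (inj₁ e) = ⊥-elim (proj₂ (sep-merged a∈ b∈) e)
      bridge a∈ b∈ (inj₂ (inj₁ (refl , _))) = ⊥-elim (proj₁ (sep-merged a∈ c∈) refl)
      bridge a∈ b∈ (inj₂ (inj₂ (eq , (le , _)))) with here p ← g a∈ (ℕ.<⇒≤ le) =
        trans (sym (proj₁ (involutive P (snd (here refl) a∈)))) (cong F p) , eq
      far : ∀ {M a b} → M ∈ rest → a ∈ M₁ ⊎ a ∈ merged → b ∈ M → a ≢ b × ¬ Edge ℓ a b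
      far M∈ (inj₁ a∈) b∈ = All.lookup sep (rest⊆ M∈) a∈ b∈
      far M∈ (inj₂ a∈) b∈ = All.lookup apart M∈ a∈ b∈
      sources : ∀ {a} → a ∈ M₁ ⊎ a ∈ merged → ∃ λ M → M ∈ M₁ ∷ Ms × a ∈ M
      sources (inj₁ q) = M₁ , here refl , q
      sources (inj₂ q) with M , M∈ , p ← merged⊆ q = M , there M∈ , p
      cover′ : ∀ {M a} → a ∈ merged ⊎ M ∈ rest → a ∈ M₁ ++ merged ⊎ M ∈ rest
      cover′ (inj₁ q) = inj₁ (∈-++⁺ʳ M₁ q)
      cover′ (inj₂ q) = inj₂ q

module _ {A : Set} {R : A → A → Set} where

  pairs-++⁻ : ∀ xs {ys} → AllPairs R (xs ++ ys) →
    AllPairs R xs × AllPairs R ys × (∀ {x y} → x ∈ xs → y ∈ ys → R x y)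
  pairs-++⁻ []       ps = [] , ps , λ ()
  pairs-++⁻ (x ∷ xs) (p ∷ ps) with l , r , cr ← pairs-++⁻ xs ps =
    All.++⁻ˡ xs p ∷ l , r , λ { (here refl) q → All.lookup p (∈-++⁺ʳ xs q) ; (there q) → cr q }

  pairs-map-∈ : ∀ {S : A → A → Set} {xs} → (∀ {x y} → x ∈ xs → y ∈ xs → R x y → S x y) → AllPairs R xs → AllPairs S xs
  pairs-map-∈ f []       = []
  pairs-map-∈ f (p ∷ ps) =
    All.tabulate (λ q → f (here refl) (there q) (All.lookup p q)) ∷ pairs-map-∈ (λ x y → f (there x) (there y)) ps

-- Each step of the automaton preserves the invariant

module Scan′ {N : ℕ} (F : Fin N → Fin N) (R : Fin N → Bool) where
  open Scan F R

  -- No chord closes at `i`, so no edge is detected and the new chord is a tree by itself.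
  components-push : ∀ {ℓ K parts} i → toℕ i ≡ ℓ → i ≺ F i → Pairing ℓ K → Pairing (suc ℓ) (F i ∷ K) →
    Components ℓ parts → Components (suc ℓ) ([ i ] ∷ parts)
  components-push {ℓ} {K} {parts} i refl i<k P P′ Q = record
    { trees = leaf i ∷ All.tabulate (λ M∈ → tree-map edge-suc
        (λ a∈ b∈ e → old (proj₁ (sound Q M∈ a∈)) (proj₁ (sound Q M∈ b∈)) e) (All.lookup (trees Q) M∈))
    ; separate = All.tabulate (λ M∈ → λ { (here refl) b∈ → fresh (sound Q M∈ b∈) })
        ∷ pairs-map-∈ (λ M∈ M′∈ sep a∈ b∈ → proj₁ (sep a∈ b∈)
            , λ e → proj₂ (sep a∈ b∈) (old (proj₁ (sound Q M∈ a∈)) (proj₁ (sound Q M′∈ b∈)) e)) (separate Q)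
    ; sound = λ { (here refl) (here refl) → ℕ.≤-refl , i<k
                ; (there M∈) a∈ → let lt , ch = sound Q M∈ a∈ in ℕ.m≤n⇒m≤1+n lt , ch }
    ; cover = λ lt ch → covered (split-suc lt) ch }
    where
    at-i : ∀ {a} → toℕ a < ℓ → toℕ (F a) < suc ℓ → toℕ (F a) < ℓ
    at-i a<ℓ lt with split-suc lt
    ... | inj₁ lt′ = lt′
    ... | inj₂ eq = ⊥-elim (ℕ.<-asym i<k (subst (_< ℓ)
        (cong toℕ (trans (sym (proj₁ (involutive P a<ℓ))) (cong F (toℕ-injective eq)))) a<ℓ))
    old : ∀ {a b} → toℕ a < ℓ → toℕ b < ℓ → Edge (suc ℓ) a b → Edge ℓ a b
    old a<ℓ b<ℓ (e , inj₁ lt) = e , inj₁ (at-i a<ℓ lt)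
    old a<ℓ b<ℓ (e , inj₂ lt) = e , inj₂ (at-i b<ℓ lt)
    no-edge : ∀ {b} → toℕ b < ℓ → ¬ Edge (suc ℓ) i b
    no-edge b<ℓ (_ , inj₁ (s≤s le)) = ℕ.<⇒≱ i<k le
    no-edge b<ℓ ((_ , _ , inj₁ (lt , _)) , inj₂ _) = ℕ.<-asym lt b<ℓ
    no-edge b<ℓ ((_ , _ , inj₂ (_ , lt , _)) , inj₂ (s≤s le)) = ℕ.<⇒≱ lt le
    fresh : ∀ {b} → toℕ b < ℓ × Chord b → i ≢ b × ¬ Edge (suc ℓ) i b
    fresh (b<ℓ , _) = (λ { refl → ℕ.<-irrefl refl b<ℓ }) , no-edge b<ℓ
    covered : ∀ {a} → toℕ a < ℓ ⊎ toℕ a ≡ ℓ → Chord a → ∃ λ M → M ∈ [ i ] ∷ parts × a ∈ M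
    covered (inj₁ lt) ch with M , M∈ , a∈ ← cover Q lt ch = M , there M∈ , a∈
    covered (inj₂ eq) ch = [ i ] , here refl , here (toℕ-injective eq)

  module _ {ℓ j K K′} (i : Point) (i≡ℓ : toℕ i ≡ ℓ) (ins : Insert i j K K′)
           (P : Pairing ℓ K′) (B : Bounded (suc ℓ) K) where
    open Closing i i≡ℓ ins P B

    merge-parts : ∀ {q r f s c₀} → Split j q r f → (I : Invariant ℓ (q ++ s) c₀ K′) → Merged s r f K K′ (open-parts I)
    merge-parts sp I = merge sp ins (layout I) (λ q → q) B (sorted P)
      (All.++⁻ˡ (open-parts I) (trees (partition I))) (proj₁ (pairs-++⁻ (open-parts I) (separate (partition I))))
      (λ M∈ a∈ → proj₁ (sound (partition I) (∈-++⁺ˡ M∈) a∈))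

    module _ {q r f s c₀} (sp : Split j q r f) (I : Invariant ℓ (q ++ s) c₀ K′) where
      private
        Q = partition I
        pairs = pairs-++⁻ (open-parts I) (separate Q)

      open Merged (merge-parts sp I)

      private
        others = rest ++ done I

        ⊆parts : ∀ {M} → M ∈ others → M ∈ open-parts I ++ done I
        ⊆parts M∈ with ∈-++⁻ rest M∈
        ... | inj₁ q = ∈-++⁺ˡ (rest⊆ q)
        ... | inj₂ q = ∈-++⁺ʳ (open-parts I) q

        merged-sound : ∀ {a} → a ∈ merged → toℕ a < ℓ × Chord a
        merged-sound a∈ with M , M∈ , p ← merged⊆ a∈ = sound Q (∈-++⁺ˡ M∈) p

        apart-from : ∀ {M} → M ∈ others → Separate ℓ merged M
        apart-from M∈ a∈ b∈ with ∈-++⁻ rest M∈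
        ... | inj₁ q = All.lookup apart q a∈ b∈
        ... | inj₂ q with M′ , M′∈ , p ← merged⊆ a∈ = proj₂ (proj₂ pairs) M′∈ q p b∈

        old : ∀ {M M′ a b} → M ∈ others → M′ ∈ others → a ∈ M → b ∈ M′ → Edge (suc ℓ) a b → Edge ℓ a b
        old M∈ M′∈ a∈ b∈ e with new-edge (proj₁ (sound Q (⊆parts M∈) a∈)) (proj₁ (sound Q (⊆parts M′∈) b∈)) e
        ... | inj₁ e′ = e′
        ... | inj₂ (inj₁ (refl , _)) = ⊥-elim (proj₁ (apart-from M∈ c∈ a∈) refl)
        ... | inj₂ (inj₂ (refl , _)) = ⊥-elim (proj₁ (apart-from M′∈ c∈ b∈) refl)

        apart-suc : ∀ {M} → M ∈ others → Separate (suc ℓ) merged M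
        apart-suc M∈ {a} {b} a∈ b∈ = proj₁ (apart-from M∈ a∈ b∈) , no-edge
          where
          b<ℓ = proj₁ (sound Q (⊆parts M∈) b∈)
          no-edge : ¬ Edge (suc ℓ) a b
          no-edge e with new-edge (proj₁ (merged-sound a∈)) b<ℓ e
          ... | inj₁ e′ = proj₂ (apart-from M∈ a∈ b∈) e′
          ... | inj₂ (inj₂ (refl , _)) = proj₁ (apart-from M∈ c∈ b∈) refl
          ... | inj₂ (inj₁ (_ , (le , lt))) =
            proj₁ (apart-from M∈ (above (complete P b<ℓ (ℕ.<⇒≤ le))
              (subst (c ≺_) (sym (proj₁ (involutive P b<ℓ))) lt)) b∈) (proj₁ (involutive P b<ℓ))

        covered : ∀ {a} → toℕ a < ℓ ⊎ toℕ a ≡ ℓ → Chord a → ∃ λ M → M ∈ merged ∷ others × a ∈ M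
        covered (inj₂ eq) ch with refl ← toℕ-injective (trans eq (sym i≡ℓ)) =
          ⊥-elim (ℕ.<-asym ch (subst (toℕ c <_) (sym i≡ℓ) c<ℓ))
        covered (inj₁ lt) ch with M , M∈ , a∈ ← cover Q lt ch with ∈-++⁻ (open-parts I) M∈
        ... | inj₂ q = M , there (∈-++⁺ʳ rest q) , a∈
        ... | inj₁ q with covers q a∈
        ... | inj₁ a∈′ = merged , here refl , a∈′
        ... | inj₂ q′  = M , there (∈-++⁺ˡ q′) , a∈

      -- All new edges start at `c`, and by `above` their other ends lie in `merged` too. Hence the
      -- other parts neither change inside nor become adjacent to `merged`.
      components-close : Components (suc ℓ) (merged ∷ rest ++ done I)
      components-close = record
        { trees = tree ∷ All.tabulate (λ M∈ → tree-map edge-suc (λ a∈ b∈ e → old M∈ M∈ a∈ b∈ e)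
            (All.lookup (trees Q) (⊆parts M∈)))
        ; separate = All.tabulate (λ M∈ → apart-suc M∈)
            ∷ pairs-map-∈ (λ M∈ M′∈ sep a∈ b∈ → proj₁ (sep a∈ b∈) , λ e → proj₂ (sep a∈ b∈) (old M∈ M′∈ a∈ b∈ e))
                (AllPairs.++⁺ rest-pairs (proj₁ (proj₂ pairs))
                  (All.tabulate λ p → All.tabulate λ q → proj₂ (proj₂ pairs) (rest⊆ p) q))
        ; sound = λ { (here refl) a∈ → let lt , ch = merged-sound a∈ in ℕ.m≤n⇒m≤1+n lt , ch
                    ; (there M∈) a∈ → let lt , ch = sound Q (⊆parts M∈) a∈ in ℕ.m≤n⇒m≤1+n lt , ch }
        ; cover = λ lt ch → covered (split-suc lt) ch }

  components-shift : ∀ {ℓ M} xs {ys} → Components ℓ (M ∷ xs ++ ys) → Components ℓ (xs ++ M ∷ ys)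
  components-shift {ℓ} {M} xs {ys} Q with trees Q | separate Q
  ... | t ∷ ts | s ∷ ss with l , r , cr ← pairs-++⁻ xs ss = record
    { trees = All.++⁺ (All.++⁻ˡ xs ts) (t ∷ All.++⁻ʳ xs ts)
    ; separate = AllPairs.++⁺ l (All.++⁻ʳ xs s ∷ r)
        (All.tabulate λ p → (λ {a} {b} → separate-sym (All.lookup (All.++⁻ˡ xs s) p) {a} {b})
          ∷ All.tabulate λ q {a} {b} → cr p q {a} {b})
    ; sound = λ M∈ a∈ → sound Q (back (∈-++⁻ xs M∈)) a∈
    ; cover = λ lt ch → let M , M∈ , a∈ = cover Q lt ch in M , forth M∈ , a∈ }
    where
    back : ∀ {M′} → M′ ∈ xs ⊎ M′ ∈ M ∷ ys → M′ ∈ M ∷ xs ++ ys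
    back (inj₁ p)           = there (∈-++⁺ˡ p)
    back (inj₂ (here refl)) = here refl
    back (inj₂ (there p))   = there (∈-++⁺ʳ xs p)
    forth : ∀ {M′} → M′ ∈ M ∷ xs ++ ys → M′ ∈ xs ++ M ∷ ys
    forth (here refl) = ∈-++⁺ʳ xs (here refl)
    forth (there p) with ∈-++⁻ xs p
    ... | inj₁ q = ∈-++⁺ˡ q
    ... | inj₂ q = ∈-++⁺ʳ xs (there q)

  invariant-finish : ∀ {ℓ s c K} (i : Point) (i≡ℓ : toℕ i ≡ ℓ) → Pairing ℓ (i ∷ K) → Bounded (suc ℓ) K →
    Invariant ℓ ((0 , 1) ∷ s) c (i ∷ K) → Invariant (suc ℓ) s (suc c) K
  invariant-finish {s = s} i i≡ℓ P B I = record
    { open-parts = rest ; done = merged ∷ done I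
    ; layout = subst (λ L → Layout _ s L rest) (sym K≡) (layout-suc rest-layout)
    ; done-length = cong suc (done-length I)
    ; done-marks = merged-marks ∷ done-marks I
    ; partition = components-shift rest (components-close i i≡ℓ here P B one I) }
    where
    open Closing.Merged (merge-parts i i≡ℓ here P B one I)
    K≡ : _ ≡ Kr
    K≡ with Kb | Kb-length | splits
    ... | [] | refl | eq = eq

  invariant-close : ∀ {ℓ j q r f s c K K′} (i : Point) (i≡ℓ : toℕ i ≡ ℓ) (ins : Insert i j K K′) → Pairing ℓ K′ →
    Bounded (suc ℓ) K → Split j q (suc r) f → Invariant ℓ (q ++ s) c K′ → Invariant (suc ℓ) ((r , f) ∷ s) c K
  invariant-close {r = r} {K = K} i i≡ℓ ins P B sp I = record
    { open-parts = merged ∷ rest ; done = done I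
    ; layout = lay Kb Kb-length splits opened opened⁻
    ; done-length = done-length I ; done-marks = done-marks I
    ; partition = components-close i i≡ℓ ins P B sp I }
    where
    open Closing.Merged (merge-parts i i≡ℓ ins P B sp I)
    lay : ∀ Kb → length Kb ≡ suc r → K ≡ Kb ++ Kr → (∀ {k} → k ∈ Kb → F k ∈ merged) →
      (∀ {a} → a ∈ merged → _ ≤ toℕ (F a) → F a ∈ Kb) → Layout _ _ K (merged ∷ rest)
    lay (k ∷ Kb) refl eq f g = subst (λ L → Layout _ _ L (merged ∷ rest)) (sym eq)
      (block refl f g merged-marks (layout-suc rest-layout))

  invariant : ∀ {s ℓ c K} {h : History s ℓ c} → Reads h K → Bounded ℓ K → Invariant ℓ s c K
  invariant start B = record
    { open-parts = [] ; done = [] ; layout = [] ; done-length = refl ; done-marks = []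
    ; partition = record { trees = [] ; separate = [] ; sound = λ () ; cover = λ () } }
  invariant rd₀@(push {x = x} i refl refl inv Ri rd) B = record
    { open-parts = [ i ] ∷ open-parts I ; done = done I
    ; layout = block refl (λ { (here refl) → here inv ; (there ()) }) (λ { (here refl) _ → here refl ; (there ()) _ })
        (trans (ℕ.+-identityʳ _) (cong fromBool Ri)) (layout-suc (layout I))
    ; done-length = done-length I ; done-marks = done-marks I
    ; partition = components-push i refl (B (here refl)) (pairing rd (bounded-tail B)) (pairing rd₀ B) (partition I) }
    where I = invariant rd (bounded-tail B)
  invariant (close {sp = sp} i eq Ri ins rd) B =
    invariant-close i eq ins (pairing rd B′) B sp (invariant rd B′)
    where B′ = bounded-insert eq ins B
  invariant (finish i eq Ri rd) B = invariant-finish i eq (pairing rd B′) B (invariant rd B′)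
    where B′ = bounded-insert eq here B

  -- Here the number `f` of marks is still arbitrary: when a diagram is scanned, the closed
  -- component has to be at hand before the rooting can show that `finish` applies.
  finish-part : ∀ {ℓ f s c K} (i : Point) (i≡ℓ : toℕ i ≡ ℓ) → Pairing ℓ (i ∷ K) → Bounded (suc ℓ) K →
    Invariant ℓ ((0 , f) ∷ s) c (i ∷ K) → ∃ λ M → ∃ λ parts →
    marks M ≡ f × Components (suc ℓ) (M ∷ parts) × (∀ {a} → a ∈ M → toℕ (F a) < suc ℓ)
  finish-part {s = s} i i≡ℓ P B I =
    merged , rest ++ done I , merged-marks , components-close i i≡ℓ here P B one I , closed
    where
    open Closing.Merged (merge-parts i i≡ℓ here P B one I)
    none : ∀ {a} → a ∉ Kb
    none with Kb | Kb-length
    ... | [] | refl = λ ()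
    closed : ∀ {a} → a ∈ merged → toℕ (F a) < suc _
    closed {a} a∈ with ℕ.<-≤-connex (toℕ (F a)) (suc _)
    ... | inj₁ lt = lt
    ... | inj₂ ge = ⊥-elim (none (opened⁻ a∈ ge))

-- Boolean predicates as propositions

∈-allVecs : ∀ {N} k (v : Vec (Fin N) k) → v ∈ allVecs k
∈-allVecs zero    []      = here refl
∈-allVecs (suc k) (x ∷ v) = ∈-concatMap⁺ (λ x → map (x ∷_) (allVecs k))
  (lose (∈-allFin x) (∈-map⁺ (x ∷_) (∈-allVecs k v)))

unique-length : ∀ {N} {xs : List (Fin N)} → Unique xs → length xs ≤ N
unique-length {xs = xs} u = injective⇒≤ {f = List.lookup xs} (injective u)
  where
  injective : ∀ {xs : List (Fin _)} → Unique xs → ∀ {i j} → List.lookup xs i ≡ List.lookup xs j → i ≡ j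
  injective (x∉ ∷ u) {Fin.zero}  {Fin.zero}  eq = refl
  injective (x∉ ∷ u) {Fin.zero}  {Fin.suc j} eq = ⊥-elim (All.lookup x∉ (∈-lookup j) eq)
  injective (x∉ ∷ u) {Fin.suc i} {Fin.zero}  eq = ⊥-elim (All.lookup x∉ (∈-lookup i) (sym eq))
  injective (x∉ ∷ u) {Fin.suc i} {Fin.suc j} eq = cong Fin.suc (injective u eq)

T-any : ∀ {A : Set} (f : A → Bool) xs → T (any f xs) ⇔ (∃ λ x → x ∈ xs × T (f x))
T-any f xs = mk⇔ (λ t → find (any⁻ f xs t)) (λ { (x , x∈ , t) → any⁺ f (lose x∈ t) })

T-not : ∀ {b} → T (not b) ⇔ (¬ T b)
T-not {true}  = mk⇔ (λ ()) (λ f → f tt)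
T-not {false} = mk⇔ (λ _ ()) (λ _ → tt)

T-< : ∀ {N} {i j : Fin N} → T (i <ᵇ j) ⇔ (toℕ i < toℕ j)
T-< {i = i} {j} = mk⇔ (λ t → toWitness {a? = i Fin.<? j} t) fromWitness

T-== : ∀ {N} {i j : Fin N} → T (i == j) ⇔ (i ≡ j)
T-== {i = i} {j} = mk⇔ (λ t → toWitness {a? = i Fin.≟ j} t) fromWitness

module Reflect {n : ℕ} (p : Inv n) (R : Fin (Pts n) → Bool) where
  private
    N = Pts n
    F = lookup p
  open Scan F R

  T-adj : ∀ {a b} → T (adj {n} p a b) ⇔ Adj a b
  T-adj {a} {b} = mk⇔ fwd bwd
    where
    fwd : T (adj {n} p a b) → Adj a b
    fwd t with ca , t₁ ← to T-∧ t with cb , t₂ ← to T-∧ t₁ with to T-∨ t₂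
    ... | inj₁ t₃ = let x , y = to T-∧ t₃ ; y , z = to T-∧ y in
      to T-< ca , to T-< cb , inj₁ (to T-< x , to T-< y , to T-< z)
    ... | inj₂ t₃ = let x , y = to T-∧ t₃ ; y , z = to T-∧ y in
      to T-< ca , to T-< cb , inj₂ (to T-< x , to T-< y , to T-< z)
    bwd : Adj a b → T (adj {n} p a b)
    bwd (ca , cb , inj₁ (x , y , z)) = from T-∧ (from T-< ca , from T-∧ (from T-< cb , from T-∨ (inj₁
      (from T-∧ (from T-< x , from T-∧ (from T-< y , from T-< z))))))
    bwd (ca , cb , inj₂ (x , y , z)) = from T-∧ (from T-< ca , from T-∧ (from T-< cb , from T-∨ (inj₂
      (from T-∧ (from T-< x , from T-∧ (from T-< y , from T-< z))))))

  private
    -- The auxiliary functions of isCycle are private; unification recovers them.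
    hidden : Σ (List (Fin N) → Bool) λ dis → Σ (Fin N → List (Fin N) → Bool) λ pth →
      Σ (Fin N → List (Fin N) → Fin N) λ end → ∀ (x y : Fin N) ys →
      isCycle {n} p (x ∷ y ∷ ys) ≡ ⌊ 3 ℕ.≤? suc (suc (length ys)) ⌋
        ∧ ((not (any (x ==_) (y ∷ ys)) ∧ (not (any (y ==_) ys) ∧ dis ys))
        ∧ ((adj {n} p x y ∧ pth y ys) ∧ adj {n} p (end y ys) x))
    hidden = _ , _ , _ , λ x y ys → refl

    dis = proj₁ hidden
    pth = proj₁ (proj₂ hidden)
    end = proj₁ (proj₂ (proj₂ hidden))

    T-fresh : ∀ (x : Fin N) xs → T (not (any (x ==_) xs)) ⇔ All (λ y → x ≢ y) xs
    T-fresh x xs = mk⇔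
      (λ t → All.tabulate λ {y} y∈ eq → to T-not t (from (T-any (x ==_) xs) (y , y∈ , from T-== eq)))
      (λ a → from T-not λ t → let y , y∈ , e = to (T-any (x ==_) xs) t in All.lookup a y∈ (to T-== e))

    T-dis : ∀ xs → T (dis xs) ⇔ Unique xs
    T-dis [] = mk⇔ (λ _ → []) (λ _ → tt)
    T-dis (x ∷ xs) = mk⇔
      (λ t → let f , d = to T-∧ t in to (T-fresh x xs) f ∷ to (T-dis xs) d)
      (λ { (f ∷ d) → from T-∧ (from (T-fresh x xs) f , from (T-dis xs) d) })

    T-pth : ∀ x xs → T (pth x xs) → Path Adj x xs (end x xs)
    T-pth x [] t = []
    T-pth x (y ∷ ys) t = let e , q = to T-∧ t in to T-adj e ∷ T-pth y ys q

    pth-T : ∀ {x xs z} → Path Adj x xs z → T (pth x xs) × end x xs ≡ z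
    pth-T []      = tt , refl
    pth-T (e ∷ q) = from T-∧ (from T-adj e , proj₁ (pth-T q)) , proj₂ (pth-T q)

  T-isCycle : ∀ x xs → T (isCycle {n} p (x ∷ xs)) ⇔ Cycle Adj x xs
  T-isCycle x [] = mk⇔ (λ ()) (λ { (cycle _ _ _ ()) })
  T-isCycle x xs@(_ ∷ _) = mk⇔ fwd bwd
    where
    fwd : T (isCycle {n} p (x ∷ xs)) → Cycle Adj x xs
    fwd t with l , t₁ ← to (T-∧ {⌊ 3 ℕ.≤? suc (length xs) ⌋}) t with d , t₂ ← to (T-∧ {not (any (x ==_) xs) ∧ dis xs}) t₁
      with q , e ← to (T-∧ {pth x xs}) t₂ =
      cycle (T-pth x xs q) (to (T-dis (x ∷ xs)) d) (to T-adj e)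
        (ℕ.s≤s⁻¹ (toWitness {a? = 3 ℕ.≤? suc (length xs)} l))
    bwd : Cycle Adj x xs → T (isCycle {n} p (x ∷ xs))
    bwd (cycle q u e l) = from (T-∧ {⌊ 3 ℕ.≤? suc (length xs) ⌋})
      ( fromWitness {a? = 3 ℕ.≤? suc (length xs)} (s≤s l)
      , from (T-∧ {not (any (x ==_) xs) ∧ dis xs}) (from (T-dis (x ∷ xs)) u
      , from (T-∧ {pth x xs}) (proj₁ (pth-T q) , subst (λ y → T (adj {n} p y x)) (sym (proj₂ (pth-T q))) (from T-adj e))))

  T-hasCycle : T (hasCycle {n} p) ⇔ (∃ λ x → ∃ λ xs → Cycle Adj x xs)
  T-hasCycle = mk⇔ fwd bwd
    where
    cyclic : ∀ k → Vec (Fin N) k → Bool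
    cyclic k v = isCycle {n} p (toList v)
    fwd : T (hasCycle {n} p) → ∃ λ x → ∃ λ xs → Cycle Adj x xs
    fwd t with k , _ , t₁ ← to (T-any (λ k → any (cyclic k) (allVecs {N} k)) (upTo (suc N))) t
      with v , _ , t₂ ← to (T-any (cyclic k) (allVecs k)) t₁
      with toList v | t₂
    ... | x ∷ xs | t₃ = x , xs , to (T-isCycle x xs) t₃
    bwd : (∃ λ x → ∃ λ xs → Cycle Adj x xs) → T (hasCycle {n} p)
    bwd (x , xs , c) = from (T-any (λ k → any (cyclic k) (allVecs {N} k)) (upTo (suc N)))
      ( length (x ∷ xs) , ∈-upTo⁺ (s≤s (unique-length (Cycle.unique c)))
      , from (T-any (cyclic (length (x ∷ xs))) (allVecs (length (x ∷ xs))))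
        ( fromList (x ∷ xs) , ∈-allVecs _ _
        , subst (λ l → T (isCycle {n} p l)) (sym (toList∘fromList (x ∷ xs))) (from (T-isCycle x xs) c)))

  private
    reach-path : ∀ {i xs j} → Path Adj i xs j → ∀ k → length xs ≤ k → T (reachIn {n} p k i j)
    reach-path []      zero    l = from T-== refl
    reach-path []      (suc k) l = from T-∨ (inj₁ (reach-path [] k z≤n))
    reach-path (_∷_ {y = y} e q) (suc k) (s≤s l) = from T-∨ (inj₂ (from (T-any _ (allFin N))
      (y , ∈-allFin y , from T-∧ (from T-adj e , reach-path q k l))))

    reach-closed : ∀ {M} → (∀ {a b} → a ∈ M → Adj a b → b ∈ M) → ∀ k {i j} → T (reachIn {n} p k i j) → i ∈ M → j ∈ M
    reach-closed cl zero t i∈ with refl ← to T-== t = i∈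
    reach-closed cl (suc k) t i∈ with to T-∨ t
    ... | inj₁ t₁ = reach-closed cl k t₁ i∈
    ... | inj₂ t₁ with y , _ , t₂ ← to (T-any _ (allFin N)) t₁ with e , t₃ ← to T-∧ t₂ =
      reach-closed cl k t₃ (cl i∈ (to T-adj e))

  -- `tree` gives reachability within `M` and `closed` confines it to `M`. Since `time` is free, a
  -- component can be certified as soon as its last chord closes.
  record Component (M : List (Fin N)) : Set where
    field
      {time} : ℕ
      tree   : Tree (Edge time) M
      closed : ∀ {a b} → a ∈ M → Adj a b → b ∈ M
      chords : ∀ {a} → a ∈ M → Chord a

  T-connected : ∀ {M v w} → Component M → v ∈ M → T (connected {n} p v w) ⇔ (w ∈ M)
  T-connected {M} {v} {w} Q v∈ = mk⇔
    (λ t → reach-closed closed N (proj₂ (to (T-∧ {isChord {n} p w}) (proj₂ (to (T-∧ {isChord {n} p v}) t)))) v∈)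
    (λ w∈ → let simple q u _ = tree-path edge-sym tree v∈ w∈ in
      from T-∧ (from T-< (chords v∈) , from T-∧ (from T-< (chords w∈) ,
        reach-path (path-map proj₁ q) N (ℕ.<⇒≤ (unique-length u)))))
    where open Component Q

-- Scanning a forest diagram

module Extend {N : ℕ} (F : Fin N → Fin N) (R : Fin N → Bool) where
  open Scan F R
  open Scan′ F R

  insert-related : ∀ {x : Point} {Q : Point → Point → Set} {j K K′} → Insert x j K K′ → AllPairs Q K′ →
    ∀ {k} → k ∈ K → Q k x ⊎ Q x k
  insert-related here        (q ∷ _)  k∈          = inj₂ (All.lookup q k∈)
  insert-related (there ins) (q ∷ qs) (here refl) = inj₁ (All.lookup q (insert-∈ ins))
  insert-related (there ins) (q ∷ qs) (there k∈)  = insert-related ins qs k∈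

  bounded-close : ∀ {ℓ j K K′} i → toℕ i ≡ ℓ → Insert i j K K′ → Pairing ℓ K′ → Bounded ℓ K′ → Bounded (suc ℓ) K
  bounded-close i refl ins P B {k} k∈ = ℕ.≤∧≢⇒< (B (insert-⊆ ins k∈)) λ eq → distinct (toℕ-injective eq)
    where
    distinct : i ≢ k
    distinct refl with insert-related ins (sorted P) k∈
    ... | inj₁ lt = ℕ.<-irrefl refl lt
    ... | inj₂ lt = ℕ.<-irrefl refl lt

  -- The obstruction to a split: some chord above `c` shares its block. The next chord `k₂` of that
  -- block is adjacent in the stack, so it is either `i` itself or still above.
  record Conflict (i : Point) (K : List Point) (Ms : List (List Point)) : Set where
    field
      {part}  : List Point
      part∈   : part ∈ Ms
      k₁ k₂   : Point
      k₁∈     : k₁ ∈ K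
      k₂∈     : k₂ ∈ K
      F-k₁∈   : F k₁ ∈ part
      F-k₂∈   : F k₂ ∈ part
      ordered : F k₂ ≺ F k₁
      above₁  : F i ≺ F k₁
      above₂  : k₂ ≡ i ⊎ F i ≺ F k₂

  findSplit : ∀ {ℓ i j K K′ s Ms} → Insert i j K K′ → Layout ℓ s K′ Ms →
    AllPairs (λ k k′ → F k′ ≺ F k) K′ →
    (∃ λ q → ∃ λ s′ → ∃ λ r → ∃ λ f → s ≡ q ++ s′ × Split j q r f) ⊎ Conflict i K′ Ms
  findSplit here (block _ _ _ _ _) _ = inj₁ (_ , _ , _ , _ , refl , one)
  findSplit (there ins) (block {Kb = []} refl _ _ _ lay) (_ ∷ srt) with findSplit ins lay srt
  ... | inj₁ (q , s′ , r , f , refl , sp) = inj₁ (_ , s′ , suc r , _ , refl , more refl sp)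
  ... | inj₂ Q = inj₂ (record
    { part∈ = there part∈ ; k₁ = k₁ ; k₂ = k₂ ; k₁∈ = there k₁∈ ; k₂∈ = there k₂∈
    ; F-k₁∈ = F-k₁∈ ; F-k₂∈ = F-k₂∈ ; ordered = ordered ; above₁ = above₁ ; above₂ = above₂ })
    where open Conflict Q
  findSplit (there ins) (block {k = k₁} {Kb = k₂ ∷ Kb} _ f _ _ lay) (below ∷ srt) = inj₂ (record
    { part∈ = here refl ; k₁ = k₁ ; k₂ = k₂ ; k₁∈ = here refl ; k₂∈ = there (here refl)
    ; F-k₁∈ = f (here refl) ; F-k₂∈ = f (there (here refl))
    ; ordered = All.lookup below (here refl) ; above₁ = All.lookup below (insert-∈ ins)
    ; above₂ = second ins srt })
    where
    second : ∀ {i j K k₂ Ks} → Insert i j K (k₂ ∷ Ks) → AllPairs (λ k k′ → F k′ ≺ F k) (k₂ ∷ Ks) →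
      k₂ ≡ i ⊎ F i ≺ F k₂
    second here        _       = inj₁ refl
    second (there ins) (q ∷ _) = inj₂ (All.lookup q (insert-∈ ins))

  -- If `c` lies in the tree of `F k₁`, the tree path between them has at least two edges, because
  -- their crossing is detected only now (`late`); the new edge closes the cycle. Otherwise `c` is a
  -- new vertex crossing both ends of the tree path from `F k₁` to `F k₂`.
  conflict-cycle : ∀ {ℓ j K K′ parts} i → toℕ i ≡ ℓ → Insert i j K K′ → Pairing ℓ K′ → Bounded (suc ℓ) K →
    Components ℓ parts → Conflict i K′ parts → ∃ λ x → ∃ λ xs → Cycle Adj x xs
  conflict-cycle {ℓ} {K = K} {K′ = K′} i i≡ℓ ins P B Q conf = answer
    where
    open Conflict conf
    open Closing i i≡ℓ ins P B
    t : Tree (Edge ℓ) part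
    t = All.lookup (trees Q) part∈
    ahead : ∀ {k} → k ∈ K′ → c ≺ F k → Adj (F k) c
    ahead {k} k∈ lt = proj₁ (edge-above (proj₂ (partner P k∈)) (subst (suc ℓ ≤_) (cong toℕ (sym (proj₁ (partner P k∈)))) big , lt))
      where
      big : suc ℓ ≤ toℕ k
      big with insert-⊇ ins k∈
      ... | inj₁ refl = ⊥-elim (ℕ.<-irrefl refl lt)
      ... | inj₂ k∈K  = B k∈K
    late : ∀ {k} → k ∈ K′ → c ≺ F k → ¬ Edge ℓ c (F k)
    late {k} k∈ lt (_ , inj₁ l) = ℕ.<-irrefl (trans (cong toℕ F-c) i≡ℓ) l
    late {k} k∈ lt (_ , inj₂ l) with insert-⊇ ins k∈
    ... | inj₁ refl = ℕ.<-irrefl refl lt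
    ... | inj₂ k∈K  = ℕ.<-asym (B k∈K) (subst (_< ℓ) (cong toℕ (proj₁ (partner P k∈))) l)
    around : ∀ {k} → k ∈ K′ → c ≺ F k → F k ∈ part → c ∈ part → ∃ λ x → ∃ λ xs → Cycle Adj x xs
    around {k} k∈ lt Fk∈ c∈ with tree-path edge-sym t c∈ Fk∈
    ... | simple {[]} p _ _ = ⊥-elim (ℕ.<-irrefl (cong toℕ (path-trivial p)) lt)
    ... | simple {_ ∷ []} p _ _ = ⊥-elim (late k∈ lt (path-single p))
    ... | simple {_ ∷ _ ∷ _} p u _ = c , _ , cycle (path-map proj₁ p) u (ahead k∈ lt) (s≤s (s≤s z≤n))
    through : c ∉ part → c ≺ F k₂ → ∃ λ x → ∃ λ xs → Cycle Adj x xs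
    through c∉ lt with tree-path edge-sym t F-k₁∈ F-k₂∈
    ... | simple {[]} p _ _ = ⊥-elim (ℕ.<-irrefl (cong toℕ (sym (path-trivial p))) ordered)
    ... | simple {_ ∷ _} p u inside = c , _ , cycle (adj-sym (ahead k₁∈ above₁) ∷ path-map proj₁ p)
      (All.map (λ { w∈ refl → c∉ w∈ }) inside ∷ u) (ahead k₂∈ lt) (s≤s (s≤s z≤n))
    answer : ∃ λ x → ∃ λ xs → Cycle Adj x xs
    answer with any? (c Fin.≟_) part | above₂
    ... | yes c∈ | _         = around k₁∈ above₁ F-k₁∈ c∈
    ... | no  c∉ | inj₁ refl = ⊥-elim (c∉ F-k₂∈)
    ... | no  c∉ | inj₂ lt   = through c∉ lt

  Reached : ℕ → Set
  Reached ℓ = ∃ λ s → ∃ λ c → ∃ λ (h : History s ℓ c) → ∃ λ K → Reads h K × Bounded ℓ K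

  module _ (invol : ∀ i → F (F i) ≡ i × F i ≢ i)
           (acyclic : ¬ (∃ λ x → ∃ λ xs → Cycle Adj x xs))
           (marked : ∀ i → R i ≡ true → Chord i)
           (rooted : ∀ {ℓ M parts} → Components ℓ (M ∷ parts) → (∀ {a} → a ∈ M → toℕ (F a) < ℓ) → marks M ≡ 1) where

    -- The diagram drives the automaton, which can get stuck only at a closing point. A missing
    -- split would give a cycle, and a component losing its last open chord has exactly one mark by
    -- `rooted`.
    reach : ∀ ℓ → ℓ ≤ N → Reached ℓ
    reach zero    _  = [] , 0 , start , [] , start , λ ()
    reach (suc ℓ) lt with reach ℓ (ℕ.<⇒≤ lt)
    ... | s , c , h , K , rd , B with ℕ.<-≤-connex (toℕ i) (toℕ (F i))
      where
      i = fromℕ< lt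
    ... | inj₁ i<Fi = _ , c , push (R i) h , F i ∷ K , push i i≡ℓ refl (proj₁ (invol i)) refl rd , bound
      where
      i = fromℕ< lt
      i≡ℓ = toℕ-fromℕ< lt
      bound : Bounded (suc ℓ) (F i ∷ K)
      bound (here refl) = subst (λ x → suc x ≤ toℕ (F i)) i≡ℓ i<Fi
      bound (there {k} k∈) = ℕ.≤∧≢⇒< (B k∈) λ eq → ℕ.<-asym i<Fi
        (subst (λ a → toℕ (F a) < toℕ i) (toℕ-injective (trans (sym eq) (sym i≡ℓ)))
          (subst (toℕ (F _) <_) (sym i≡ℓ) (proj₂ (partner (pairing rd B) k∈))))
    ... | inj₂ Fi≤i = result
      where
      i = fromℕ< lt
      i≡ℓ = toℕ-fromℕ< lt
      P = pairing rd B
      Fi<i : F i ≺ i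
      Fi<i = ℕ.≤∧≢⇒< Fi≤i λ eq → proj₂ (invol i) (toℕ-injective eq)
      i∈K : i ∈ K
      i∈K = subst (_∈ K) (proj₁ (invol i)) (complete P (subst (toℕ (F i) <_) i≡ℓ Fi<i)
        (subst (λ a → ℓ ≤ toℕ a) (sym (proj₁ (invol i))) (ℕ.≤-reflexive (sym i≡ℓ))))
      insertion : ∀ {x : Point} {K} → x ∈ K → ∃ λ j → ∃ λ K₀ → Insert x j K₀ K
      insertion (here refl) = 0 , _ , here
      insertion (there x∈) with j , K₀ , ins ← insertion x∈ = suc j , _ , there ins
      j = proj₁ (insertion i∈K)
      K₀ = proj₁ (proj₂ (insertion i∈K))
      ins : Insert i j K₀ K
      ins = proj₂ (proj₂ (insertion i∈K))
      B₀ : Bounded (suc ℓ) K₀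
      B₀ = bounded-close i i≡ℓ ins P B
      Ri : R i ≡ false
      Ri with R i in eq
      ... | false = refl
      ... | true  = ⊥-elim (ℕ.<-asym Fi<i (marked i eq))
      I = invariant rd B
      advance : ∀ {j K₀ q r f s c K} {h : History (q ++ s) ℓ c} → Split j q r f → Insert i j K₀ K → Reads h K →
        Pairing ℓ K → Bounded (suc ℓ) K₀ → Invariant ℓ (q ++ s) c K → Reached (suc ℓ)
      advance {r = suc r} sp ins rd P B₀ I = _ , _ , close sp _ , _ , close i i≡ℓ Ri ins rd , B₀
      advance {r = zero} one here rd P B₀ I with M , parts , mk , Q , cl ← finish-part i i≡ℓ P B₀ I
        with refl ← trans (sym mk) (rooted Q cl) = _ , _ , finish _ , _ , finish i i≡ℓ Ri rd , B₀
      result : Reached (suc ℓ)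
      result with findSplit ins (layout I) (sorted P)
      ... | inj₁ (q , s′ , r , f , refl , sp) = advance sp ins rd P B₀ I
      ... | inj₂ conf = ⊥-elim (acyclic (conflict-cycle i i≡ℓ ins P B₀ (partition I)
        (record { Conflict conf ; part∈ = ∈-++⁺ˡ (Conflict.part∈ conf) })))

-- Counting with duplicate-free lists

unique-length-≡ : ∀ {A : Set} {xs ys : List A} → Unique xs → Unique ys →
  (∀ {x} → x ∈ xs → x ∈ ys) → (∀ {x} → x ∈ ys → x ∈ xs) → length xs ≡ length ys
unique-length-≡ u v f g = ↭-length (∼bag⇒↭ (unique∧set⇒bag u v (mk⇔ f g)))

countB-length : ∀ {A : Set} (f : A → Bool) {xs ys} → Unique xs → Unique ys →
  (∀ {x} → x ∈ ys → x ∈ xs × T (f x)) → (∀ {x} → x ∈ xs → T (f x) → x ∈ ys) → countB f xs ≡ length ys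
countB-length f u v g h = unique-length-≡ (Unique.filter⁺ (T? ∘ f) u) v
  (λ p → let x∈ , t = ∈-filter⁻ (T? ∘ f) p in h x∈ t)
  (λ p → let x∈ , t = g p in ∈-filter⁺ (T? ∘ f) x∈ t)

pairs-∈ : ∀ {A : Set} {Q : A → A → Set} {xs x y} → AllPairs Q xs → x ∈ xs → y ∈ xs → x ≡ y ⊎ (Q x y ⊎ Q y x)
pairs-∈ (q ∷ qs) (here refl) (here refl) = inj₁ refl
pairs-∈ (q ∷ qs) (here refl) (there y∈)  = inj₂ (inj₁ (All.lookup q y∈))
pairs-∈ (q ∷ qs) (there x∈)  (here refl) = inj₂ (inj₂ (All.lookup q x∈))
pairs-∈ (q ∷ qs) (there x∈)  (there y∈)  = pairs-∈ qs x∈ y∈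

record Minimum {N} (M : List (Fin N)) (v : Fin N) : Set where
  constructor minimum
  field
    member : v ∈ M
    least  : ∀ {u} → u ∈ M → toℕ v ≤ toℕ u

min-unique : ∀ {N} {M : List (Fin N)} {v w} → Minimum M v → Minimum M w → v ≡ w
min-unique (minimum v∈ v≤) (minimum w∈ w≤) = toℕ-injective (ℕ.≤-antisym (v≤ w∈) (w≤ v∈))

min-exists : ∀ {N} {M : List (Fin N)} {v} → v ∈ M → ∃ (Minimum M)
min-exists {M = x ∷ []} _ = x , minimum (here refl) λ { (here refl) → ℕ.≤-refl }
min-exists {M = x ∷ y ∷ M} _ with w , minimum w∈ w≤ ← min-exists {M = y ∷ M} (here refl) with ℕ.≤-total (toℕ x) (toℕ w)
... | inj₁ x≤w = x , minimum (here refl) λ { (here refl) → ℕ.≤-refl ; (there u∈) → ℕ.≤-trans x≤w (w≤ u∈) }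
... | inj₂ w≤x = w , minimum (there w∈) λ { (here refl) → w≤x ; (there u∈) → w≤ u∈ }

-- The diagrams read by closed histories are the rooted forest diagrams

module Validity {n : ℕ} (p : Inv n) (S : Subset (Pts n)) where
  private
    N = Pts n
    F = lookup p
    R = lookup S
  open Scan F R
  open Scan′ F R
  open Extend F R
  open Reflect {n} p R

  same-part : ∀ {ℓ parts M M′ a} → Components ℓ parts → M ∈ parts → M′ ∈ parts → a ∈ M → a ∈ M′ → M ≡ M′
  same-part Q M∈ M′∈ a∈ a∈′ with pairs-∈ (separate Q) M∈ M′∈
  ... | inj₁ eq = eq
  ... | inj₂ (inj₁ s) = ⊥-elim (proj₁ (s a∈ a∈′) refl)
  ... | inj₂ (inj₂ s) = ⊥-elim (proj₁ (s a∈′ a∈) refl)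

  -- A chord crossing a closed chord was opened before that one closed, so it has been read and lies
  -- in some part. The crossing has been detected, and separation forbids any part but `M`.
  component : ∀ {ℓ parts M} → Components ℓ parts → M ∈ parts → (∀ {a} → a ∈ M → toℕ (F a) < ℓ) → Component M
  component {ℓ} {parts} {M} Q M∈ done = record
    { time = ℓ ; tree = All.lookup (trees Q) M∈ ; closed = closed ; chords = λ a∈ → proj₂ (sound Q M∈ a∈) }
    where
    earlier : ∀ {a b} → a ∈ M → Crosses a b → toℕ b < ℓ
    earlier a∈ (inj₁ (_ , lt , _)) = ℕ.<-trans lt (done a∈)
    earlier a∈ (inj₂ (lt , _))     = ℕ.<-trans lt (proj₁ (sound Q M∈ a∈))
    closed : ∀ {a b} → a ∈ M → Adj a b → b ∈ M
    closed {a} {b} a∈ e@(_ , cb , x) with M′ , M′∈ , b∈ ← cover Q (earlier a∈ x) cb with pairs-∈ (separate Q) M∈ M′∈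
    ... | inj₁ refl = b∈
    ... | inj₂ (inj₁ s) = ⊥-elim (proj₂ (s a∈ b∈) (e , inj₁ (done a∈)))
    ... | inj₂ (inj₂ s) = ⊥-elim (proj₂ (s b∈ a∈) (adj-sym e , inj₂ (done a∈)))

  marks-length : ∀ M → marks M ≡ length (filter (T? ∘ R) M)
  marks-length [] = refl
  marks-length (a ∷ M) with R a
  ... | true  = cong suc (marks-length M)
  ... | false = marks-length M

  component-marks : ∀ {M v} → Component M → v ∈ M →
    countB (λ r → lookup S r ∧ connected {n} p v r) (allFin N) ≡ marks M
  component-marks {M} {v} Q v∈ = trans
    (countB-length (λ r → lookup S r ∧ connected {n} p v r) (Unique.allFin⁺ N)
      (Unique.filter⁺ (T? ∘ R) (tree-unique (Component.tree Q)))
      (λ q → let r∈ , t = ∈-filter⁻ (T? ∘ R) q in ∈-allFin _ , from T-∧ (t , from (T-connected Q v∈) r∈))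
      (λ _ t → let tr , tc = to T-∧ t in ∈-filter⁺ (T? ∘ R) (to (T-connected Q v∈) tc) tr))
    (sym (marks-length M))

  T-matching : T (isMatching {n} p) ⇔ (∀ i → F (F i) ≡ i × F i ≢ i)
  T-matching = mk⇔
    (λ t i → let q = All.lookup (All.all⁺ _ (allFin N) t) (∈-allFin i) ; x , y = to T-∧ q in
      to T-== x , λ e → to T-not y (from T-== e))
    (λ f → All.all⁻ _ {xs = allFin N} (All.tabulate λ {i} _ → from T-∧ (from T-== (proj₁ (f i)) , from T-not λ t → proj₂ (f i) (to T-== t))))

  Rooting : Set
  Rooting = (∀ i → R i ≡ true → Chord i) ×
    (∀ v → Chord v → countB (λ r → lookup S r ∧ connected {n} p v r) (allFin N) ≡ 1)

  private
    markedB rootedB : Fin N → Bool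
    markedB r = not (lookup S r) ∨ isChord {n} p r
    rootedB v = not (isChord {n} p v)
      ∨ ⌊ countB (λ r → lookup S r ∧ connected {n} p v r) (allFin N) ℕ.≟ 1 ⌋

  T-rooting : T (isRooting {n} p S) ⇔ Rooting
  T-rooting = mk⇔ fwd bwd
    where
    fwd : T (isRooting {n} p S) → Rooting
    fwd t with t₁ , t₂ ← to (T-∧ {all markedB (allFin N)}) t = marked , rooted
      where
      marked : ∀ i → R i ≡ true → Chord i
      marked i eq with to T-∨ (All.lookup (All.all⁺ markedB (allFin N) t₁) (∈-allFin i))
      ... | inj₁ q = ⊥-elim (to T-not q (from T-≡ eq))
      ... | inj₂ q = to T-< q
      rooted : ∀ v → Chord v → _ ≡ 1
      rooted v ch with to T-∨ (All.lookup (All.all⁺ rootedB (allFin N) t₂) (∈-allFin v))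
      ... | inj₁ q = ⊥-elim (to T-not q (from T-< ch))
      ... | inj₂ q = toWitness q
    bwd : Rooting → T (isRooting {n} p S)
    bwd (marked , rooted) = from (T-∧ {all markedB (allFin N)})
      ( All.all⁻ markedB {xs = allFin N} (All.tabulate λ {i} _ → m i)
      , All.all⁻ rootedB {xs = allFin N} (All.tabulate λ {v} _ → q v) )
      where
      m : ∀ i → T (markedB i)
      m i with R i in eq
      ... | true  = from (T-< {i = i} {F i}) (marked i eq)
      ... | false = tt
      q : ∀ v → T (rootedB v)
      q v with T? (isChord {n} p v)
      ... | yes t = from (T-∨ {not (isChord {n} p v)}) (inj₂ (fromWitness (rooted v (to T-< t))))
      ... | no ¬t = from (T-∨ {not (isChord {n} p v)}) (inj₁ (from T-not ¬t))

  private
    leaderB : Fin N → Bool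
    leaderB v = isChord {n} p v ∧ not (any (λ u → (u <ᵇ v) ∧ connected {n} p u v) (allFin N))

  module Final {parts : List (List (Fin N))} (Q : Components N parts) where
    comp : ∀ {M} → M ∈ parts → Component M
    comp M∈ = component Q M∈ (λ {a} _ → toℕ<n (F a))

    part-of : ∀ {a} → Chord a → ∃ λ M → M ∈ parts × a ∈ M
    part-of {a} ch = cover Q (toℕ<n a) ch

    T-leader : ∀ {v} → T (leaderB v) ⇔ (∃ λ M → M ∈ parts × Minimum M v)
    T-leader {v} = mk⇔ fwd bwd
      where
      earlierB : Fin N → Bool
      earlierB u = (u <ᵇ v) ∧ connected {n} p u v
      fwd : T (leaderB v) → ∃ λ M → M ∈ parts × Minimum M v
      fwd t with ch , none ← to (T-∧ {isChord {n} p v}) t with M , M∈ , v∈ ← part-of (to T-< ch) =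
        M , M∈ , minimum v∈ λ {u} u∈ → ℕ.≮⇒≥ λ u<v → to T-not none (from (T-any earlierB (allFin N))
          (u , ∈-allFin u , from T-∧ (from T-< u<v , from (T-connected (comp M∈) u∈) v∈)))
      bwd : (∃ λ M → M ∈ parts × Minimum M v) → T (leaderB v)
      bwd (M , M∈ , minimum v∈ v≤) = from (T-∧ {isChord {n} p v})
        ( from T-< (proj₂ (sound Q M∈ v∈)) , from T-not none )
        where
        none : ¬ T (any earlierB (allFin N))
        none t with u , _ , t₁ ← to (T-any earlierB (allFin N)) t with u<v , con ← to T-∧ t₁
          with M′ , M′∈ , u∈ ← part-of (to T-< (proj₁ (to (T-∧ {isChord {n} p u}) con)))
          with refl ← same-part Q M′∈ M∈ (to (T-connected (comp M′∈) u∈) con) v∈ =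
          ℕ.<⇒≱ (to T-< u<v) (v≤ u∈)

    -- The chords counted by `components` are the minima of the parts, one for each part.
    components-length : components {n} p ≡ length parts
    components-length = trans
      (countB-length leaderB (Unique.allFin⁺ N) unique-leaders
        (λ q → ∈-allFin _ , from T-leader (to-part q)) (λ _ t → from-part (to T-leader t)))
      leaders-length
      where
      collect : ∀ Ms → All (Tree (Edge N)) Ms → AllPairs (Separate N) Ms → ∃ λ L → length L ≡ length Ms × Unique L ×
        (∀ {v} → v ∈ L → ∃ λ M → M ∈ Ms × Minimum M v) × (∀ {v} → (∃ λ M → M ∈ Ms × Minimum M v) → v ∈ L)
      collect [] [] [] = [] , refl , [] , (λ ()) , λ { (_ , () , _) }
      collect (M ∷ Ms) (t ∷ ts) (s ∷ ss) with L , len , u , f , g ← collect Ms ts ss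
        with w , min ← min-exists (proj₂ (tree-root t)) =
        w ∷ L , cong suc len
        , All.tabulate (λ {v} v∈ eq → let M′ , M′∈ , m′ = f v∈ in
            proj₁ (All.lookup s M′∈ (Minimum.member min) (Minimum.member m′)) eq) ∷ u
        , (λ { (here refl) → M , here refl , min ; (there v∈) → let M′ , M′∈ , m′ = f v∈ in M′ , there M′∈ , m′ })
        , λ { (_ , here refl , m) → here (min-unique m min) ; (M′ , there M′∈ , m) → there (g (M′ , M′∈ , m)) }
      leaders = collect parts (trees Q) (separate Q)
      leaders-length = proj₁ (proj₂ leaders)
      unique-leaders = proj₁ (proj₂ (proj₂ leaders))
      to-part = proj₁ (proj₂ (proj₂ (proj₂ leaders)))
      from-part = proj₂ (proj₂ (proj₂ (proj₂ leaders)))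

    -- At the end every crossing has been detected. A cycle stays in the part where it starts, since
    -- parts are closed under adjacency, and would be a cycle in a tree.
    forest : T (isForest {n} p)
    forest = from T-not λ t → let x , xs , c = to T-hasCycle t in no-cycle c
      where
      along : ∀ {M} → M ∈ parts → ∀ {x xs y} → Path Adj x xs y → x ∈ M → All (_∈ M) xs
      along M∈ []      x∈ = []
      along M∈ (e ∷ q) x∈ = let y∈ = Component.closed (comp M∈) x∈ e in y∈ ∷ along M∈ q y∈
      adj-edge : ∀ {a b} → Adj a b → Edge N a b
      adj-edge {a} e = e , inj₁ (toℕ<n (F a))
      no-cycle : ∀ {x xs} → Cycle Adj x xs → ⊥
      no-cycle {x} (cycle q u b l) with M , M∈ , x∈ ← part-of (proj₁ (proj₂ b)) =
        tree-acyclic edge-sym (All.lookup (trees Q) M∈)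
          (cycle (path-map adj-edge q) u (adj-edge b) l) (x∈ ∷ along M∈ q x∈)

  layout-[] : ∀ {ℓ s Ms} → Layout ℓ s [] Ms → s ≡ [] × Ms ≡ []
  layout-[] [] = refl , refl

  bounded-N : ∀ {K} → Bounded N K → K ≡ []
  bounded-N {[]}    B = refl
  bounded-N {k ∷ K} B = ⊥-elim (ℕ.<⇒≱ (toℕ<n k) (B (here refl)))

  record Valid (m : ℕ) : Set where
    field
      matching : T (isMatching {n} p)
      acyclic  : T (isForest {n} p)
      count    : components {n} p ≡ m
      rooting  : T (isRooting {n} p S)

  reads-valid : ∀ {c} {h : History [] N c} → Reads h [] → Valid c
  reads-valid rd = valid (invariant rd (λ ())) (pairing rd (λ ()))
    where
    valid : ∀ {c} → Invariant N [] c [] → Pairing N [] → Valid c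
    valid I P with open-parts I | layout I | partition I
    ... | .[] | [] | Q = record
      { matching = from T-matching λ i → involutive P (toℕ<n i)
      ; acyclic = Final.forest Q
      ; count = trans (Final.components-length Q) (done-length I)
      ; rooting = from T-rooting (marked , rooted) }
      where
      marked : ∀ i → R i ≡ true → Chord i
      marked i eq = ℕ.≰⇒> λ Fi≤i → true≢false (trans (sym eq) (unmarked P (toℕ<n i)
        (ℕ.≤∧≢⇒< Fi≤i λ e → proj₂ (involutive P (toℕ<n i)) (toℕ-injective e))))
        where
        true≢false : true ≢ false
        true≢false ()
      rooted : ∀ v → Chord v → countB (λ r → lookup S r ∧ connected {n} p v r) (allFin N) ≡ 1
      rooted v ch with M , M∈ , v∈ ← Final.part-of Q ch =
        trans (component-marks (Final.comp Q M∈) v∈) (All.lookup (done-marks I) M∈)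

  valid-reads : ∀ {m} → Valid m → ∃ λ (h : History [] N m) → Reads h []
  valid-reads V with marked , rooted ← to T-rooting (Valid.rooting V)
    with s , c , h , K , rd , B ← reach (to T-matching (Valid.matching V))
      (λ cyc → to T-not (Valid.acyclic V) (from T-hasCycle cyc)) marked
      (λ Q done → let M = component Q (here refl) done
                      v , v∈ = tree-root (All.lookup (trees Q) (here refl)) in
        trans (sym (component-marks M v∈)) (rooted v (Component.chords M v∈))) N ℕ.≤-refl
    with refl ← bounded-N B with refl , _ ← layout-[] (layout (invariant rd B))
    -- The scan produces some number of finished components. It equals `m` because the history just
    -- found makes the same diagram valid for that number.
    with refl ← trans (sym (Valid.count (reads-valid rd))) (Valid.count V) = h , rd

-- Diagrams correspond to histories

-- `j` fixes the length `j + 1` of the prefix, and the prefix fixes `r` and `f`. This is the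
-- determinism of closing steps.
split-prefix : ∀ {j q q′ r r′ f f′} {s s′ : State} → Split j q r f → Split j q′ r′ f′ → q ++ s ≡ q′ ++ s′ →
  q ≡ q′ × s ≡ s′ × r ≡ r′ × f ≡ f′
split-prefix one one refl = refl , refl , refl , refl
split-prefix (more refl sp) (more refl sp′) eq with refl , eq′ ← ∷-injective eq
  with refl , refl , refl , refl ← split-prefix sp sp′ eq′ = refl , refl , refl , refl

split-unique : ∀ {j q r f} (sp sp′ : Split j q r f) → sp ≡ sp′
split-unique one one = refl
split-unique {q = _ ∷ q} (more p sp) (more p′ sp′)
  with refl , refl , refl , refl ← split-prefix {s = []} {s′ = []} sp sp′ refl
  with refl ← p | refl ← p′ = cong (more refl) (split-unique sp sp′)

SomeHistory : ℕ → Set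
SomeHistory ℓ = Σ State λ s → Σ ℕ λ c → History s ℓ c

close-≡ : ∀ {ℓ j q q′ r r′ f f′ s s′ c c′} (sp : Split j q (suc r) f) (sp′ : Split j q′ (suc r′) f′)
  (h : History (q ++ s) ℓ c) (h′ : History (q′ ++ s′) ℓ c′) →
  _≡_ {A = SomeHistory ℓ} (_ , _ , h) (_ , _ , h′) → _≡_ {A = SomeHistory (suc ℓ)} (_ , _ , close sp h) (_ , _ , close sp′ h′)
close-≡ sp sp′ h h′ eq with refl , refl , refl , refl ← split-prefix sp sp′ (cong proj₁ eq)
  with refl ← split-unique sp sp′ with refl ← eq = refl

module _ {A : Set} where

  insert-functional : ∀ {j} {x : A} {ys zs zs′} → Insert x j ys zs → Insert x j ys zs′ → zs ≡ zs′
  insert-functional here      here       = refl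
  insert-functional (there i) (there i′) = cong (_ ∷_) (insert-functional i i′)

  insert-position : ∀ {j j′} {x : A} {ys ys′ zs} → Unique zs → Insert x j ys zs → Insert x j′ ys′ zs → j ≡ j′ × ys ≡ ys′
  insert-position u        here      here       = refl , refl
  insert-position (x∉ ∷ u) here      (there i′) = ⊥-elim (All.lookup x∉ (insert-∈ i′) refl)
  insert-position (x∉ ∷ u) (there i) here       = ⊥-elim (All.lookup x∉ (insert-∈ i) refl)
  insert-position (x∉ ∷ u) (there i) (there i′) with refl , refl ← insert-position u i i′ = refl , refl

  insertAt : ∀ j (x : A) ys → j ≤ length ys → ∃ λ zs → Insert x j ys zs × length zs ≡ suc (length ys)
  insertAt zero    x ys       _         = x ∷ ys , here , refl
  insertAt (suc j) x (y ∷ ys) (s≤s j≤) with zs , i , len ← insertAt j x ys j≤ = y ∷ zs , there i , cong suc len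

  insert-unique : ∀ {j} {x : A} {ys zs} → Insert x j ys zs → x ∉ ys → Unique ys → Unique zs
  insert-unique here      x∉ u        = All.tabulate (λ { q refl → x∉ q }) ∷ u
  insert-unique (there i) x∉ (y∉ ∷ u) = All.tabulate (λ q → apart (insert-⊇ i q)) ∷ insert-unique i (λ q → x∉ (there q)) u
    where
    apart : ∀ {z} → z ≡ _ ⊎ z ∈ _ → _ ≢ z
    apart (inj₁ refl) refl = x∉ (here refl)
    apart (inj₂ q)    eq   = All.lookup y∉ q eq

module _ {N : ℕ} (F : Fin N → Fin N) (R : Fin N → Bool) where
  open Scan F R

  pairing-unique : ∀ {ℓ K} → Pairing ℓ K → Unique K
  pairing-unique P = AllPairs.map (λ { lt refl → ℕ.<-irrefl refl lt }) (sorted P)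

  private
    clash : ∀ {ℓ s c j K K′} {h : History s ℓ c} i → toℕ i ≡ ℓ → suc ℓ ≤ toℕ (F i) →
      Insert i j K K′ → Reads h K′ → Bounded (suc ℓ) K → ⊥
    clash i eq lt ins rd B =
      ℕ.<-asym lt (proj₂ (partner (pairing rd (bounded-insert eq ins B)) (insert-∈ ins)))

    same : ∀ {ℓ} {i i′ : Point} → toℕ i ≡ ℓ → toℕ i′ ≡ ℓ → i ≡ i′
    same p q = toℕ-injective (trans p (sym q))

  -- The history is recovered from its last point backwards. Comparing `F i` with `i` tells openings
  -- from closings, the position of `i` in the stack gives `j`, and the previous state separates
  -- `finish` from `close`, since they need different top blocks when `j = 0`.
  reads-functional : ∀ {ℓ s s′ c c′ K K′} {h : History s ℓ c} {h′ : History s′ ℓ c′} → Reads h K → Reads h′ K′ →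
    Bounded ℓ K → Bounded ℓ K′ → _≡_ {A = SomeHistory ℓ} (_ , _ , h) (_ , _ , h′) × K ≡ K′
  reads-functional start start _ _ = refl , refl
  reads-functional (push i p refl _ refl rd) (push i′ p′ refl _ refl rd′) B B′ with refl ← same p p′
    with refl , refl ← reads-functional rd rd′ (bounded-tail B) (bounded-tail B′) = refl , refl
  reads-functional (push i p refl _ _ _) (close i′ p′ _ ins rd) B B′ with refl ← same p p′ =
    ⊥-elim (clash i p (B (here refl)) ins rd B′)
  reads-functional (push i p refl _ _ _) (finish i′ p′ _ rd) B B′ with refl ← same p p′ =
    ⊥-elim (clash i p (B (here refl)) here rd B′)
  reads-functional (close i p _ ins rd) (push i′ p′ refl _ _ _) B B′ with refl ← same p p′ =
    ⊥-elim (clash i p (B′ (here refl)) ins rd B)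
  reads-functional (finish i p _ rd) (push i′ p′ refl _ _ _) B B′ with refl ← same p p′ =
    ⊥-elim (clash i p (B′ (here refl)) here rd B)
  reads-functional (close {sp = sp} {h = h} i p _ ins rd) (close {sp = sp′} {h = h′} i′ p′ _ ins′ rd′) B B′ with refl ← same p p′
    with eq , refl ← reads-functional rd rd′ (bounded-insert p ins B) (bounded-insert p ins′ B′)
    with refl , refl ← insert-position (pairing-unique (pairing rd (bounded-insert p ins B))) ins ins′ =
    close-≡ sp sp′ h h′ eq , refl
  reads-functional (finish i p _ rd) (finish i′ p′ _ rd′) B B′ with refl ← same p p′
    with refl , refl ← reads-functional rd rd′ (bounded-insert p here B) (bounded-insert p here B′) = refl , refl
  reads-functional (close {sp = sp} i p _ ins rd) (finish i′ p′ _ rd′) B B′ with refl ← same p p′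
    with eq , refl ← reads-functional rd rd′ (bounded-insert p ins B) (bounded-insert p here B′)
    with refl , refl ← insert-position (pairing-unique (pairing rd (bounded-insert p ins B))) ins here
    with one ← sp with () ← ∷-injectiveˡ (cong proj₁ eq)
  reads-functional (finish i p _ rd) (close {sp = sp} i′ p′ _ ins rd′) B B′ with refl ← same p p′
    with eq , refl ← reads-functional rd rd′ (bounded-insert p here B) (bounded-insert p ins B′)
    with refl , refl ← insert-position (pairing-unique (pairing rd (bounded-insert p here B))) ins here
    with one ← sp with () ← ∷-injectiveˡ (cong proj₁ eq)

-- Apart from the points already read, a run constrains the diagram only at the pending partners in
-- `K`.
record Agree {N} (ℓ : ℕ) (K : List (Fin N)) (F F′ : Fin N → Fin N) (R R′ : Fin N → Bool) : Set where
  field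
    partners : ∀ {i} → toℕ i < ℓ → F i ≡ F′ i
    marks    : ∀ {i} → toℕ i < ℓ → R i ≡ R′ i
    closers  : ∀ {k} → k ∈ K → F k ≡ F′ k
open Agree

module _ {N : ℕ} {F F′ : Fin N → Fin N} {R R′ : Fin N → Bool} where
  open Scan using (start; push; close; finish; split-suc)

  private
    at-most : ∀ {A : Set} {ℓ} {f g : Fin N → A} i → toℕ i ≡ ℓ → f i ≡ g i → (∀ {a} → toℕ a < ℓ → f a ≡ g a) →
      ∀ {a} → toℕ a < suc ℓ → f a ≡ g a
    at-most i refl eq e lt with split-suc F R lt
    ... | inj₁ lt′ = e lt′
    ... | inj₂ p with refl ← toℕ-injective p = eq

  reads-agree : ∀ {s ℓ c K} {h : History s ℓ c} → Scan.Reads F R h K → Scan.Reads F′ R′ h K → Agree ℓ K F F′ R R′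
  reads-agree start start = record { partners = λ () ; marks = λ () ; closers = λ () }
  reads-agree (push i p Fi Fk Ri rd) (push i′ p′ Fi′ Fk′ Ri′ rd′) with refl ← toℕ-injective (trans p (sym p′)) = record
    { partners = at-most i p (trans Fi (sym Fi′)) (partners A)
    ; marks = at-most i p (trans Ri (sym Ri′)) (marks A)
    ; closers = λ { (here refl) → trans Fk (sym Fk′) ; (there q) → closers A q } }
    where A = reads-agree rd rd′
  reads-agree (close i p Ri ins rd) (close i′ p′ Ri′ ins′ rd′) with refl ← toℕ-injective (trans p (sym p′))
    with refl ← insert-functional ins ins′ = record
    { partners = at-most i p (closers A (insert-∈ ins)) (partners A)
    ; marks = at-most i p (trans Ri (sym Ri′)) (marks A)
    ; closers = λ q → closers A (insert-⊆ ins q) }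
    where A = reads-agree rd rd′
  reads-agree (finish i p Ri rd) (finish i′ p′ Ri′ rd′) with refl ← toℕ-injective (trans p (sym p′)) = record
    { partners = at-most i p (closers A (here refl)) (partners A)
    ; marks = at-most i p (trans Ri (sym Ri′)) (marks A)
    ; closers = λ q → closers A (there q) }
    where A = reads-agree rd rd′

  -- The list before the last step consists of entries of `K` and possibly the point being read, so
  -- agreement passes down to it.
  reads-resp : ∀ {s ℓ c K} {h : History s ℓ c} → Agree ℓ K F F′ R R′ → Scan.Reads F R h K → Scan.Reads F′ R′ h K
  reads-resp A start = start
  reads-resp A (push i refl Fi Fk Ri rd) = push i refl
    (trans (sym (partners A ℕ.≤-refl)) Fi) (trans (sym (closers A (here refl))) Fk) (trans (sym (marks A ℕ.≤-refl)) Ri)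
    (reads-resp (record { partners = λ lt → partners A (ℕ.m≤n⇒m≤1+n lt) ; marks = λ lt → marks A (ℕ.m≤n⇒m≤1+n lt)
                        ; closers = λ q → closers A (there q) }) rd)
  reads-resp A (close i refl Ri ins rd) = close i refl (trans (sym (marks A ℕ.≤-refl)) Ri) ins
    (reads-resp (record { partners = λ lt → partners A (ℕ.m≤n⇒m≤1+n lt) ; marks = λ lt → marks A (ℕ.m≤n⇒m≤1+n lt)
                        ; closers = λ q → inserted (insert-⊇ ins q) }) rd)
    where
    inserted : ∀ {k} → k ≡ i ⊎ k ∈ _ → F k ≡ F′ k
    inserted (inj₁ refl) = partners A ℕ.≤-refl
    inserted (inj₂ q)    = closers A q
  reads-resp A (finish i refl Ri rd) = finish i refl (trans (sym (marks A ℕ.≤-refl)) Ri)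
    (reads-resp (record { partners = λ lt → partners A (ℕ.m≤n⇒m≤1+n lt) ; marks = λ lt → marks A (ℕ.m≤n⇒m≤1+n lt)
                        ; closers = λ { (here refl) → partners A ℕ.≤-refl ; (there q) → closers A q } }) rd)

-- Every history is realised by a diagram

size : State → ℕ
size []            = 0
size ((b , _) ∷ s) = suc b ℕ.+ size s

split-size : ∀ {j q r f} s → Split j q r f → size (q ++ s) ≡ suc r ℕ.+ size s × j ≤ r
split-size s one         = refl , z≤n
split-size s (more _ sp) with eq , le ← split-size s sp = cong suc eq , s≤s le

module _ {N : ℕ} where

  private
    inserted : ∀ {ℓ K} (lt : ℓ < N) → (∀ {k} → k ∈ K → suc ℓ ≤ toℕ k) → ∀ {k} → k ≡ fromℕ< lt ⊎ k ∈ K → ℓ ≤ toℕ k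
    inserted lt B (inj₁ refl) = ℕ.≤-reflexive (sym (toℕ-fromℕ< lt))
    inserted lt B (inj₂ q)    = ℕ.<⇒≤ (B q)

    unmark : Fin N → (Fin N → Bool) → Fin N → Bool
    unmark i R a with a Fin.≟ i
    ... | yes _ = false
    ... | no  _ = R a

    unmark-same : ∀ i R → unmark i R i ≡ false
    unmark-same i R with i Fin.≟ i
    ... | yes _ = refl
    ... | no ¬p = ⊥-elim (¬p refl)

    unmark-other : ∀ {i a} R → a ≢ i → R a ≡ unmark i R a
    unmark-other {i} {a} R a≢i with a Fin.≟ i
    ... | yes p = ⊥-elim (a≢i p)
    ... | no  _ = refl

    unmark-reads : ∀ {s ℓ c K F R i} {h : History s ℓ c} → toℕ i ≡ ℓ → Scan.Reads F R h K → Scan.Reads F (unmark i R) h K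
    unmark-reads {R = R} p = reads-resp (record
      { partners = λ _ → refl ; marks = λ lt → unmark-other R (λ { refl → ℕ.<-irrefl p lt }) ; closers = λ _ → refl })

  -- The history is unwound from its end with the future partners `K` prescribed: undoing a closing
  -- puts the current point into the list, and undoing `push` pairs the current point with the head.
  -- The values outside the run, identity and `false`, are defaults that a complete run overwrites
  -- everywhere.
  realize : ∀ {s ℓ c} (h : History s ℓ c) K → length K ≡ size s → Unique K → (∀ {k} → k ∈ K → ℓ ≤ toℕ k) → ℓ ≤ N →
    ∃ λ (F : Fin N → Fin N) → ∃ λ (R : Fin N → Bool) → Scan.Reads F R h K
  realize start [] _ _ _ _ = (λ i → i) , (λ _ → false) , Scan.start
  realize {ℓ = suc ℓ} (push x h) (k ∷ K) len (k∉ ∷ u) B lt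
    with F , R , rd ← realize h K (ℕ.suc-injective len) u (λ q → ℕ.<⇒≤ (B (there q))) (ℕ.<⇒≤ lt) =
    F′ , R′ , Scan.push i i≡ℓ F′-i F′-k R′-i (reads-resp (record
      { partners = λ {a} a<ℓ → sym (F′-other (λ { refl → ℕ.<-irrefl i≡ℓ a<ℓ })
          (λ { refl → ℕ.<-asym a<ℓ (B (here refl)) }))
      ; marks = λ {a} a<ℓ → sym (R′-other (λ { refl → ℕ.<-irrefl i≡ℓ a<ℓ }))
      ; closers = λ {a} a∈ → sym (F′-other (λ { refl → ℕ.<-irrefl (sym i≡ℓ) (B (there a∈)) })
          (λ { refl → All.lookup k∉ a∈ refl })) }) rd)
    where
    i = fromℕ< lt
    i≡ℓ = toℕ-fromℕ< lt
    F′ : Fin N → Fin N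
    F′ a with a Fin.≟ i | a Fin.≟ k
    ... | yes _ | _     = k
    ... | no  _ | yes _ = i
    ... | no  _ | no  _ = F a
    R′ : Fin N → Bool
    R′ a with a Fin.≟ i
    ... | yes _ = x
    ... | no  _ = R a
    k≢i : k ≢ i
    k≢i refl = ℕ.<-irrefl (sym i≡ℓ) (B (here refl))
    F′-i : F′ i ≡ k
    F′-i with i Fin.≟ i | i Fin.≟ k
    ... | yes _ | _ = refl
    ... | no ¬p | _ = ⊥-elim (¬p refl)
    F′-k : F′ k ≡ i
    F′-k with k Fin.≟ i | k Fin.≟ k
    ... | yes p | _     = ⊥-elim (k≢i p)
    ... | no  _ | yes _ = refl
    ... | no  _ | no ¬p = ⊥-elim (¬p refl)
    F′-other : ∀ {a} → a ≢ i → a ≢ k → F′ a ≡ F a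
    F′-other {a} a≢i a≢k with a Fin.≟ i | a Fin.≟ k
    ... | yes p | _     = ⊥-elim (a≢i p)
    ... | no  _ | yes p = ⊥-elim (a≢k p)
    ... | no  _ | no  _ = refl
    R′-i : R′ i ≡ x
    R′-i with i Fin.≟ i
    ... | yes _ = refl
    ... | no ¬p = ⊥-elim (¬p refl)
    R′-other : ∀ {a} → a ≢ i → R′ a ≡ R a
    R′-other {a} a≢i with a Fin.≟ i
    ... | yes p = ⊥-elim (a≢i p)
    ... | no  _ = refl
  realize {ℓ = suc ℓ} (close {j = j} {q = q} {s = s} sp h) K len u B lt
    with size-q , j≤ ← split-size s sp
    -- The `j` crossed chords stay open, so position `j` exists in `K`.
    with K′ , ins , len′ ← insertAt j (fromℕ< lt) K (ℕ.≤-trans (ℕ.≤-trans j≤ (ℕ.m≤m+n _ _)) (ℕ.≤-reflexive (sym len)))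
    with F , R , rd ← realize h K′ (trans len′ (trans (cong suc len) (sym size-q)))
      (insert-unique ins (λ p → ℕ.<-irrefl (sym (toℕ-fromℕ< lt)) (B p)) u)
      (λ p → inserted lt B (insert-⊇ ins p)) (ℕ.<⇒≤ lt) =
    F , unmark (fromℕ< lt) R , Scan.close (fromℕ< lt) (toℕ-fromℕ< lt) (unmark-same (fromℕ< lt) R) ins (unmark-reads (toℕ-fromℕ< lt) rd)
  realize {ℓ = suc ℓ} (finish h) K len u B lt
    with F , R , rd ← realize h (fromℕ< lt ∷ K) (cong suc len)
      (insert-unique here (λ p → ℕ.<-irrefl (sym (toℕ-fromℕ< lt)) (B p)) u)
      (λ p → inserted lt B (insert-⊇ here p)) (ℕ.<⇒≤ lt) =
    F , unmark (fromℕ< lt) R , Scan.finish (fromℕ< lt) (toℕ-fromℕ< lt) (unmark-same (fromℕ< lt) R) (unmark-reads (toℕ-fromℕ< lt) rd)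

-- The diagrams counted by `r` are in bijection with closed histories

module Decode (n : ℕ) where
  private N = Pts n

  Candidate : Set
  Candidate = Inv n × Subset N

  Accepts : ∀ {m} → History [] N m → Candidate → Set
  Accepts h (p , S) = Scan.Reads (lookup p) (lookup S) h []

  decode : ∀ {m} (h : History [] N m) → ∃ (Accepts h)
  decode h with F , R , rd ← realize h [] refl [] (λ ()) ℕ.≤-refl =
    (tabulate F , tabulate R) , reads-resp (record
      { partners = λ {i} _ → sym (lookup∘tabulate F i) ; marks = λ {i} _ → sym (lookup∘tabulate R i) ; closers = λ () }) rd

  lookup-injective : ∀ {A : Set} {k} {u v : Vec A k} → (∀ i → lookup u i ≡ lookup v i) → u ≡ v
  lookup-injective {u = u} {v} e = trans (sym (tabulate∘lookup u)) (trans (tabulate-cong e) (tabulate∘lookup v))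

  accepts-functional : ∀ {m} {h h′ : History [] N m} {x} → Accepts h x → Accepts h′ x → h ≡ h′
  accepts-functional {x = p , S} rd rd′ with refl , _ ← reads-functional (lookup p) (lookup S) rd rd′ (λ ()) (λ ()) = refl

  accepts-injective : ∀ {m} {h : History [] N m} {x x′} → Accepts h x → Accepts h x′ → x ≡ x′
  accepts-injective rd rd′ = cong₂ _,_
    (lookup-injective λ i → partners A (toℕ<n i)) (lookup-injective λ i → marks A (toℕ<n i))
    where A = reads-agree rd rd′

  candidates : List Candidate
  candidates = concatMap (λ p → map (p ,_) (allSubsets N)) (allVecs {N} N)

  private
    unique-product : ∀ {A B Q : Set} (f : A → B → Q) → (∀ {a a′ b b′} → f a b ≡ f a′ b′ → a ≡ a′ × b ≡ b′) →
      ∀ {xs ys} → Unique xs → Unique ys → Unique (concatMap (λ a → map (f a) ys) xs)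
    unique-product f inj {xs} {ys} u v = Unique.concat⁺
      (All.map⁺ (All.tabulate {xs = xs} λ _ → Unique.map⁺ (λ e → proj₂ (inj e)) v))
      (AllPairs.map⁺ (AllPairs.map (λ a≢ {x} → apart a≢ {x}) u))
      where
      apart : ∀ {a a′} → a ≢ a′ → ∀ {x} → ¬ (x ∈ map (f a) ys × x ∈ map (f a′) ys)
      apart {a} {a′} a≢ (p , q) with _ , _ , e ← ∈-map⁻ (f a) p | _ , _ , e′ ← ∈-map⁻ (f a′) q =
        a≢ (proj₁ (inj (trans (sym e) e′)))

    ∷-inj : ∀ {A : Set} {k} {a a′ : A} {v v′ : Vec A k} → a ∷ v ≡ a′ ∷ v′ → a ≡ a′ × v ≡ v′
    ∷-inj refl = refl , refl

    unique-allVecs : ∀ {M} k → Unique (allVecs {M} k)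
    unique-allVecs zero    = [] ∷ []
    unique-allVecs {M} (suc k) = unique-product _∷_ ∷-inj (Unique.allFin⁺ M) (unique-allVecs k)

    unique-allSubsets : ∀ k → Unique (allSubsets k)
    unique-allSubsets zero    = [] ∷ []
    unique-allSubsets (suc k) = unique-product _∷_ ∷-inj (((λ ()) ∷ []) ∷ ([] ∷ [])) (unique-allSubsets k)

    ∈-allSubsets : ∀ k (v : Vec Bool k) → v ∈ allSubsets k
    ∈-allSubsets zero    []      = here refl
    ∈-allSubsets (suc k) (b ∷ v) = ∈-concatMap⁺ (λ b → map (b ∷_) (allSubsets k))
      (lose (∈-bool b) (∈-map⁺ (b ∷_) (∈-allSubsets k v)))
      where
      ∈-bool : ∀ b → b ∈ true ∷ false ∷ []
      ∈-bool true  = here refl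
      ∈-bool false = there (here refl)

  candidates-unique : Unique candidates
  candidates-unique = unique-product _,_ ,-injective (unique-allVecs N) (unique-allSubsets N)

  ∈-candidates : ∀ x → x ∈ candidates
  ∈-candidates (p , S) = ∈-concatMap⁺ (λ p → map (p ,_) (allSubsets N))
    (lose (∈-allVecs N p) (∈-map⁺ (p ,_) (∈-allSubsets N S)))

  module _ (m : ℕ) where
    opaque
      accepted : Candidate → Bool
      accepted (p , S) = isMatching {n} p ∧ isForest {n} p ∧ ⌊ components {n} p ℕ.≟ m ⌋ ∧ isRooting {n} p S

      r-accepted : r n m ≡ countB accepted candidates
      r-accepted = refl

      T-accepted : ∀ {p S} → T (accepted (p , S)) ⇔ Validity.Valid {n} p S m
      T-accepted {p} {S} = mk⇔ fwd bwd
        where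
        rest₁ rest₂ rest₃ : Bool
        rest₁ = isForest {n} p ∧ rest₂
        rest₂ = ⌊ components {n} p ℕ.≟ m ⌋ ∧ rest₃
        rest₃ = isRooting {n} p S
        fwd : T (accepted (p , S)) → Validity.Valid {n} p S m
        fwd t = record { matching = proj₁ t₁ ; acyclic = proj₁ t₂ ; count = toWitness {a? = components {n} p ℕ.≟ m} (proj₁ t₃)
                       ; rooting = proj₂ t₃ }
          where
          t₁ : T (isMatching {n} p) × T rest₁
          t₁ = to (T-∧ {isMatching {n} p} {rest₁}) t
          t₂ : T (isForest {n} p) × T rest₂
          t₂ = to (T-∧ {isForest {n} p} {rest₂}) (proj₂ t₁)
          t₃ : T ⌊ components {n} p ℕ.≟ m ⌋ × T rest₃
          t₃ = to (T-∧ {⌊ components {n} p ℕ.≟ m ⌋} {rest₃}) (proj₂ t₂)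
        bwd : Validity.Valid {n} p S m → T (accepted (p , S))
        bwd V = from (T-∧ {isMatching {n} p} {rest₁}) (matching , from (T-∧ {isForest {n} p} {rest₂}) (acyclic ,
          from (T-∧ {⌊ components {n} p ℕ.≟ m ⌋} {rest₃}) (fromWitness {a? = components {n} p ℕ.≟ m} count , rooting)))
          where open Validity.Valid V

    private
      abstract
        enumeration : History [] N m ↔ Fin (countHistories [] N m)
        enumeration = histories↔ [] N m

      open Inverse enumeration using () renaming (to to index; from to history)

      diagram : Fin (countHistories [] N m) → Candidate
      diagram i = proj₁ (decode (history i))

      diagram-reads : ∀ i → Accepts (history i) (diagram i)
      diagram-reads i = proj₂ (decode (history i))

      diagram-injective : ∀ {i j} → diagram i ≡ diagram j → i ≡ j
      diagram-injective {i} {j} eq = trans (sym (Inverse.strictlyInverseˡ enumeration i))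
        (trans (cong index (accepts-functional {h = history i} {h′ = history j} {x = diagram i}
            (diagram-reads i) (subst (Accepts (history j)) (sym eq) (diagram-reads j))))
          (Inverse.strictlyInverseˡ enumeration j))

      diagram-index : ∀ {x} h → Accepts h x → diagram (index h) ≡ x
      diagram-index {x} h rd = accepts-injective {h = history (index h)} {x = diagram (index h)} {x′ = x} (diagram-reads (index h))
        (subst (λ h → Accepts h x) (sym (Inverse.strictlyInverseʳ enumeration h)) rd)

      reads-accepted : ∀ {x} (h : History [] N m) → Accepts h x → T (accepted x)
      reads-accepted {p , S} h rd = from (T-accepted {p} {S}) (Validity.reads-valid {n} p S rd)

      accepted-reads : ∀ x → T (accepted x) → ∃ λ (h : History [] N m) → Accepts h x
      accepted-reads (p , S) t = Validity.valid-reads {n} p S (to (T-accepted {p} {S}) t)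

      sound : ∀ {x} → x ∈ List.tabulate diagram → x ∈ candidates × T (accepted x)
      sound {x} x∈ = let i , eq = ∈-tabulate⁻ x∈ in
        ∈-candidates x , subst (λ x → T (accepted x)) {x = diagram i} (sym eq) (reads-accepted {diagram i} (history i) (diagram-reads i))

      complete : ∀ {x} → x ∈ candidates → T (accepted x) → x ∈ List.tabulate diagram
      complete {x} _ t = let h , rd = accepted-reads x t in
        subst (_∈ List.tabulate diagram) (diagram-index {x} h rd) (∈-tabulate⁺ {f = diagram} (index h))

    -- `diagram` lists the accepted candidates without repetition: a diagram determines its history,
    -- and a history read to the end determines its diagram.
    r≡countHistories : r n m ≡ countHistories [] N m
    r≡countHistories = trans r-accepted (trans
      (countB-length accepted candidates-unique (Unique.tabulate⁺ {f = diagram} diagram-injective) sound complete)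
      (length-tabulate diagram))

open import Data.Rational using (_*_; _+_)

theorem2 : (n m : ℕ) → .{{_ : NonZero m}} → m ≤ n →
    (+ r n m) / 1 ≡ ((+ ((2 ℕ.* n) C (m ∸ 1))) / m) * (Σ₁ n m + Σ₂ n m)
theorem2 n m m≤n = trans (cong (λ x → (+ x) / 1) (Decode.r≡countHistories n m)) (closed-formula n m m≤n)
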